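{- Let $\alpha>0$. Then $$\dim_{\mathrm{H}}\left\{x\in(0,1]:\lim_{n\to\infty}\frac{L_n(x)}{\log_2 n}=\alpha\right\}=1,$$ where $L_n(x)=\max\{d_i(x):1\le i\le n\}$.
   Context: $\mathbb{N}=\{1,2,3,\dots\}$; $\dim_{\mathrm{H}}$ denotes Hausdorff dimension. Every $x\in(0,1]$ has a unique expansion $x=\sum_{i=1}^{\infty}2^{ -(d_1(x)+d_2(x)+\cdots+d_i(x))}$ with all $d_i(x)\in\mathbb{N}$ (the power-2-decaying Gauss-like expansion); this defines the digit functions $d_i:(0,1]\to\mathbb{N}$. Equivalently, with $T:(0,1]\to(0,1]$ given by $Tx=2^nx-1$ for $x\in(2^{ -n},2^{ -(n-1)}]$, $n\in\mathbb{N}$, the digit $d_i(x)$ is the unique $n\in\mathbb{N}$ with $T^{i-1}x\in(2^{ -n},2^{ -(n-1)}]$. -}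

module Defs where

open import Data.Integer.Base using (+_) renaming (∣_∣ to absℤ)
open import Data.Nat.Base as ℕ using (ℕ; zero; suc)
open import Data.Product.Base using (Σ-syntax; ∃-syntax; _×_; _,_)
open import Data.Rational.Base as ℚ using (ℚ; 0ℚ; 1ℚ; ½; ↥_; ↧ₙ_)
import Data.Rational.Properties as ℚ
open import Algebra.Definitions.RawSemiring ℚ.+-*-rawSemiring using () renaming (_^_ to _^ℚ_)
open import Data.Sum.Base using (_⊎_; inj₁; inj₂)
open import Level using (0ℓ; Lift) renaming (suc to lsuc)
open import Relation.Binary.Definitions using (tri<; tri≈; tri>)
open import Relation.Binary.PropositionalEquality using (refl)
open import Relation.Nullary.Negation using (¬_)
open import Relation.Unary using (Pred; _∈_)

-- A real number is a Dedekind cut.  `Below x q` reads q < x and `Above x q`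
-- reads x < q.  The operations are defined on arbitrary pairs of predicates;
-- on cuts satisfying IsDedekind (and, where stated, in the given range of
-- arguments) they are the usual operations on reals.

record Cut : Set₁ where
  constructor ⟪_,_⟫
  field
    Below : Pred ℚ 0ℓ
    Above : Pred ℚ 0ℓ

open Cut public

record IsDedekind (x : Cut) : Set where
  field
    below-inhabited : ∃[ q ] Below x q
    above-inhabited : ∃[ q ] Above x q
    below-lower     : ∀ {p q} → p ℚ.< q → Below x q → Below x p
    above-upper     : ∀ {p q} → p ℚ.< q → Above x p → Above x q
    below-open      : ∀ {p} → Below x p → ∃[ q ] p ℚ.< q × Below x q
    above-open      : ∀ {q} → Above x q → ∃[ p ] p ℚ.< q × Above x p
    disjoint        : ∀ {q} → ¬ (Below x q × Above x q)
    located         : ∀ {p q} → p ℚ.< q → Below x p ⊎ Above x q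

record ℝ : Set₁ where
  field
    cut        : Cut
    isDedekind : IsDedekind cut

open ℝ public

infix 4 _<_ _≤_

_<_ : Cut → Cut → Set
x < y = ∃[ q ] Above x q × Below y q

_≤_ : Cut → Cut → Set
x ≤ y = ¬ (y < x)

ι : ℚ → Cut
ι p = ⟪ (λ q → q ℚ.< p) , (λ q → p ℚ.< q) ⟫

fromℚ : ℚ → ℝ
fromℚ p = record
  { cut        = ι p
  ; isDedekind = record
    { below-inhabited = p ℚ.- 1ℚ , p-1<p
    ; above-inhabited = p ℚ.+ 1ℚ , p<p+1
    ; below-lower     = ℚ.<-trans
    ; above-upper     = λ r<q p<r → ℚ.<-trans p<r r<q
    ; below-open      = ℚ.<-dense
    ; above-open      = λ p<q → let m , p<m , m<q = ℚ.<-dense p<q in m , m<q , p<m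
    ; disjoint        = λ (q<p , p<q) → ℚ.<-asym q<p p<q
    ; located         = λ {q} {r} q<r → located′ q r q<r
    }
  }
  where
  open ℚ.≤-Reasoning

  p-1<p : p ℚ.- 1ℚ ℚ.< p
  p-1<p = begin-strict
    p ℚ.- 1ℚ  <⟨ ℚ.+-monoʳ-< p (ℚ.negative⁻¹ (ℚ.- 1ℚ)) ⟩
    p ℚ.+ 0ℚ  ≡⟨ ℚ.+-identityʳ p ⟩
    p         ∎

  p<p+1 : p ℚ.< p ℚ.+ 1ℚ
  p<p+1 = begin-strict
    p         ≡⟨ ℚ.+-identityʳ p ⟨
    p ℚ.+ 0ℚ  <⟨ ℚ.+-monoʳ-< p (ℚ.positive⁻¹ 1ℚ) ⟩
    p ℚ.+ 1ℚ  ∎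

  located′ : ∀ q r → q ℚ.< r → q ℚ.< p ⊎ p ℚ.< r
  located′ q r q<r with ℚ.<-cmp q p
  ... | tri< q<p _ _  = inj₁ q<p
  ... | tri≈ _ refl _ = inj₂ q<r
  ... | tri> _ _ p<q  = inj₂ (ℚ.<-trans p<q q<r)

fromℕ : ℕ → ℚ
fromℕ n = + n ℚ./ 1

0ℝ 1ℝ : ℝ
0ℝ = fromℚ 0ℚ
1ℝ = fromℚ 1ℚ

infixl 6 _+_ _-_
infixl 7 _÷_
infixr 8 _^_

_+_ : Cut → Cut → Cut
x + y = ⟪ (λ c → ∃[ a ] ∃[ b ] Below x a × Below y b × c ℚ.< a ℚ.+ b)
        , (λ c → ∃[ a ] ∃[ b ] Above x a × Above y b × a ℚ.+ b ℚ.< c) ⟫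

_-_ : Cut → Cut → Cut
x - y = ⟪ (λ c → ∃[ a ] ∃[ b ] Below x a × Above y b × c ℚ.< a ℚ.- b)
        , (λ c → ∃[ a ] ∃[ b ] Above x a × Below y b × a ℚ.- b ℚ.< c) ⟫

∣_∣ : Cut → Cut
∣ x ∣ = ⟪ (λ c → c ℚ.< 0ℚ ⊎ Below x c ⊎ Above x (ℚ.- c))
        , (λ c → Above x c × Below x (ℚ.- c)) ⟫

-- Quotient, for x ≥ 0 and y > 0.
_÷_ : Cut → Cut → Cut
x ÷ y = ⟪ (λ c → c ℚ.< 0ℚ ⊎ ∃[ a ] ∃[ b ] Below x a × Above y b × c ℚ.* b ℚ.< a)
        , (λ c → ∃[ a ] ∃[ b ] Above x a × Below y b × 0ℚ ℚ.< b × a ℚ.< c ℚ.* b) ⟫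

-- For rationals b, c ≥ 0 and t = m / n ≥ 0 in lowest terms, c < bᵗ means
-- cⁿ < bᵐ, and bᵗ < c means bᵐ < cⁿ.

infix 4 _<⟨_⟩^_ ⟨_⟩^_<_

_<⟨_⟩^_ : ℚ → ℚ → ℚ → Set
c <⟨ b ⟩^ t = c ^ℚ (↧ₙ t) ℚ.< b ^ℚ absℤ (↥ t)

⟨_⟩^_<_ : ℚ → ℚ → ℚ → Set
⟨ b ⟩^ t < c = b ^ℚ absℤ (↥ t) ℚ.< c ^ℚ (↧ₙ t)

-- The power xˢ, for x ≥ 0 and s > 0 (so 0ˢ = 0).  Since bᵗ increases with t
-- when b ≥ 1 and decreases when b ≤ 1, a bound is required at rational
-- exponents on both sides of s.
_^_ : Cut → Cut → Cut
x ^ s =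
  ⟪ (λ c → c ℚ.< 0ℚ ⊎
       ∃[ b ] ∃[ t ] ∃[ t′ ] 0ℚ ℚ.< b × 0ℚ ℚ.< t ×
         Below x b × Below s t × Above s t′ × (c <⟨ b ⟩^ t) × (c <⟨ b ⟩^ t′))
  , (λ c → 0ℚ ℚ.< c ×
       ∃[ b ] ∃[ t ] ∃[ t′ ] 0ℚ ℚ.< t ×
         Above x b × Below s t × Above s t′ × (⟨ b ⟩^ t < c) × (⟨ b ⟩^ t′ < c)) ⟫

-- The base-2 logarithm of a natural number n ≥ 1: c < log₂ n iff 2ᶜ < n.
log₂ : ℕ → Cut
log₂ n = ⟪ (λ c → c ℚ.< 0ℚ ⊎ (⟨ fromℕ 2 ⟩^ c < fromℕ n))
         , (λ c → 0ℚ ℚ.≤ c × (fromℕ n <⟨ fromℕ 2 ⟩^ c)) ⟫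

Lim : (ℕ → Cut) → Cut → Set
Lim f v = ∀ (ε : ℚ) → 0ℚ ℚ.< ε →
  ∃[ N ] ∀ n → N ℕ.≤ n → ∣ f n - v ∣ < ι ε

partialSum : (ℕ → Cut) → ℕ → Cut
partialSum f zero    = ι 0ℚ
partialSum f (suc n) = partialSum f n + f n

HasSum : (ℕ → Cut) → Cut → Set
HasSum f v = Lim (partialSum f) v

-- Suprema and infima of families: v bounds the family, and every rational
-- strictly on the other side of v is passed by some member.

IsSup : ∀ {a} {I : Set a} → (I → Cut) → Cut → Set a
IsSup f v = (∀ i → f i ≤ v) × (∀ q → Below v q → ∃[ i ] Below (f i) q)

IsInf : ∀ {a} {I : Set a} → (I → Cut) → Cut → Set a
IsInf f v = (∀ i → v ≤ f i) × (∀ q → Above v q → ∃[ i ] Above (f i) q)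

Subset : Set₂
Subset = Pred ℝ (lsuc 0ℓ)

IsDiameter : Subset → ℝ → Set₁
IsDiameter U r =
  IsSup {I = Σ[ x ∈ ℝ ] Σ[ y ∈ ℝ ] x ∈ U × y ∈ U}
        (λ (x , y , _) → ∣ cut x - cut y ∣) (cut r)

-- Covers are indexed by all of ℕ, and IsDiameter forces their members to be
-- inhabited.  Finite covers and empty members are not lost: since only
-- exponents s > 0 are used, filling up with singletons adds terms 0ˢ = 0.
record DeltaCover (δ : ℝ) (E : Subset) : Set₂ where
  field
    member     : ℕ → Subset
    diam       : ℕ → ℝ
    isDiameter : ∀ i → IsDiameter (member i) (diam i)
    diam≤δ     : ∀ i → cut (diam i) ≤ cut δ
    covers     : ∀ {x} → x ∈ E → ∃[ i ] x ∈ member i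

open DeltaCover public

-- h = H^s_δ(E) = inf Σᵢ (diam Uᵢ)ˢ over all δ-covers of E.  Covers whose sum
-- diverges have value +∞ and do not affect a finite infimum.
IsPremeasure : (s δ : ℝ) → Subset → ℝ → Set₂
IsPremeasure s δ E h =
  IsInf {I = Σ[ C ∈ DeltaCover δ E ] Σ[ v ∈ ℝ ]
               HasSum (λ i → cut (diam C i) ^ cut s) (cut v)}
        (λ (_ , v , _) → cut v) (cut h)

-- v = H^s(E) = lim_{δ→0} H^s_δ(E) = sup_{δ>0} H^s_δ(E), for finite v.
IsHausdorffMeasure : (s : ℝ) → Subset → ℝ → Set₂
IsHausdorffMeasure s E v =
  Σ[ h ∈ ((δ : ℝ) → cut 0ℝ < cut δ → ℝ) ]
    (∀ δ δ>0 → IsPremeasure s δ E (h δ δ>0)) ×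
    IsSup {I = Σ[ δ ∈ ℝ ] cut 0ℝ < cut δ} (λ (δ , δ>0) → cut (h δ δ>0)) (cut v)

-- d = dim_H E = inf {s : H^s(E) = 0}.  Leaving out s = 0 does not change the
-- infimum, as H^0(E) = 0 only for empty E.
IsHausdorffDimension : Subset → ℝ → Set₂
IsHausdorffDimension E d =
  IsInf {I = Σ[ s ∈ ℝ ] cut 0ℝ < cut s × IsHausdorffMeasure s E 0ℝ}
        (λ (s , _) → cut s) (cut d)

-- Digit sequences are indexed from 0, so d i stands for the digit d_{i+1}.

digitSum : (ℕ → ℕ) → ℕ → ℕ
digitSum d zero    = d zero
digitSum d (suc i) = digitSum d i ℕ.+ d (suc i)

-- d is the digit sequence of x ∈ (0,1].
IsExpansion : ℝ → (ℕ → ℕ) → Set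
IsExpansion x d =
  (∀ i → 1 ℕ.≤ d i) × HasSum (λ i → ι (½ ^ℚ digitSum d i)) (cut x)

-- The maximum of the first n digits (0 for n = 0).
maxDigit : (ℕ → ℕ) → ℕ → ℕ
maxDigit d zero    = 0
maxDigit d (suc n) = maxDigit d n ℕ.⊔ d n

-- {x ∈ (0,1] : L_n(x) / log₂ n → α}.  The expansion of x being unique, the
-- existential picks out the digit sequence of x.
MaxDigitSet : ℝ → Subset
MaxDigitSet α x = Lift (lsuc 0ℓ)
  ( cut 0ℝ < cut x × cut x ≤ cut 1ℝ ×
    ∃[ d ] IsExpansion x d ×
           Lim (λ n → ι (fromℕ (maxDigit d n)) ÷ log₂ n) (cut α) )

{-# OPTIONS --safe #-}
module Submission where

-- Upper bound: for s = 1 + 1/k and r = 2^(-kl) the power rˢ is rational, and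
-- about 2/r intervals of length r cover (0,1] with total about 2^(-l).
--
-- Lower bound: encode x by its binary digits, whose ones sit at the partial sums
-- of the dᵢ, so that the dᵢ are the gaps between consecutive ones.  Force a one in
-- every m-th place and a run of about α k zeros after place 2^k; the remaining
-- places are free, with density about 1 − 1/m.  Every such x has bounded digits
-- except, for each large k, one digit α k + O(1) near place 2^k, whence
-- L_n / log₂ n → α.  Given a cover with Σ diamˢ small and s < 1 − 1/m, choose the
-- free bits one at a time, always keeping the conditional expectation of the number
-- of covering sets that are hit below 1; the resulting x avoids all of them.
-- Covering sets of diameter about 2^(-j) are handled as four dyadic cylinders of
-- level j.

open import Defs

open import Data.Bool.Base using (Bool; true; false)
import Data.Bool.Properties as Bool
open import Data.Empty using (⊥; ⊥-elim)
open import Data.Integer.Base as ℤ using (+_; -[1+_]) renaming (∣_∣ to absℤ)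
import Data.Integer.GCD as ℤ
import Data.Integer.Properties as ℤ
open import Data.Maybe.Base using (Maybe; just; nothing)
open import Data.Nat.Base as ℕ using (ℕ; zero; suc; z≤n; s≤s)
import Data.Nat.Properties as ℕ
import Data.Nat.Tactic.RingSolver as ℕSolver
open import Data.Product.Base using (Σ-syntax; ∃-syntax; _×_; _,_; proj₁; proj₂)
open import Data.Rational.Base as ℚ using (ℚ; mkℚ; 0ℚ; 1ℚ; ½; ↥_; ↧ₙ_; ↧_)
import Data.Rational.Properties as ℚ
open import Data.Rational.Unnormalised.Base as ℚᵘ using (mkℚᵘ; *≡*; *<*)
import Data.Rational.Unnormalised.Properties as ℚᵘ
open import Algebra.Definitions.RawSemiring ℚ.+-*-rawSemiring using () renaming (_^_ to _^ℚ_)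
open import Data.Sum.Base using (_⊎_; inj₁; inj₂)
open import Level using (0ℓ; Lift; lift) renaming (suc to lsuc)
open import Relation.Binary.Definitions using (tri<; tri≈; tri>)
open import Relation.Binary.PropositionalEquality
open import Relation.Nullary.Decidable using (Dec; yes; no; dec⇒maybe; _×-dec_)
open import Relation.Nullary.Negation using (¬_)
open import Relation.Unary using (_∈_)
open import Tactic.RingSolver using (solve-∀)
open import Tactic.RingSolver.Core.AlmostCommutativeRing using (AlmostCommutativeRing; fromCommutativeRing)

-- The argument is constructive, which shapes many statements: a point of a grid is located only up
-- to two adjacent cells, and a power `rˢ` is computed exactly only where its value is rational. No
-- measure is put on the constructed set. The choice of bits takes the place of a mass distribution,
-- since each choice can be made by comparing finite sums of rationals.
--
-- Runs of length about `α k` in blocks of length `2 ^ k` have density tending to 0, so they fix the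
-- limit of `L_n / log₂ n` without costing dimension. The periodic ones keep all other gaps bounded,
-- and their cost vanishes as `m` grows.
--
-- A covering set may have diameter zero, or one too small to be compared with a dyadic scale in
-- bounded time. Such a set becomes an obstacle at a level so deep, depending on its index, that
-- these obstacles together have a small geometric weight; nothing is then asked of its term in
-- `Σ diamˢ`.

ℚ-ring : AlmostCommutativeRing 0ℓ 0ℓ
ℚ-ring = fromCommutativeRing ℚ.+-*-commutativeRing (λ x → dec⇒maybe (0ℚ ℚ.≟ x))

-- Linear combinations of inequalities.  Each rule leaves a ring identity
-- expressing y − x (in ℕ, with subtraction moved to the other side) as the sum
-- of the slacks of its hypotheses.

p<q⇒0<q-p : ∀ {p q} → p ℚ.< q → 0ℚ ℚ.< q ℚ.- p
p<q⇒0<q-p {p} {q} p<q = subst (ℚ._< q ℚ.- p) (ℚ.+-inverseʳ p) (ℚ.+-monoˡ-< (ℚ.- p) p<q)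

p≤q⇒0≤q-p : ∀ {p q} → p ℚ.≤ q → 0ℚ ℚ.≤ q ℚ.- p
p≤q⇒0≤q-p {p} {q} p≤q = subst (ℚ._≤ q ℚ.- p) (ℚ.+-inverseʳ p) (ℚ.+-monoˡ-≤ (ℚ.- p) p≤q)

<-lin₁ : ∀ {a b x y} → a ℚ.< b → (b ℚ.- a) ℚ.+ x ≡ y → x ℚ.< y
<-lin₁ {a} {b} {x} a<b eq = subst₂ ℚ._<_ (ℚ.+-identityˡ x) eq (ℚ.+-monoˡ-< x (p<q⇒0<q-p a<b))

≤-lin₁ : ∀ {a b x y} → a ℚ.≤ b → (b ℚ.- a) ℚ.+ x ≡ y → x ℚ.≤ y
≤-lin₁ {a} {b} {x} a≤b eq = subst₂ ℚ._≤_ (ℚ.+-identityˡ x) eq (ℚ.+-monoˡ-≤ x (p≤q⇒0≤q-p a≤b))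

<-lin₂ : ∀ {a b c d x y} → a ℚ.< b → c ℚ.< d → ((b ℚ.- a) ℚ.+ (d ℚ.- c)) ℚ.+ x ≡ y → x ℚ.< y
<-lin₂ {x = x} a<b c<d eq = subst₂ ℚ._<_ (ℚ.+-identityˡ x) eq
  (ℚ.+-monoˡ-< x (ℚ.+-mono-< (p<q⇒0<q-p a<b) (p<q⇒0<q-p c<d)))

<≤-lin₂ : ∀ {a b c d x y} → a ℚ.< b → c ℚ.≤ d → ((b ℚ.- a) ℚ.+ (d ℚ.- c)) ℚ.+ x ≡ y → x ℚ.< y
<≤-lin₂ {x = x} a<b c≤d eq = subst₂ ℚ._<_ (ℚ.+-identityˡ x) eq
  (ℚ.+-monoˡ-< x (ℚ.+-mono-<-≤ (p<q⇒0<q-p a<b) (p≤q⇒0≤q-p c≤d)))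

≤-lin₂ : ∀ {a b c d x y} → a ℚ.≤ b → c ℚ.≤ d → ((b ℚ.- a) ℚ.+ (d ℚ.- c)) ℚ.+ x ≡ y → x ℚ.≤ y
≤-lin₂ {x = x} a≤b c≤d eq = subst₂ ℚ._≤_ (ℚ.+-identityˡ x) eq
  (ℚ.+-monoˡ-≤ x (ℚ.+-mono-≤ (p≤q⇒0≤q-p a≤b) (p≤q⇒0≤q-p c≤d)))

ℕ-lin₁ : ∀ {a b x y} k → a ℕ.≤ b → x ℕ.+ b ℕ.+ k ≡ y ℕ.+ a → x ℕ.≤ y
ℕ-lin₁ {a} {b} {x} {y} k a≤b eq = ℕ.+-cancelʳ-≤ b x y (ℕ.≤-trans
  (subst (x ℕ.+ b ℕ.≤_) eq (ℕ.m≤m+n (x ℕ.+ b) k)) (ℕ.+-monoʳ-≤ y a≤b))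

ℕ-lin₂ : ∀ {a b c d x y} k → a ℕ.≤ b → c ℕ.≤ d → x ℕ.+ (b ℕ.+ d) ℕ.+ k ≡ y ℕ.+ (a ℕ.+ c) → x ℕ.≤ y
ℕ-lin₂ k a≤b c≤d = ℕ-lin₁ k (ℕ.+-mono-≤ a≤b c≤d)

ℕ-lin₃ : ∀ {a b c d e f x y} k → a ℕ.≤ b → c ℕ.≤ d → e ℕ.≤ f →
         x ℕ.+ (b ℕ.+ (d ℕ.+ f)) ℕ.+ k ≡ y ℕ.+ (a ℕ.+ (c ℕ.+ e)) → x ℕ.≤ y
ℕ-lin₃ k a≤b c≤d e≤f = ℕ-lin₂ k a≤b (ℕ.+-mono-≤ c≤d e≤f)

-- Products and powers of rationals

*-monoʳ-< : ∀ {r p q} → 0ℚ ℚ.< r → p ℚ.< q → r ℚ.* p ℚ.< r ℚ.* q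
*-monoʳ-< {r} 0<r = ℚ.*-monoʳ-<-pos r {{ℚ.positive 0<r}}

*-monoˡ-< : ∀ {r p q} → 0ℚ ℚ.< r → p ℚ.< q → p ℚ.* r ℚ.< q ℚ.* r
*-monoˡ-< {r} 0<r = ℚ.*-monoˡ-<-pos r {{ℚ.positive 0<r}}

*-monoʳ-≤ : ∀ {r p q} → 0ℚ ℚ.≤ r → p ℚ.≤ q → r ℚ.* p ℚ.≤ r ℚ.* q
*-monoʳ-≤ {r} 0≤r = ℚ.*-monoˡ-≤-nonNeg r {{ℚ.nonNegative 0≤r}}

*-monoˡ-≤ : ∀ {r p q} → 0ℚ ℚ.≤ r → p ℚ.≤ q → p ℚ.* r ℚ.≤ q ℚ.* r
*-monoˡ-≤ {r} 0≤r = ℚ.*-monoʳ-≤-nonNeg r {{ℚ.nonNegative 0≤r}}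

*-cancelˡ-< : ∀ {r p q} → 0ℚ ℚ.≤ r → r ℚ.* p ℚ.< r ℚ.* q → p ℚ.< q
*-cancelˡ-< {r} 0≤r = ℚ.*-cancelˡ-<-nonNeg r {{ℚ.nonNegative 0≤r}}

*-pos : ∀ {p q} → 0ℚ ℚ.< p → 0ℚ ℚ.< q → 0ℚ ℚ.< p ℚ.* q
*-pos {p} {q} 0<p 0<q = subst (ℚ._< p ℚ.* q) (ℚ.*-zeroʳ p) (*-monoʳ-< 0<p 0<q)

*-nonneg : ∀ {p q} → 0ℚ ℚ.≤ p → 0ℚ ℚ.≤ q → 0ℚ ℚ.≤ p ℚ.* q
*-nonneg {p} {q} 0≤p 0≤q = subst (ℚ._≤ p ℚ.* q) (ℚ.*-zeroʳ p) (*-monoʳ-≤ 0≤p 0≤q)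

0<1 : 0ℚ ℚ.< 1ℚ
0<1 = ℚ.positive⁻¹ 1ℚ

0<½ : 0ℚ ℚ.< ½
0<½ = ℚ.positive⁻¹ ½

½<1 : ½ ℚ.< 1ℚ
½<1 = <-lin₁ 0<½ refl

^-homo-* : ∀ x m n → x ^ℚ (m ℕ.+ n) ≡ x ^ℚ m ℚ.* x ^ℚ n
^-homo-* x zero    n = sym (ℚ.*-identityˡ (x ^ℚ n))
^-homo-* x (suc m) n = trans (cong (x ℚ.*_) (^-homo-* x m n)) (sym (ℚ.*-assoc x (x ^ℚ m) (x ^ℚ n)))

^-distrib-* : ∀ x y n → (x ℚ.* y) ^ℚ n ≡ x ^ℚ n ℚ.* y ^ℚ n
^-distrib-* x y zero    = refl
^-distrib-* x y (suc n) = trans (cong (x ℚ.* y ℚ.*_) (^-distrib-* x y n)) (regroup x y (x ^ℚ n) (y ^ℚ n))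
  where
  regroup : ∀ a b c d → a ℚ.* b ℚ.* (c ℚ.* d) ≡ a ℚ.* c ℚ.* (b ℚ.* d)
  regroup = solve-∀ ℚ-ring

^-assocʳ : ∀ x m n → (x ^ℚ m) ^ℚ n ≡ x ^ℚ (n ℕ.* m)
^-assocʳ x m zero    = refl
^-assocʳ x m (suc n) = trans (cong (x ^ℚ m ℚ.*_) (^-assocʳ x m n)) (sym (^-homo-* x m (n ℕ.* m)))

^-pos : ∀ {x} → 0ℚ ℚ.< x → ∀ n → 0ℚ ℚ.< x ^ℚ n
^-pos 0<x zero    = 0<1
^-pos 0<x (suc n) = *-pos 0<x (^-pos 0<x n)

^-nonneg : ∀ {x} → 0ℚ ℚ.≤ x → ∀ n → 0ℚ ℚ.≤ x ^ℚ n
^-nonneg 0≤x zero    = ℚ.<⇒≤ 0<1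
^-nonneg 0≤x (suc n) = *-nonneg 0≤x (^-nonneg 0≤x n)

^-monoˡ-≤ : ∀ {x y} → 0ℚ ℚ.≤ x → x ℚ.≤ y → ∀ n → x ^ℚ n ℚ.≤ y ^ℚ n
^-monoˡ-≤ 0≤x x≤y zero    = ℚ.≤-refl
^-monoˡ-≤ 0≤x x≤y (suc n) = ℚ.≤-trans (*-monoʳ-≤ 0≤x (^-monoˡ-≤ 0≤x x≤y n))
  (*-monoˡ-≤ (^-nonneg (ℚ.≤-trans 0≤x x≤y) n) x≤y)

^-monoˡ-< : ∀ {x y} → 0ℚ ℚ.≤ x → x ℚ.< y → ∀ n → .{{ℕ.NonZero n}} → x ^ℚ n ℚ.< y ^ℚ n
^-monoˡ-< 0≤x x<y (suc n) = ℚ.≤-<-trans (*-monoʳ-≤ 0≤x (^-monoˡ-≤ 0≤x (ℚ.<⇒≤ x<y) n))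
  (*-monoˡ-< (^-pos (ℚ.≤-<-trans 0≤x x<y) n) x<y)

^-cancelˡ-< : ∀ {x y} → 0ℚ ℚ.≤ y → ∀ n → x ^ℚ n ℚ.< y ^ℚ n → x ℚ.< y
^-cancelˡ-< {x} {y} 0≤y n x^n<y^n = ℚ.≰⇒> λ y≤x →
  ℚ.<-irrefl refl (ℚ.<-≤-trans x^n<y^n (^-monoˡ-≤ 0≤y y≤x n))

1^n≡1 : ∀ n → 1ℚ ^ℚ n ≡ 1ℚ
1^n≡1 zero    = refl
1^n≡1 (suc n) = trans (ℚ.*-identityˡ _) (1^n≡1 n)

^-antimonoʳ-≤ : ∀ {x m n} → 0ℚ ℚ.≤ x → x ℚ.≤ 1ℚ → m ℕ.≤ n → x ^ℚ n ℚ.≤ x ^ℚ m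
^-antimonoʳ-≤ {x} {n = n} 0≤x x≤1 z≤n = subst (x ^ℚ n ℚ.≤_) (1^n≡1 n) (^-monoˡ-≤ 0≤x x≤1 n)
^-antimonoʳ-≤ 0≤x x≤1 (s≤s m≤n) = *-monoʳ-≤ 0≤x (^-antimonoʳ-≤ 0≤x x≤1 m≤n)

^-monoʳ-≤ : ∀ {x m n} → 1ℚ ℚ.≤ x → m ℕ.≤ n → x ^ℚ m ℚ.≤ x ^ℚ n
^-monoʳ-≤ {x} {n = n} 1≤x z≤n = subst (ℚ._≤ x ^ℚ n) (1^n≡1 n) (^-monoˡ-≤ (ℚ.<⇒≤ 0<1) 1≤x n)
^-monoʳ-≤ 1≤x (s≤s m≤n) = *-monoʳ-≤ (ℚ.≤-trans (ℚ.<⇒≤ 0<1) 1≤x) (^-monoʳ-≤ 1≤x m≤n)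

½^-pos : ∀ n → 0ℚ ℚ.< ½ ^ℚ n
½^-pos = ^-pos 0<½

½^-antimono-≤ : ∀ {m n} → m ℕ.≤ n → ½ ^ℚ n ℚ.≤ ½ ^ℚ m
½^-antimono-≤ = ^-antimonoʳ-≤ (ℚ.<⇒≤ 0<½) (ℚ.<⇒≤ ½<1)

½^-antimono-< : ∀ {m n} → m ℕ.< n → ½ ^ℚ n ℚ.< ½ ^ℚ m
½^-antimono-< {m} {n} m<n = ℚ.≤-<-trans (½^-antimono-≤ m<n)
  (subst (½ ^ℚ suc m ℚ.<_) (ℚ.*-identityˡ (½ ^ℚ m)) (*-monoˡ-< (½^-pos m) ½<1))

½^-double : ∀ n → ½ ^ℚ suc n ℚ.+ ½ ^ℚ suc n ≡ ½ ^ℚ n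
½^-double n = halves (½ ^ℚ n)
  where
  halves : ∀ a → ½ ℚ.* a ℚ.+ ½ ℚ.* a ≡ a
  halves = solve-∀ ℚ-ring

-- Natural numbers and powers of two inside the rationals

fromℕ-+ : ∀ m n → fromℕ (m ℕ.+ n) ≡ fromℕ m ℚ.+ fromℕ n
fromℕ-+ m n = ℚ.toℚᵘ-injective (ℚᵘ.≃-trans (ℚ.toℚᵘ-fromℚᵘ (mkℚᵘ (+ (m ℕ.+ n)) 0))
  (ℚᵘ.≃-trans {j = mkℚᵘ (+ m) 0 ℚᵘ.+ mkℚᵘ (+ n) 0}
    (*≡* (cong (ℤ._* + 1) (sym (cong₂ ℤ._+_ (ℤ.*-identityʳ (+ m)) (ℤ.*-identityʳ (+ n))))))
  (ℚᵘ.≃-sym (ℚᵘ.≃-trans (ℚ.toℚᵘ-homo-+ (fromℕ m) (fromℕ n))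
    (ℚᵘ.+-cong (ℚ.toℚᵘ-fromℚᵘ (mkℚᵘ (+ m) 0)) (ℚ.toℚᵘ-fromℚᵘ (mkℚᵘ (+ n) 0)))))))

fromℕ-* : ∀ m n → fromℕ (m ℕ.* n) ≡ fromℕ m ℚ.* fromℕ n
fromℕ-* m n = ℚ.toℚᵘ-injective (ℚᵘ.≃-trans (ℚ.toℚᵘ-fromℚᵘ (mkℚᵘ (+ (m ℕ.* n)) 0))
  (ℚᵘ.≃-trans {j = mkℚᵘ (+ m) 0 ℚᵘ.* mkℚᵘ (+ n) 0} (*≡* (cong (ℤ._* + 1) (ℤ.pos-* m n)))
  (ℚᵘ.≃-sym (ℚᵘ.≃-trans (ℚ.toℚᵘ-homo-* (fromℕ m) (fromℕ n))
    (ℚᵘ.*-cong (ℚ.toℚᵘ-fromℚᵘ (mkℚᵘ (+ m) 0)) (ℚ.toℚᵘ-fromℚᵘ (mkℚᵘ (+ n) 0)))))))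

fromℕ-suc : ∀ n → fromℕ (suc n) ≡ 1ℚ ℚ.+ fromℕ n
fromℕ-suc = fromℕ-+ 1

0≤fromℕ : ∀ n → 0ℚ ℚ.≤ fromℕ n
0≤fromℕ n = ℚ.nonNegative⁻¹ (fromℕ n) {{ℚ.normalize-nonNeg n 1}}

fromℕ-mono-≤ : ∀ {m n} → m ℕ.≤ n → fromℕ m ℚ.≤ fromℕ n
fromℕ-mono-≤ {m} m≤n with ℕ.m≤n⇒∃[o]m+o≡n m≤n
... | o , refl = subst₂ ℚ._≤_ (ℚ.+-identityʳ (fromℕ m)) (sym (fromℕ-+ m o)) (ℚ.+-monoʳ-≤ (fromℕ m) (0≤fromℕ o))

fromℕ<fromℕ-suc : ∀ n → fromℕ n ℚ.< fromℕ (suc n)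
fromℕ<fromℕ-suc n = subst₂ ℚ._<_ (ℚ.+-identityˡ (fromℕ n)) (sym (fromℕ-suc n)) (ℚ.+-monoˡ-< (fromℕ n) 0<1)

fromℕ-mono-< : ∀ {m n} → m ℕ.< n → fromℕ m ℚ.< fromℕ n
fromℕ-mono-< {m} {n} m<n = ℚ.<-≤-trans (fromℕ<fromℕ-suc m) (fromℕ-mono-≤ {suc m} {n} m<n)

fromℕ-cancel-< : ∀ {m n} → fromℕ m ℚ.< fromℕ n → m ℕ.< n
fromℕ-cancel-< {m} {n} m<n = ℕ.≰⇒> λ n≤m → ℚ.<-irrefl refl (ℚ.<-≤-trans m<n (fromℕ-mono-≤ {n} {m} n≤m))

0<fromℕ-suc : ∀ n → 0ℚ ℚ.< fromℕ (suc n)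
0<fromℕ-suc n = ℚ.≤-<-trans (0≤fromℕ n) (fromℕ<fromℕ-suc n)

fromℕ[2^n]*½^n≡1 : ∀ n → fromℕ (2 ℕ.^ n) ℚ.* ½ ^ℚ n ≡ 1ℚ
fromℕ[2^n]*½^n≡1 zero    = refl
fromℕ[2^n]*½^n≡1 (suc n) = begin
  fromℕ (2 ℕ.^ suc n) ℚ.* (½ ℚ.* ½ ^ℚ n)              ≡⟨ cong (ℚ._* (½ ℚ.* ½ ^ℚ n)) (fromℕ-* 2 (2 ℕ.^ n)) ⟩
  (fromℕ 2 ℚ.* fromℕ (2 ℕ.^ n)) ℚ.* (½ ℚ.* ½ ^ℚ n)    ≡⟨ regroup (fromℕ (2 ℕ.^ n)) (½ ^ℚ n) ⟩
  fromℕ (2 ℕ.^ n) ℚ.* ½ ^ℚ n                          ≡⟨ fromℕ[2^n]*½^n≡1 n ⟩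
  1ℚ                                                  ∎
  where
  open ≡-Reasoning
  regroup : ∀ a b → (fromℕ 2 ℚ.* a) ℚ.* (½ ℚ.* b) ≡ a ℚ.* b
  regroup = solve-∀ ℚ-ring

n<2^n : ∀ n → n ℕ.< 2 ℕ.^ n
n<2^n zero    = s≤s z≤n
n<2^n (suc n) = ℕ-lin₂ 0 (n<2^n n) (ℕ.≤-trans (s≤s z≤n) (n<2^n n)) (regroup n (2 ℕ.^ n))
  where
  regroup : ∀ n p → suc (suc n) ℕ.+ (p ℕ.+ p) ℕ.+ 0 ≡ p ℕ.+ (p ℕ.+ 0) ℕ.+ (suc n ℕ.+ 1)
  regroup = ℕSolver.solve-∀

numerator : ℚ → ℕ
numerator t = absℤ (↥ t)

*-denominator : ∀ {t} → 0ℚ ℚ.≤ t → t ℚ.* fromℕ (↧ₙ t) ≡ fromℕ (numerator t)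
*-denominator {mkℚ -[1+ n ] d c} (ℚ.*≤* ())
*-denominator {t@(mkℚ (+ n) d c)} 0≤t = ℚ.toℚᵘ-injective (ℚᵘ.≃-trans (ℚ.toℚᵘ-homo-* t (fromℕ (suc d)))
  (ℚᵘ.≃-trans (ℚᵘ.*-congˡ {ℚ.toℚᵘ t} (ℚ.toℚᵘ-fromℚᵘ (mkℚᵘ (+ suc d) 0)))
  (ℚᵘ.≃-trans (*≡* (trans (ℤ.*-identityʳ _) (cong (λ e → + n ℤ.* + e) (sym (ℕ.*-identityʳ (suc d))))))
    (ℚᵘ.≃-sym (ℚ.toℚᵘ-fromℚᵘ (mkℚᵘ (+ n) 0))))))

-- Comparisons with rational powers refer to the exponent in lowest terms. This cross-multiplied
-- identity, in which the common factor cancels, is what allows the unreduced exponents `u / v`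
-- found below.
numerator-/ : ∀ u v .{{_ : ℕ.NonZero v}} → numerator (+ u ℚ./ v) ℕ.* v ≡ u ℕ.* ↧ₙ (+ u ℚ./ v)
numerator-/ u v = begin
  n ℕ.* v               ≡⟨ cong (n ℕ.*_) (sym d*g≡v) ⟩
  n ℕ.* (d ℕ.* g)       ≡⟨ regroup n d g ⟩
  n ℕ.* g ℕ.* d         ≡⟨ cong (ℕ._* d) n*g≡u ⟩
  u ℕ.* d               ∎
  where
  open ≡-Reasoning
  n = numerator (+ u ℚ./ v)
  d = ↧ₙ (+ u ℚ./ v)
  g = absℤ (ℤ.gcd (+ u) (+ v))
  n*g≡u : n ℕ.* g ≡ u
  n*g≡u = trans (sym (ℤ.abs-* (↥ (+ u ℚ./ v)) (ℤ.gcd (+ u) (+ v)))) (cong absℤ (ℚ.↥-/ (+ u) v))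
  d*g≡v : d ℕ.* g ≡ v
  d*g≡v = trans (sym (ℤ.abs-* (↧ (+ u ℚ./ v)) (ℤ.gcd (+ u) (+ v)))) (cong absℤ (ℚ.↧-/ (+ u) v))
  regroup : ∀ a b c → a ℕ.* (b ℕ.* c) ≡ a ℕ.* c ℕ.* b
  regroup = ℕSolver.solve-∀

0<numerator : ∀ {t} → 0ℚ ℚ.< t → 0 ℕ.< numerator t
0<numerator {mkℚ (+ zero) d c} (ℚ.*<* (ℤ.+<+ ()))
0<numerator {mkℚ (+ suc n) d c} _ = s≤s z≤n
0<numerator {mkℚ -[1+ n ] d c} _ = s≤s z≤n

cross-< : ∀ {t t′} → 0ℚ ℚ.< t → t ℚ.< t′ → numerator t ℕ.* ↧ₙ t′ ℕ.< numerator t′ ℕ.* ↧ₙ t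
cross-< {t} {t′} 0<t t<t′ = fromℕ-cancel-< {numerator t ℕ.* ↧ₙ t′} {numerator t′ ℕ.* ↧ₙ t} (subst₂ ℚ._<_ lhs rhs
  (*-monoˡ-< (0<fromℕ-suc (ℚ.denominator-1 t′)) (*-monoˡ-< (0<fromℕ-suc (ℚ.denominator-1 t)) t<t′)))
  where
  open ≡-Reasoning
  lhs : t ℚ.* fromℕ (↧ₙ t) ℚ.* fromℕ (↧ₙ t′) ≡ fromℕ (numerator t ℕ.* ↧ₙ t′)
  lhs = trans (cong (ℚ._* fromℕ (↧ₙ t′)) (*-denominator (ℚ.<⇒≤ 0<t))) (sym (fromℕ-* (numerator t) (↧ₙ t′)))
  swap : ∀ a b c → a ℚ.* b ℚ.* c ≡ a ℚ.* c ℚ.* b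
  swap = solve-∀ ℚ-ring
  rhs : t′ ℚ.* fromℕ (↧ₙ t) ℚ.* fromℕ (↧ₙ t′) ≡ fromℕ (numerator t′ ℕ.* ↧ₙ t)
  rhs = begin
    t′ ℚ.* fromℕ (↧ₙ t) ℚ.* fromℕ (↧ₙ t′)  ≡⟨ swap t′ (fromℕ (↧ₙ t)) (fromℕ (↧ₙ t′)) ⟩
    t′ ℚ.* fromℕ (↧ₙ t′) ℚ.* fromℕ (↧ₙ t)  ≡⟨ cong (ℚ._* fromℕ (↧ₙ t)) (*-denominator (ℚ.<⇒≤ (ℚ.<-trans 0<t t<t′))) ⟩
    fromℕ (numerator t′) ℚ.* fromℕ (↧ₙ t)  ≡⟨ fromℕ-* (numerator t′) (↧ₙ t) ⟨
    fromℕ (numerator t′ ℕ.* ↧ₙ t)          ∎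

-- Archimedean properties

∃-fromℕ-above : ∀ q → ∃[ n ] q ℚ.< fromℕ n
∃-fromℕ-above q with ℚ.<-cmp q 0ℚ
... | tri< q<0 _ _  = 0 , q<0
... | tri≈ _ refl _ = 1 , 0<1
... | tri> _ _ 0<q  = suc (numerator q) , ℚ.≤-<-trans q≤n (fromℕ<fromℕ-suc (numerator q))
  where
  q≤n : q ℚ.≤ fromℕ (numerator q)
  q≤n = subst₂ ℚ._≤_ (ℚ.*-identityʳ q) (*-denominator (ℚ.<⇒≤ 0<q))
    (*-monoʳ-≤ (ℚ.<⇒≤ 0<q) (fromℕ-mono-≤ {1} {↧ₙ q} (s≤s z≤n)))

fromℕ*½^-<1 : ∀ n → fromℕ n ℚ.* ½ ^ℚ n ℚ.< 1ℚ
fromℕ*½^-<1 n = subst (fromℕ n ℚ.* ½ ^ℚ n ℚ.<_) (fromℕ[2^n]*½^n≡1 n) (*-monoˡ-< (½^-pos n) (fromℕ-mono-< {n} {2 ℕ.^ n} (n<2^n n)))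

∃½^-below : ∀ {ε} → 0ℚ ℚ.< ε → ∃[ n ] ½ ^ℚ n ℚ.< ε
-- The denominator `d` of `ε` serves as exponent: `½ ^ d < 1 / d ≤ ε`, the numerator being at least
-- 1.
∃½^-below {ε} 0<ε = ↧ₙ ε , below (↧ₙ ε) 1≤
  where
  below : ∀ n → 1ℚ ℚ.≤ fromℕ n ℚ.* ε → ½ ^ℚ n ℚ.< ε
  below n 1≤nε = *-cancelˡ-< {fromℕ n} {½ ^ℚ n} {ε} (0≤fromℕ n) (ℚ.<-≤-trans (fromℕ*½^-<1 n) 1≤nε)
  1≤ : 1ℚ ℚ.≤ fromℕ (↧ₙ ε) ℚ.* ε
  1≤ = subst (1ℚ ℚ.≤_) (trans (sym (*-denominator (ℚ.<⇒≤ 0<ε))) (ℚ.*-comm ε (fromℕ (↧ₙ ε))))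
    (fromℕ-mono-≤ {1} {numerator ε} (0<numerator 0<ε))

∃½^-below-scaled : ∀ K {ε} → 0ℚ ℚ.< ε → ∃[ n ] K ℚ.* ½ ^ℚ n ℚ.< ε
∃½^-below-scaled K {ε} 0<ε = above (∃-fromℕ-above K) (∃½^-below 0<ε)
  where
  module _ (k m : ℕ) (K<k : K ℚ.< fromℕ k) where
    K*½^k<1 : K ℚ.* ½ ^ℚ k ℚ.< 1ℚ
    K*½^k<1 = ℚ.<-trans (*-monoˡ-< {½ ^ℚ k} {K} {fromℕ k} (½^-pos k) K<k) (fromℕ*½^-<1 k)
    split : (K ℚ.* ½ ^ℚ k) ℚ.* ½ ^ℚ m ≡ K ℚ.* ½ ^ℚ (k ℕ.+ m)
    split = trans (ℚ.*-assoc K (½ ^ℚ k) (½ ^ℚ m)) (cong (K ℚ.*_) (sym (^-homo-* ½ k m)))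
    bound : K ℚ.* ½ ^ℚ (k ℕ.+ m) ℚ.< ½ ^ℚ m
    bound = subst₂ ℚ._<_ split (ℚ.*-identityˡ (½ ^ℚ m))
      (*-monoˡ-< {½ ^ℚ m} {K ℚ.* ½ ^ℚ k} {1ℚ} (½^-pos m) K*½^k<1)
  above : ∃[ k ] K ℚ.< fromℕ k → ∃[ m ] ½ ^ℚ m ℚ.< ε → ∃[ n ] K ℚ.* ½ ^ℚ n ℚ.< ε
  above (k , K<k) (m , ½^m<ε) = k ℕ.+ m , ℚ.<-trans (bound k m K<k) ½^m<ε

archimedean : ∀ K {ε} → 0ℚ ℚ.< ε → ∃[ n ] K ℚ.< fromℕ n ℚ.* ε
archimedean K {ε} 0<ε = above (∃-fromℕ-above K) (∃½^-below 0<ε)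
  where
  open ≡-Reasoning
  scaled : ∀ k m → fromℕ (k ℕ.* 2 ℕ.^ m) ℚ.* ½ ^ℚ m ≡ fromℕ k
  scaled k m = begin
    fromℕ (k ℕ.* 2 ℕ.^ m) ℚ.* ½ ^ℚ m           ≡⟨ cong (ℚ._* ½ ^ℚ m) (fromℕ-* k (2 ℕ.^ m)) ⟩
    fromℕ k ℚ.* fromℕ (2 ℕ.^ m) ℚ.* ½ ^ℚ m     ≡⟨ ℚ.*-assoc (fromℕ k) (fromℕ (2 ℕ.^ m)) (½ ^ℚ m) ⟩
    fromℕ k ℚ.* (fromℕ (2 ℕ.^ m) ℚ.* ½ ^ℚ m)   ≡⟨ cong (fromℕ k ℚ.*_) (fromℕ[2^n]*½^n≡1 m) ⟩
    fromℕ k ℚ.* 1ℚ                             ≡⟨ ℚ.*-identityʳ (fromℕ k) ⟩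
    fromℕ k                                    ∎
  above : ∃[ k ] K ℚ.< fromℕ k → ∃[ m ] ½ ^ℚ m ℚ.< ε → ∃[ n ] K ℚ.< fromℕ n ℚ.* ε
  above (k , K<k) (m , ½^m<ε) = N , ℚ.<-≤-trans K<k
    (subst (ℚ._≤ fromℕ N ℚ.* ε) (scaled k m)
      (*-monoʳ-≤ {fromℕ N} {½ ^ℚ m} {ε} (0≤fromℕ N) (ℚ.<⇒≤ ½^m<ε)))
    where N = k ℕ.* 2 ℕ.^ m

-- Bernoulli's inequality and continuity of powers

0≤x*x : ∀ x → 0ℚ ℚ.≤ x ℚ.* x
0≤x*x x with ℚ.≤-total 0ℚ x
... | inj₁ 0≤x = *-nonneg {x} {x} 0≤x 0≤x
... | inj₂ x≤0 = subst (0ℚ ℚ.≤_) (square x) (*-nonneg {ℚ.- x} {ℚ.- x} 0≤-x 0≤-x)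
  where
  0≤-x : 0ℚ ℚ.≤ ℚ.- x
  0≤-x = ℚ.neg-antimono-≤ x≤0
  square : ∀ x → ℚ.- x ℚ.* ℚ.- x ≡ x ℚ.* x
  square = solve-∀ ℚ-ring

bernoulli : ∀ y → 0ℚ ℚ.≤ 1ℚ ℚ.+ y → ∀ n → 1ℚ ℚ.+ fromℕ n ℚ.* y ℚ.≤ (1ℚ ℚ.+ y) ^ℚ n
bernoulli y 0≤1+y zero    = ℚ.≤-reflexive (trans (cong (1ℚ ℚ.+_) (ℚ.*-zeroˡ y)) (ℚ.+-identityʳ 1ℚ))
bernoulli y 0≤1+y (suc n) = begin
  1ℚ ℚ.+ fromℕ (suc n) ℚ.* y                                            ≡⟨ cong (λ m → 1ℚ ℚ.+ m ℚ.* y) (fromℕ-suc n) ⟩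
  1ℚ ℚ.+ (1ℚ ℚ.+ fromℕ n) ℚ.* y                                         ≤⟨ ≤-lin₁ {0ℚ} {fromℕ n ℚ.* (y ℚ.* y)} (*-nonneg (0≤fromℕ n) (0≤x*x y)) (identity (fromℕ n) y) ⟩
  (1ℚ ℚ.+ y) ℚ.* (1ℚ ℚ.+ fromℕ n ℚ.* y)                                 ≤⟨ *-monoʳ-≤ {1ℚ ℚ.+ y} 0≤1+y (bernoulli y 0≤1+y n) ⟩
  (1ℚ ℚ.+ y) ℚ.* (1ℚ ℚ.+ y) ^ℚ n                                        ∎
  where
  open ℚ.≤-Reasoning
  identity : ∀ m y → (m ℚ.* (y ℚ.* y) ℚ.- 0ℚ) ℚ.+ (1ℚ ℚ.+ (1ℚ ℚ.+ m) ℚ.* y) ≡ (1ℚ ℚ.+ y) ℚ.* (1ℚ ℚ.+ m ℚ.* y)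
  identity = solve-∀ ℚ-ring

1-½^-pos : ∀ n → 0ℚ ℚ.< 1ℚ ℚ.+ ℚ.- (½ ^ℚ suc n)
1-½^-pos n = p<q⇒0<q-p {½ ^ℚ suc n} {1ℚ} (½^-antimono-< {0} {suc n} (s≤s z≤n))

^-continuous-below : ∀ {r c} n → 0ℚ ℚ.< r → c ℚ.< r ^ℚ n → ∃[ b ] 0ℚ ℚ.< b × b ℚ.< r × c ℚ.< b ^ℚ n
^-continuous-below {r} {c} n 0<r c<r^n = witness (∃½^-below-scaled (r ^ℚ n ℚ.* fromℕ n) (p<q⇒0<q-p c<r^n))
  where
  witness : ∃[ k ] r ^ℚ n ℚ.* fromℕ n ℚ.* ½ ^ℚ k ℚ.< r ^ℚ n ℚ.- c → ∃[ b ] 0ℚ ℚ.< b × b ℚ.< r × c ℚ.< b ^ℚ n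
  witness (k , small) = r ℚ.* (1ℚ ℚ.+ ℚ.- θ) , *-pos {r} {1ℚ ℚ.+ ℚ.- θ} 0<r (1-½^-pos k) , b<r , c<b^n
    where
    open ℚ.≤-Reasoning
    -- The successor keeps `1 − θ` positive even for `k = 0`.
    θ = ½ ^ℚ suc k
    b<r : r ℚ.* (1ℚ ℚ.+ ℚ.- θ) ℚ.< r
    b<r = <-lin₁ (*-pos 0<r (½^-pos (suc k))) (identity r θ)
      where
      identity : ∀ r t → (r ℚ.* t ℚ.- 0ℚ) ℚ.+ r ℚ.* (1ℚ ℚ.+ ℚ.- t) ≡ r
      identity = solve-∀ ℚ-ring
    small′ : r ^ℚ n ℚ.* fromℕ n ℚ.* θ ℚ.< r ^ℚ n ℚ.- c
    small′ = ℚ.≤-<-trans (*-monoʳ-≤ {r ^ℚ n ℚ.* fromℕ n} {θ} {½ ^ℚ k}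
      (*-nonneg (^-nonneg (ℚ.<⇒≤ 0<r) n) (0≤fromℕ n)) (½^-antimono-≤ (ℕ.n≤1+n k))) small
    c<b^n : c ℚ.< (r ℚ.* (1ℚ ℚ.+ ℚ.- θ)) ^ℚ n
    c<b^n = begin-strict
      c                                                  <⟨ <-lin₁ small′ (identity (r ^ℚ n) (fromℕ n) θ c) ⟩
      r ^ℚ n ℚ.* (1ℚ ℚ.+ fromℕ n ℚ.* ℚ.- θ)              ≤⟨ *-monoʳ-≤ {r ^ℚ n} (^-nonneg (ℚ.<⇒≤ 0<r) n) (bernoulli (ℚ.- θ) (ℚ.<⇒≤ (1-½^-pos k)) n) ⟩
      r ^ℚ n ℚ.* (1ℚ ℚ.+ ℚ.- θ) ^ℚ n                     ≡⟨ ^-distrib-* r (1ℚ ℚ.+ ℚ.- θ) n ⟨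
      (r ℚ.* (1ℚ ℚ.+ ℚ.- θ)) ^ℚ n                        ∎
      where
      identity : ∀ p m t c → (p ℚ.- c ℚ.- p ℚ.* m ℚ.* t) ℚ.+ c ≡ p ℚ.* (1ℚ ℚ.+ m ℚ.* ℚ.- t)
      identity = solve-∀ ℚ-ring

-- Bernoulli bounds powers only from below, so `b = r (1 + θ)` is estimated through `b (1 − θ) ≤ r`:
-- then `bⁿ (1 − n θ) ≤ rⁿ < c (1 − n θ)`, and the positive factor cancels.
^-continuous-above : ∀ {r c} n → 0ℚ ℚ.< r → r ^ℚ n ℚ.< c → ∃[ b ] r ℚ.< b × b ^ℚ n ℚ.< c
^-continuous-above {r} {c} n 0<r r^n<c = witness (∃½^-below-scaled (c ℚ.* fromℕ n) (p<q⇒0<q-p r^n<c))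
  where
  0<c : 0ℚ ℚ.< c
  0<c = ℚ.<-trans (^-pos 0<r n) r^n<c
  witness : ∃[ k ] c ℚ.* fromℕ n ℚ.* ½ ^ℚ k ℚ.< c ℚ.- r ^ℚ n → ∃[ b ] r ℚ.< b × b ^ℚ n ℚ.< c
  witness (k , small) = b , r<b , *-cancelʳ-< (ℚ.<⇒≤ 0<shrunk) (ℚ.≤-<-trans (begin
      b ^ℚ n ℚ.* shrunk                                 ≤⟨ *-monoʳ-≤ {b ^ℚ n} (^-nonneg (ℚ.<⇒≤ (ℚ.<-trans 0<r r<b)) n) (bernoulli (ℚ.- θ) (ℚ.<⇒≤ (1-½^-pos k)) n) ⟩
      b ^ℚ n ℚ.* (1ℚ ℚ.+ ℚ.- θ) ^ℚ n                    ≡⟨ ^-distrib-* b (1ℚ ℚ.+ ℚ.- θ) n ⟨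
      (b ℚ.* (1ℚ ℚ.+ ℚ.- θ)) ^ℚ n                       ≤⟨ ^-monoˡ-≤ (*-nonneg {b} (ℚ.<⇒≤ (ℚ.<-trans 0<r r<b)) (ℚ.<⇒≤ (1-½^-pos k)))
                                                             (≤-lin₁ (*-nonneg (ℚ.<⇒≤ 0<r) (0≤x*x θ)) (shrink r θ)) n ⟩
      r ^ℚ n                                            ∎) r^n<c*shrunk)
    where
    open ℚ.≤-Reasoning
    θ = ½ ^ℚ suc k
    b = r ℚ.* (1ℚ ℚ.+ θ)
    shrunk = 1ℚ ℚ.+ fromℕ n ℚ.* ℚ.- θ
    *-cancelʳ-< : ∀ {p q r} → 0ℚ ℚ.≤ r → p ℚ.* r ℚ.< q ℚ.* r → p ℚ.< q
    *-cancelʳ-< {r = r} 0≤r = ℚ.*-cancelʳ-<-nonNeg r {{ℚ.nonNegative 0≤r}}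
    shrink : ∀ r t → (r ℚ.* (t ℚ.* t) ℚ.- 0ℚ) ℚ.+ r ℚ.* (1ℚ ℚ.+ t) ℚ.* (1ℚ ℚ.+ ℚ.- t) ≡ r
    shrink = solve-∀ ℚ-ring
    r<b : r ℚ.< b
    r<b = <-lin₁ (*-pos 0<r (½^-pos (suc k))) (identity r θ)
      where
      identity : ∀ r t → (r ℚ.* t ℚ.- 0ℚ) ℚ.+ r ≡ r ℚ.* (1ℚ ℚ.+ t)
      identity = solve-∀ ℚ-ring
    small′ : c ℚ.* fromℕ n ℚ.* θ ℚ.< c ℚ.- r ^ℚ n
    small′ = ℚ.≤-<-trans (*-monoʳ-≤ {c ℚ.* fromℕ n} {θ} {½ ^ℚ k}
      (*-nonneg (ℚ.<⇒≤ 0<c) (0≤fromℕ n)) (½^-antimono-≤ (ℕ.n≤1+n k))) small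
    r^n<c*shrunk : r ^ℚ n ℚ.< c ℚ.* shrunk
    r^n<c*shrunk = <-lin₁ small′ (identity (r ^ℚ n) (fromℕ n) θ c)
      where
      identity : ∀ p m t c → (c ℚ.- p ℚ.- c ℚ.* m ℚ.* t) ℚ.+ p ≡ c ℚ.* (1ℚ ℚ.+ m ℚ.* ℚ.- t)
      identity = solve-∀ ℚ-ring
    0<shrunk : 0ℚ ℚ.< shrunk
    0<shrunk = *-cancelˡ-< {c} {0ℚ} {shrunk} (ℚ.<⇒≤ 0<c)
      (subst (ℚ._< c ℚ.* shrunk) (sym (ℚ.*-zeroʳ c)) (ℚ.<-trans (^-pos 0<r n) r^n<c*shrunk))

-- A ratio `y / x` of at least `1 + θ` grows past any bound by Bernoulli, hence beats the fixed
-- factor `b`. This allows an exponent to be moved slightly to either side of a given one at the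
-- price of one factor `b`.
^-dominates : ∀ {x y b} → 0ℚ ℚ.≤ x → x ℚ.< y → 0ℚ ℚ.< b → ∃[ n ] x ^ℚ suc n ℚ.< y ^ℚ suc n ℚ.* b
^-dominates {x} {y} {b} 0≤x x<y 0<b = witness (∃½^-below-scaled y (p<q⇒0<q-p x<y))
  where
  open ℚ.≤-Reasoning
  0<y : 0ℚ ℚ.< y
  0<y = ℚ.≤-<-trans 0≤x x<y
  double-< : ∀ {p q} → 0ℚ ℚ.< q → p ℚ.+ p ℚ.≤ q → p ℚ.< q
  double-< {p} {q} 0<q 2p≤q = ℚ.≰⇒> λ q≤p → ℚ.<-irrefl refl (begin-strict
    q ℚ.+ 0ℚ   <⟨ ℚ.+-mono-≤-< q≤p (ℚ.<-≤-trans 0<q q≤p) ⟩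
    p ℚ.+ p    ≤⟨ 2p≤q ⟩
    q          ≡⟨ ℚ.+-identityʳ q ⟨
    q ℚ.+ 0ℚ   ∎)
  witness : ∃[ k ] y ℚ.* ½ ^ℚ k ℚ.< y ℚ.- x → ∃[ n ] x ^ℚ suc n ℚ.< y ^ℚ suc n ℚ.* b
  witness (k , small) = large (archimedean (fromℕ 2) (*-pos (½^-pos k) 0<b))
    where
    θ = ½ ^ℚ k
    x[1+θ]≤y : x ℚ.* (1ℚ ℚ.+ θ) ℚ.≤ y
    x[1+θ]≤y = ≤-lin₂ (ℚ.<⇒≤ small) (*-monoˡ-≤ {θ} {x} {y} (ℚ.<⇒≤ (½^-pos k)) (ℚ.<⇒≤ x<y)) (identity x y θ)
      where
      identity : ∀ x y t → ((y ℚ.- x ℚ.- y ℚ.* t) ℚ.+ (y ℚ.* t ℚ.- x ℚ.* t)) ℚ.+ x ℚ.* (1ℚ ℚ.+ t) ≡ y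
      identity = solve-∀ ℚ-ring
    0≤1+θ : 0ℚ ℚ.≤ 1ℚ ℚ.+ θ
    0≤1+θ = ℚ.+-mono-≤ (ℚ.<⇒≤ 0<1) (ℚ.<⇒≤ (½^-pos k))
    large : ∃[ n ] fromℕ 2 ℚ.< fromℕ n ℚ.* (θ ℚ.* b) → ∃[ n ] x ^ℚ suc n ℚ.< y ^ℚ suc n ℚ.* b
    -- `X` may be 0, so multiplying by it preserves only `≤`. Strictness comes from proving twice
    -- the bound, with the positive right-hand side.
    large (n , 2<nθb) = n , double-< (*-pos (^-pos 0<y (suc n)) 0<b) (begin
      X ℚ.+ X                                                ≡⟨ twice X ⟨
      X ℚ.* fromℕ 2                                          ≤⟨ *-monoʳ-≤ {X} {fromℕ 2} 0≤X (ℚ.<⇒≤ 2<nθb) ⟩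
      X ℚ.* (fromℕ n ℚ.* (θ ℚ.* b))                          ≤⟨ *-monoʳ-≤ {X} {fromℕ n ℚ.* (θ ℚ.* b)} 0≤X (*-monoˡ-≤ {θ ℚ.* b} (ℚ.<⇒≤ (*-pos (½^-pos k) 0<b)) (ℚ.<⇒≤ (fromℕ<fromℕ-suc n))) ⟩
      X ℚ.* (fromℕ (suc n) ℚ.* (θ ℚ.* b))                    ≤⟨ ≤-lin₁ (*-nonneg 0≤X (ℚ.<⇒≤ 0<b)) (drop-1 X (fromℕ (suc n)) θ b) ⟩
      X ℚ.* (1ℚ ℚ.+ fromℕ (suc n) ℚ.* θ) ℚ.* b               ≤⟨ *-monoˡ-≤ {b} (ℚ.<⇒≤ 0<b) (*-monoʳ-≤ {X} 0≤X (bernoulli θ 0≤1+θ (suc n))) ⟩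
      X ℚ.* (1ℚ ℚ.+ θ) ^ℚ suc n ℚ.* b                        ≡⟨ cong (ℚ._* b) (^-distrib-* x (1ℚ ℚ.+ θ) (suc n)) ⟨
      (x ℚ.* (1ℚ ℚ.+ θ)) ^ℚ suc n ℚ.* b                      ≤⟨ *-monoˡ-≤ {b} (ℚ.<⇒≤ 0<b) (^-monoˡ-≤ (*-nonneg 0≤x 0≤1+θ) x[1+θ]≤y (suc n)) ⟩
      y ^ℚ suc n ℚ.* b                                       ∎)
      where
      X = x ^ℚ suc n
      0≤X : 0ℚ ℚ.≤ X
      0≤X = ^-nonneg 0≤x (suc n)
      twice : ∀ a → a ℚ.* fromℕ 2 ≡ a ℚ.+ a
      twice = solve-∀ ℚ-ring
      drop-1 : ∀ a m t b → (a ℚ.* b ℚ.- 0ℚ) ℚ.+ a ℚ.* (m ℚ.* (t ℚ.* b)) ≡ a ℚ.* (1ℚ ℚ.+ m ℚ.* t) ℚ.* b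
      drop-1 = solve-∀ ℚ-ring

-- Raising to the power `e` and then taking the `f`-th root shows that the comparison depends only
-- on the ratio of the exponents. This carries it over to lowest terms.
^-rescale-< : ∀ {x y} a b a′ b′ e f → .{{ℕ.NonZero e}} → 0ℚ ℚ.≤ x → 0ℚ ℚ.≤ y →
              e ℕ.* a ≡ f ℕ.* a′ → e ℕ.* b ≡ f ℕ.* b′ → x ^ℚ a ℚ.< y ^ℚ b → x ^ℚ a′ ℚ.< y ^ℚ b′
^-rescale-< {x} {y} a b a′ b′ e f 0≤x 0≤y ea≡fa′ eb≡fb′ x^a<y^b = ^-cancelˡ-< (^-nonneg 0≤y b′) f (begin-strict
  (x ^ℚ a′) ^ℚ f     ≡⟨ ^-assocʳ x a′ f ⟩
  x ^ℚ (f ℕ.* a′)    ≡⟨ cong (x ^ℚ_) ea≡fa′ ⟨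
  x ^ℚ (e ℕ.* a)     ≡⟨ ^-assocʳ x a e ⟨
  (x ^ℚ a) ^ℚ e      <⟨ ^-monoˡ-< (^-nonneg 0≤x a) x^a<y^b e ⟩
  (y ^ℚ b) ^ℚ e      ≡⟨ ^-assocʳ y b e ⟩
  y ^ℚ (e ℕ.* b)     ≡⟨ cong (y ^ℚ_) eb≡fb′ ⟩
  y ^ℚ (f ℕ.* b′)    ≡⟨ ^-assocʳ y b′ f ⟨
  (y ^ℚ b′) ^ℚ f     ∎)
  where open ℚ.≤-Reasoning

-- c < bᵗ and b′ᵗ′ < d imply c < d, for t = u / v and t′ = u′ / v′.
^-separate : ∀ {b b′ c d} u v u′ v′ → .{{ℕ.NonZero v′}} → 0ℚ ℚ.< b → b ℚ.< b′ → 0ℚ ℚ.< d →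
             b ^ℚ (v′ ℕ.* u) ℚ.≤ b ^ℚ (v ℕ.* u′) →
             c ^ℚ v ℚ.< b ^ℚ u → b′ ^ℚ u′ ℚ.< d ^ℚ v′ → c ℚ.< d
^-separate {b} {b′} {c} {d} u v u′ v′ 0<b b<b′ 0<d exponents c^v<b^u b′^u′<d^v′ = ℚ.≰⇒> λ d≤c →
  ℚ.<-irrefl refl (begin-strict
    (d ^ℚ v) ^ℚ v′     ≤⟨ ^-monoˡ-≤ (^-nonneg (ℚ.<⇒≤ 0<d) v) (^-monoˡ-≤ (ℚ.<⇒≤ 0<d) d≤c v) v′ ⟩
    (c ^ℚ v) ^ℚ v′     <⟨ ^-monoˡ-< (^-nonneg (ℚ.≤-trans (ℚ.<⇒≤ 0<d) d≤c) v) c^v<b^u v′ ⟩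
    (b ^ℚ u) ^ℚ v′     ≡⟨ ^-assocʳ b u v′ ⟩
    b ^ℚ (v′ ℕ.* u)    ≤⟨ exponents ⟩
    b ^ℚ (v ℕ.* u′)    ≡⟨ ^-assocʳ b u′ v ⟨
    (b ^ℚ u′) ^ℚ v     ≤⟨ ^-monoˡ-≤ (^-nonneg (ℚ.<⇒≤ 0<b) u′) (^-monoˡ-≤ (ℚ.<⇒≤ 0<b) (ℚ.<⇒≤ b<b′) u′) v ⟩
    (b′ ^ℚ u′) ^ℚ v    ≤⟨ ^-monoˡ-≤ (^-nonneg (ℚ.<⇒≤ (ℚ.<-trans 0<b b<b′)) u′) (ℚ.<⇒≤ b′^u′<d^v′) v ⟩
    (d ^ℚ v′) ^ℚ v     ≡⟨ ^-assocʳ d v′ v ⟩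
    d ^ℚ (v ℕ.* v′)    ≡⟨ cong (d ^ℚ_) (ℕ.*-comm v v′) ⟩
    d ^ℚ (v′ ℕ.* v)    ≡⟨ ^-assocʳ d v v′ ⟨
    (d ^ℚ v) ^ℚ v′     ∎)
  where open ℚ.≤-Reasoning

-- Rational bounds for cuts

-- Positive forms of `ι a ≤ x` and `x ≤ ι b`, which as negations would not produce members of the
-- cut. They make sense for bare cuts, such as partial sums and powers, and holding both with the
-- same rational expresses an exact value.
record AtLeast (x : Cut) (a : ℚ) : Set where
  constructor atLeast
  field below : ∀ {c} → c ℚ.< a → Below x c

record AtMost (x : Cut) (b : ℚ) : Set where
  constructor atMost
  field above : ∀ {c} → b ℚ.< c → Above x c

open AtLeast
open AtMost

ι-atLeast : ∀ p → AtLeast (ι p) p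
ι-atLeast p = atLeast λ c<p → c<p

ι-atMost : ∀ p → AtMost (ι p) p
ι-atMost p = atMost λ p<c → p<c

ℝ-atLeast : ∀ (x : ℝ) {a} → Below (cut x) a → AtLeast (cut x) a
ℝ-atLeast x a<x = atLeast λ c<a → IsDedekind.below-lower (isDedekind x) c<a a<x

ℝ-atMost : ∀ (x : ℝ) {a} → Above (cut x) a → AtMost (cut x) a
ℝ-atMost x x<a = atMost λ a<c → IsDedekind.above-upper (isDedekind x) a<c x<a

Below⇒<Above : ∀ (x : ℝ) {a b} → Below (cut x) a → Above (cut x) b → a ℚ.< b
Below⇒<Above x {a} {b} a<x x<b with ℚ.<-cmp a b
... | tri< a<b _ _  = a<b
... | tri≈ _ refl _ = ⊥-elim (IsDedekind.disjoint (isDedekind x) (a<x , x<b))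
... | tri> _ _ b<a  = ⊥-elim (IsDedekind.disjoint (isDedekind x) (a<x , IsDedekind.above-upper (isDedekind x) b<a x<b))

+-atLeast : ∀ {x y a b} → AtLeast x a → AtLeast y b → AtLeast (x + y) (a ℚ.+ b)
+-atLeast {x} {y} {a} {b} a≤x b≤y = atLeast λ {c} c<a+b →
  let a′ , c-b<a′ , a′<a = ℚ.<-dense {c ℚ.- b} {a} (<-lin₁ c<a+b (id₁ a b c))
      b′ , c-a′<b′ , b′<b = ℚ.<-dense {c ℚ.- a′} {b} (<-lin₁ c-b<a′ (id₂ a′ b c))
  in a′ , b′ , below a≤x a′<a , below b≤y b′<b , <-lin₁ c-a′<b′ (id₃ a′ b′ c)
  where
  id₁ : ∀ a b c → (a ℚ.+ b ℚ.- c) ℚ.+ (c ℚ.- b) ≡ a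
  id₁ = solve-∀ ℚ-ring
  id₂ : ∀ a b c → (a ℚ.- (c ℚ.- b)) ℚ.+ (c ℚ.- a) ≡ b
  id₂ = solve-∀ ℚ-ring
  id₃ : ∀ a b c → (b ℚ.- (c ℚ.- a)) ℚ.+ c ≡ a ℚ.+ b
  id₃ = solve-∀ ℚ-ring

+-atMost : ∀ {x y a b} → AtMost x a → AtMost y b → AtMost (x + y) (a ℚ.+ b)
+-atMost {x} {y} {a} {b} x≤a y≤b = atMost λ {c} a+b<c →
  let a′ , a<a′ , a′<c-b = ℚ.<-dense {a} {c ℚ.- b} (<-lin₁ a+b<c (id₁ a b c))
      b′ , b<b′ , b′<c-a′ = ℚ.<-dense {b} {c ℚ.- a′} (<-lin₁ a′<c-b (id₂ a′ b c))
  in a′ , b′ , above x≤a a<a′ , above y≤b b<b′ , <-lin₁ b′<c-a′ (id₃ a′ b′ c)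
  where
  id₁ : ∀ a b c → (c ℚ.- (a ℚ.+ b)) ℚ.+ a ≡ c ℚ.- b
  id₁ = solve-∀ ℚ-ring
  id₂ : ∀ a b c → (c ℚ.- b ℚ.- a) ℚ.+ b ≡ c ℚ.- a
  id₂ = solve-∀ ℚ-ring
  id₃ : ∀ a b c → (c ℚ.- a ℚ.- b) ℚ.+ (a ℚ.+ b) ≡ c
  id₃ = solve-∀ ℚ-ring

−-atLeast : ∀ {x y a b} → AtLeast x a → AtMost y b → AtLeast (x - y) (a ℚ.- b)
−-atLeast {x} {y} {a} {b} a≤x y≤b = atLeast λ {c} c<a-b →
  let a′ , c+b<a′ , a′<a = ℚ.<-dense {c ℚ.+ b} {a} (<-lin₁ c<a-b (id₁ a b c))
      b′ , b<b′ , b′<a′-c = ℚ.<-dense {b} {a′ ℚ.- c} (<-lin₁ c+b<a′ (id₂ a′ b c))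
  in a′ , b′ , below a≤x a′<a , above y≤b b<b′ , <-lin₁ b′<a′-c (id₃ a′ b′ c)
  where
  id₁ : ∀ a b c → (a ℚ.- b ℚ.- c) ℚ.+ (c ℚ.+ b) ≡ a
  id₁ = solve-∀ ℚ-ring
  id₂ : ∀ a b c → (a ℚ.- (c ℚ.+ b)) ℚ.+ b ≡ a ℚ.- c
  id₂ = solve-∀ ℚ-ring
  id₃ : ∀ a b c → (a ℚ.- c ℚ.- b) ℚ.+ c ≡ a ℚ.- b
  id₃ = solve-∀ ℚ-ring

−-atMost : ∀ {x y a b} → AtMost x a → AtLeast y b → AtMost (x - y) (a ℚ.- b)
−-atMost {x} {y} {a} {b} x≤a b≤y = atMost λ {c} a-b<c →
  let a′ , a<a′ , a′<c+b = ℚ.<-dense {a} {c ℚ.+ b} (<-lin₁ a-b<c (id₁ a b c))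
      b′ , a′-c<b′ , b′<b = ℚ.<-dense {a′ ℚ.- c} {b} (<-lin₁ a′<c+b (id₂ a′ b c))
  in a′ , b′ , above x≤a a<a′ , below b≤y b′<b , <-lin₁ a′-c<b′ (id₃ a′ b′ c)
  where
  id₁ : ∀ a b c → (c ℚ.- (a ℚ.- b)) ℚ.+ a ≡ c ℚ.+ b
  id₁ = solve-∀ ℚ-ring
  id₂ : ∀ a b c → (c ℚ.+ b ℚ.- a) ℚ.+ (a ℚ.- c) ≡ b
  id₂ = solve-∀ ℚ-ring
  id₃ : ∀ a b c → (b ℚ.- (a ℚ.- c)) ℚ.+ (a ℚ.- b) ≡ c
  id₃ = solve-∀ ℚ-ring

∣∣-atLeast : ∀ {x a} → AtLeast x a → AtLeast ∣ x ∣ a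
∣∣-atLeast a≤x = atLeast λ c<a → inj₂ (inj₁ (below a≤x c<a))

∣∣<ι : ∀ {x a b ε} → AtLeast x a → AtMost x b → ℚ.- ε ℚ.< a → b ℚ.< ε → ∣ x ∣ < ι ε
∣∣<ι {x} {a} {b} {ε} a≤x x≤b -ε<a b<ε =
  let q₁ , -a<q₁ , q₁<ε = ℚ.<-dense {ℚ.- a} {ε} (<-lin₁ -ε<a (id₁ a ε))
      q₂ , b<q₂ , q₂<ε  = ℚ.<-dense {b} {ε} b<ε
  in choose q₁ q₂ -a<q₁ q₁<ε b<q₂ q₂<ε
  where
  id₁ : ∀ a e → (a ℚ.- (ℚ.- e)) ℚ.+ (ℚ.- a) ≡ e
  id₁ = solve-∀ ℚ-ring
  id₂ : ∀ a q → (q ℚ.- (ℚ.- a)) ℚ.+ (ℚ.- q) ≡ a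
  id₂ = solve-∀ ℚ-ring
  choose : ∀ q₁ q₂ → ℚ.- a ℚ.< q₁ → q₁ ℚ.< ε → b ℚ.< q₂ → q₂ ℚ.< ε → ∣ x ∣ < ι ε
  choose q₁ q₂ -a<q₁ q₁<ε b<q₂ q₂<ε with ℚ.≤-total q₁ q₂
  ... | inj₁ q₁≤q₂ = q₂ , (above x≤b b<q₂ , below a≤x (<-lin₁ (ℚ.<-≤-trans -a<q₁ q₁≤q₂) (id₂ a q₂))) , q₂<ε
  ... | inj₂ q₂≤q₁ = q₁ , (above x≤b (ℚ.<-≤-trans b<q₂ q₂≤q₁) , below a≤x (<-lin₁ -a<q₁ (id₂ a q₁))) , q₁<ε

-- Finite sums of rationals and partial sums of cuts

∑ : (ℕ → ℚ) → ℕ → ℚ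
∑ f zero    = 0ℚ
∑ f (suc n) = ∑ f n ℚ.+ f n

partialSum-atLeast : ∀ {f : ℕ → Cut} {a} → (∀ i → AtLeast (f i) (a i)) → ∀ n → AtLeast (partialSum f n) (∑ a n)
partialSum-atLeast a≤f zero    = ι-atLeast 0ℚ
partialSum-atLeast a≤f (suc n) = +-atLeast (partialSum-atLeast a≤f n) (a≤f n)

partialSum-atMost : ∀ {f : ℕ → Cut} {a} → (∀ i → AtMost (f i) (a i)) → ∀ n → AtMost (partialSum f n) (∑ a n)
partialSum-atMost f≤a zero    = ι-atMost 0ℚ
partialSum-atMost f≤a (suc n) = +-atMost (partialSum-atMost f≤a n) (f≤a n)

-- Partial sums of powers are bare cuts rather than elements of `ℝ`, so the consistency of their two
-- halves has to be inherited from the terms.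
partialSum-separate : ∀ {f : ℕ → Cut} → (∀ i {c d} → Below (f i) c → Above (f i) d → c ℚ.< d) →
                      ∀ n {c d} → Below (partialSum f n) c → Above (partialSum f n) d → c ℚ.< d
partialSum-separate sep zero    c<0 0<d = ℚ.<-trans c<0 0<d
partialSum-separate sep (suc n) (a , b , a<S , b<f , c<a+b) (a′ , b′ , S<a′ , f<b′ , a′+b′<d) =
  ℚ.<-trans c<a+b (ℚ.<-trans (ℚ.+-mono-< (partialSum-separate sep n a<S S<a′) (sep n b<f f<b′)) a′+b′<d)

-- Powers of cuts

<⟨⟩-exponent : ∀ {c b} u v .{{_ : ℕ.NonZero v}} → 0ℚ ℚ.≤ c → 0ℚ ℚ.≤ b →
               c ^ℚ v ℚ.< b ^ℚ u → c <⟨ b ⟩^ (+ u ℚ./ v)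
<⟨⟩-exponent u v 0≤c 0≤b = ^-rescale-< v u (↧ₙ t) (numerator t) (↧ₙ t) v 0≤c 0≤b
  (ℕ.*-comm (↧ₙ t) v) (trans (ℕ.*-comm (↧ₙ t) u) (trans (sym (numerator-/ u v)) (ℕ.*-comm (numerator t) v)))
  where t = + u ℚ./ v

⟨⟩<-exponent : ∀ {b c} u v .{{_ : ℕ.NonZero v}} → 0ℚ ℚ.≤ b → 0ℚ ℚ.≤ c →
               b ^ℚ u ℚ.< c ^ℚ v → ⟨ b ⟩^ (+ u ℚ./ v) < c
⟨⟩<-exponent u v 0≤b 0≤c = ^-rescale-< u v (numerator t) (↧ₙ t) (↧ₙ t) v 0≤b 0≤c
  (trans (ℕ.*-comm (↧ₙ t) u) (trans (sym (numerator-/ u v)) (ℕ.*-comm (numerator t) v))) (ℕ.*-comm (↧ₙ t) v)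
  where t = + u ℚ./ v

-- For `b ≤ 1` larger exponents give smaller powers, so the bound at `t′ > s` is played against the
-- bound at `r < s`; for `b ≥ 1` it is `t < s` against `r′ > s`. This is where powers need exponents
-- on both sides of `s`.
^-disjoint : ∀ (x s : ℝ) {c d} → Below (cut x ^ cut s) c → Above (cut x ^ cut s) d → c ℚ.< d
^-disjoint x s (inj₁ c<0) (0<d , _) = ℚ.<-trans c<0 0<d
^-disjoint x s (inj₂ (b , t , t′ , 0<b , 0<t , b<x , t<s , s<t′ , c<bᵗ , c<bᵗ′))
               (0<d , b′ , r , r′ , 0<r , x<b′ , r<s , s<r′ , b′ʳ<d , b′ʳ′<d) with ℚ.≤-total b 1ℚ
... | inj₁ b≤1 = ^-separate (numerator t′) (↧ₙ t′) (numerator r) (↧ₙ r) 0<b (Below⇒<Above x b<x x<b′) 0<d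
  (^-antimonoʳ-≤ (ℚ.<⇒≤ 0<b) b≤1 (ℕ.≤-trans (ℕ.≤-reflexive (ℕ.*-comm (↧ₙ t′) (numerator r)))
    (ℕ.≤-trans (ℕ.<⇒≤ (cross-< 0<r (Below⇒<Above s r<s s<t′))) (ℕ.≤-reflexive (ℕ.*-comm (numerator t′) (↧ₙ r))))))
  c<bᵗ′ b′ʳ<d
... | inj₂ 1≤b = ^-separate (numerator t) (↧ₙ t) (numerator r′) (↧ₙ r′) 0<b (Below⇒<Above x b<x x<b′) 0<d
  (^-monoʳ-≤ 1≤b (ℕ.≤-trans (ℕ.≤-reflexive (ℕ.*-comm (↧ₙ r′) (numerator t)))
    (ℕ.≤-trans (ℕ.<⇒≤ (cross-< 0<t (Below⇒<Above s t<s s<r′))) (ℕ.≤-reflexive (ℕ.*-comm (numerator r′) (↧ₙ t))))))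
  c<bᵗ b′ʳ′<d

-- Searching through finitely many overlapping alternatives

-- The result is the first index at which `Q` is offered, or `n` by default. The default carries no
-- `Q`, so a caller has to know independently what holds at the end of the range.
search : ∀ (P Q : ℕ → Set) → (∀ k → P k ⊎ Q k) → ∀ n →
         ∃[ k ] k ℕ.≤ n × (∀ {j} → k ≡ suc j → P j) × (k ℕ.< n → Q k)
search P Q P⊎Q zero    = zero , z≤n , (λ ()) , λ ()
search P Q P⊎Q (suc n) with P⊎Q zero
... | inj₂ Q₀ = zero , z≤n , (λ ()) , λ _ → Q₀
... | inj₁ P₀ with search (λ k → P (suc k)) (λ k → Q (suc k)) (λ k → P⊎Q (suc k)) n
...   | k , k≤n , before , at = suc k , s≤s k≤n , prev , λ { (s≤s k<n) → at k<n }
  where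
  prev : ∀ {j} → suc k ≡ suc j → P j
  prev {zero}  refl = P₀
  prev {suc j} refl = before refl

-- The cell of width `h` containing `z` cannot be computed from a cut. Locatedness only yields the
-- overlapping cells `((k − 1) h , (k + 1) h)`, whose left end is missing for `k = 0` and whose
-- right end is missing for `k = n`.
grid-search : ∀ (z : ℝ) {h} → 0ℚ ℚ.< h → ∀ n →
              ∃[ k ] k ℕ.≤ n × (∀ {j} → k ≡ suc j → Below (cut z) (fromℕ j ℚ.* h)) ×
                     (k ℕ.< n → Above (cut z) (fromℕ (suc k) ℚ.* h))
grid-search z {h} 0<h = search (λ j → Below (cut z) (fromℕ j ℚ.* h)) (λ j → Above (cut z) (fromℕ (suc j) ℚ.* h))
  (λ j → IsDedekind.located (isDedekind z) (*-monoˡ-< {h} {fromℕ j} {fromℕ (suc j)} 0<h (fromℕ<fromℕ-suc j)))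

fromℕ-suc-* : ∀ n h → fromℕ (suc n) ℚ.* h ≡ fromℕ n ℚ.* h ℚ.+ h
fromℕ-suc-* n h = trans (cong (ℚ._* h) (fromℕ-suc n)) (identity (fromℕ n) h)
  where
  identity : ∀ m h → (1ℚ ℚ.+ m) ℚ.* h ≡ m ℚ.* h ℚ.+ h
  identity = solve-∀ ℚ-ring

-- Exact values of powers

/-<-/ : ∀ u v u′ v′ .{{_ : ℕ.NonZero v}} .{{_ : ℕ.NonZero v′}} →
        u ℕ.* v′ ℕ.< u′ ℕ.* v → + u ℚ./ v ℚ.< + u′ ℚ./ v′
/-<-/ u (suc v) u′ (suc v′) uv′<u′v = ℚ.toℚᵘ-cancel-<
  (ℚᵘ.<-respˡ-≃ (ℚᵘ.≃-sym (ℚ.toℚᵘ-fromℚᵘ (mkℚᵘ (+ u) v)))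
  (ℚᵘ.<-respʳ-≃ (ℚᵘ.≃-sym (ℚ.toℚᵘ-fromℚᵘ (mkℚᵘ (+ u′) v′)))
    (*<* (subst₂ ℤ._<_ (ℤ.pos-* u (suc v′)) (ℤ.pos-* u′ (suc v)) (ℤ.+<+ uv′<u′v)))))

/-*-cancel : ∀ u v .{{_ : ℕ.NonZero v}} → (+ u ℚ./ v) ℚ.* fromℕ v ≡ fromℕ u
/-*-cancel u (suc v) = ℚ.toℚᵘ-injective
  (ℚᵘ.≃-trans (ℚ.toℚᵘ-homo-* (+ u ℚ./ suc v) (fromℕ (suc v)))
  (ℚᵘ.≃-trans (ℚᵘ.*-cong (ℚ.toℚᵘ-fromℚᵘ (mkℚᵘ (+ u) v)) (ℚ.toℚᵘ-fromℚᵘ (mkℚᵘ (+ suc v) 0)))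
  (ℚᵘ.≃-trans {j = mkℚᵘ (+ u) 0}
    (*≡* (trans (ℤ.*-identityʳ _) (cong (λ e → + u ℤ.* + e) (sym (ℕ.*-identityʳ (suc v))))))
    (ℚᵘ.≃-sym (ℚ.toℚᵘ-fromℚᵘ (mkℚᵘ (+ u) 0))))))

/-< : ∀ u v {p} .{{_ : ℕ.NonZero v}} → fromℕ u ℚ.< p ℚ.* fromℕ v → + u ℚ./ v ℚ.< p
/-< u v {p} u<pv = ℚ.*-cancelʳ-<-nonNeg (fromℕ v) {{ℚ.nonNegative (0≤fromℕ v)}} {+ u ℚ./ v} {p}
  (subst (ℚ._< p ℚ.* fromℕ v) (sym (/-*-cancel u v)) u<pv)

module _ (k : ℕ) where

  private K = suc k

  exponent : ℚ
  exponent = + suc K ℚ./ K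

  1<exponent : 1ℚ ℚ.< exponent
  1<exponent = /-<-/ 1 1 (suc K) K (ℕ.≤-reflexive (identity K))
    where
    identity : ∀ K → suc (1 ℕ.* K) ≡ suc K ℕ.* 1
    identity = ℕSolver.solve-∀

  -- One rational above all these exponents, used as the outer `t′`. The value 2 would not do, being
  -- attained at `k = 0`.
  exponent<3 : exponent ℚ.< + 3 ℚ./ 1
  exponent<3 = /-<-/ (suc K) K 3 1 (ℕ-lin₁ {1} {K} (k) (s≤s z≤n) (identity k))
    where
    identity : ∀ k → suc (suc (suc k) ℕ.* 1) ℕ.+ suc k ℕ.+ k ≡ 3 ℕ.* suc k ℕ.+ 1
    identity = ℕSolver.solve-∀

  0^exponent-atLeast : AtLeast (ι 0ℚ ^ ι exponent) 0ℚ
  0^exponent-atLeast = atLeast inj₁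

  0^exponent-atMost : AtMost (ι 0ℚ ^ ι exponent) 0ℚ
  0^exponent-atMost = atMost λ 0<c → 0<c , witness 0<c (∃½^-below 0<c)
    where
    witness : ∀ {c} → 0ℚ ℚ.< c → ∃[ j ] ½ ^ℚ j ℚ.< c → _
    witness {c} 0<c (j , ½^j<c) = ½ ^ℚ j , 1ℚ , + 3 ℚ./ 1 , 0<1 , ½^-pos j , 1<exponent , exponent<3 ,
      to-first ½^j<c , ℚ.≤-<-trans (^-antimonoʳ-≤ {½ ^ℚ j} {1} {3} (ℚ.<⇒≤ (½^-pos j)) (½^-antimono-≤ {0} {j} z≤n) (s≤s z≤n)) (to-first ½^j<c)
      where
      to-first : ∀ {a} → a ℚ.< c → a ^ℚ 1 ℚ.< c ^ℚ 1
      to-first {a} = subst₂ ℚ._<_ (sym (ℚ.*-identityʳ a)) (sym (ℚ.*-identityʳ c))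

  module _ {r w : ℚ} (0<r : 0ℚ ℚ.< r) (r<1 : r ℚ.< 1ℚ) (0<w : 0ℚ ℚ.< w) (w^K≡r^1+K : w ^ℚ K ≡ r ^ℚ suc K) where

    open ℚ.≤-Reasoning

    r^exponent-atLeast : AtLeast (ι r ^ ι exponent) w
    r^exponent-atLeast = atLeast bound
      where
      bound : ∀ {c} → c ℚ.< w → Below (ι r ^ ι exponent) c
      bound {c} c<w with c ℚ.<? 0ℚ
      ... | yes c<0 = inj₁ c<0
      ... | no c≮0  = inj₂ (base (^-continuous-below (suc K) 0<r
                        (subst (c ^ℚ K ℚ.<_) w^K≡r^1+K (^-monoˡ-< 0≤c c<w K))))
        where
        0≤c : 0ℚ ℚ.≤ c
        0≤c = ℚ.≮⇒≥ c≮0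
        base : ∃[ b ] 0ℚ ℚ.< b × b ℚ.< r × c ^ℚ K ℚ.< b ^ℚ suc K → _
        base (b , 0<b , b<r , c^K<b^1+K) = witness (^-dominates (^-nonneg 0≤c K) c^K<b^1+K 0<b)
          where
          b≤1 : b ℚ.≤ 1ℚ
          b≤1 = ℚ.<⇒≤ (ℚ.<-trans b<r r<1)
          c<b : c ℚ.< b
          c<b = ^-cancelˡ-< (ℚ.<⇒≤ 0<b) K (ℚ.<-≤-trans c^K<b^1+K
            (^-antimonoʳ-≤ {b} {K} {suc K} (ℚ.<⇒≤ 0<b) b≤1 (ℕ.n≤1+n K)))
          witness : ∃[ n ] (c ^ℚ K) ^ℚ suc n ℚ.< (b ^ℚ suc K) ^ℚ suc n ℚ.* b → _
          witness (n , dominates) = b , 1ℚ , + U ℚ./ V , 0<b , 0<1 , b<r , 1<exponent ,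
            /-<-/ (suc K) K U V (ℕ-lin₁ k (s≤s (z≤n {0})) (identity n k)) ,
            subst₂ ℚ._<_ (sym (ℚ.*-identityʳ c)) (sym (ℚ.*-identityʳ b)) c<b ,
            <⟨⟩-exponent U V 0≤c (ℚ.<⇒≤ 0<b) (begin-strict
              c ^ℚ V                          ≡⟨ ^-assocʳ c K (suc n) ⟨
              (c ^ℚ K) ^ℚ suc n               <⟨ dominates ⟩
              (b ^ℚ suc K) ^ℚ suc n ℚ.* b     ≡⟨ cong (ℚ._* b) (^-assocʳ b (suc K) (suc n)) ⟩
              b ^ℚ (suc n ℕ.* suc K) ℚ.* b    ≡⟨ ℚ.*-comm (b ^ℚ (suc n ℕ.* suc K)) b ⟩
              b ^ℚ U                          ∎)
            where
            -- `U / V` exceeds `(K + 1) / K` by `1 / V`. The resulting extra factor `b` in `bᵁ` is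
            -- the one beaten by `^-dominates`; the exponent below `s` is simply 1.
            U = suc (suc n ℕ.* suc K)
            V = suc n ℕ.* K
            identity : ∀ n k → suc (suc (suc k) ℕ.* (suc n ℕ.* suc k)) ℕ.+ 1 ℕ.+ k ≡ suc (suc n ℕ.* suc (suc k)) ℕ.* suc k ℕ.+ 1
            identity = ℕSolver.solve-∀

    r^exponent-atMost : AtMost (ι r ^ ι exponent) w
    r^exponent-atMost = atMost bound
      where
      bound : ∀ {c} → w ℚ.< c → Above (ι r ^ ι exponent) c
      bound {c} w<c = 0<c , below-1 (^-continuous-above (suc K) 0<r
                        (subst (ℚ._< c ^ℚ K) w^K≡r^1+K (^-monoˡ-< (ℚ.<⇒≤ 0<w) w<c K)))
        where
        0<c : 0ℚ ℚ.< c
        0<c = ℚ.<-trans 0<w w<c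
        base : ∀ b → r ℚ.< b → b ℚ.≤ 1ℚ → b ^ℚ suc K ℚ.< c ^ℚ K → _
        base b r<b b≤1 b^1+K<c^K = witness (^-dominates (^-nonneg (ℚ.<⇒≤ 0<b) (suc K)) b^1+K<c^K 0<b)
          where
          0<b : 0ℚ ℚ.< b
          0<b = ℚ.<-trans 0<r r<b
          b^3<c : b ^ℚ 3 ℚ.< c
          b^3<c = ^-cancelˡ-< (ℚ.<⇒≤ 0<c) K (begin-strict
            (b ^ℚ 3) ^ℚ K      ≡⟨ ^-assocʳ b 3 K ⟩
            b ^ℚ (K ℕ.* 3)     ≤⟨ ^-antimonoʳ-≤ {b} {suc K} {K ℕ.* 3} (ℚ.<⇒≤ 0<b) b≤1 (ℕ-lin₁ {1} {K} K (s≤s z≤n) (identity k)) ⟩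
            b ^ℚ suc K         <⟨ b^1+K<c^K ⟩
            c ^ℚ K             ∎)
            where
            identity : ∀ k → suc (suc k) ℕ.+ suc k ℕ.+ suc k ≡ suc k ℕ.* 3 ℕ.+ 1
            identity = ℕSolver.solve-∀
          witness : ∃[ n ] (b ^ℚ suc K) ^ℚ suc n ℚ.< (c ^ℚ K) ^ℚ suc n ℚ.* b → _
          witness (n , dominates) = b , + U ℚ./ V , + 3 ℚ./ 1 ,
            /-<-/ 0 1 U V (s≤s z≤n) , r<b ,
            /-<-/ U V (suc K) K (ℕ-lin₁ k (s≤s (z≤n {0})) (identity n k)) , exponent<3 ,
            ⟨⟩<-exponent U V (ℚ.<⇒≤ 0<b) (ℚ.<⇒≤ 0<c) (*-cancelˡ-< {b} {b ^ℚ U} {c ^ℚ V} (ℚ.<⇒≤ 0<b) (begin-strict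
              b ^ℚ (suc n ℕ.* suc K)          ≡⟨ ^-assocʳ b (suc K) (suc n) ⟨
              (b ^ℚ suc K) ^ℚ suc n           <⟨ dominates ⟩
              (c ^ℚ K) ^ℚ suc n ℚ.* b         ≡⟨ cong (ℚ._* b) (^-assocʳ c K (suc n)) ⟩
              c ^ℚ V ℚ.* b                    ≡⟨ ℚ.*-comm (c ^ℚ V) b ⟩
              b ℚ.* c ^ℚ V                    ∎)) ,
            subst (b ^ℚ 3 ℚ.<_) (sym (ℚ.*-identityʳ c)) b^3<c
            where
            -- Here `U = (n + 1) (K + 1) − 1`, so that `U / V` falls short of `(K + 1) / K` by
            -- `1 / V`.
            U = K ℕ.+ n ℕ.* suc K
            V = suc n ℕ.* K
            identity : ∀ n k → suc ((suc k ℕ.+ n ℕ.* suc (suc k)) ℕ.* suc k) ℕ.+ 1 ℕ.+ k ≡ suc (suc k) ℕ.* (suc n ℕ.* suc k) ℕ.+ 1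
            identity = ℕSolver.solve-∀
        below-1 : ∃[ b ] r ℚ.< b × b ^ℚ suc K ℚ.< c ^ℚ K → _
        below-1 (b , r<b , b^1+K<c^K) with ℚ.≤-total b 1ℚ
        ... | inj₁ b≤1 = base b r<b b≤1 b^1+K<c^K
        -- As `r < 1`, a base above 1 may be lowered to 1, so that powers of it decrease in the
        -- exponent.
        ... | inj₂ 1≤b = base 1ℚ r<1 ℚ.≤-refl (ℚ.≤-<-trans (^-monoˡ-≤ (ℚ.<⇒≤ 0<1) 1≤b (suc K)) b^1+K<c^K)

-- The upper bound for the dimension: covers by intervals

HasSum-nonneg : ∀ {f : ℕ → Cut} → (∀ i {c} → Above (f i) c → 0ℚ ℚ.< c) →
                ∀ (v : ℝ) → HasSum f (cut v) → cut 0ℝ ≤ cut v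
HasSum-nonneg {f} f>0 v hasSum (q , v<q , q<0) = contradict (hasSum (ℚ.- q) (ℚ.neg-antimono-< q<0))
  where
  positive : ∀ n {c} → Above (partialSum f n) c → 0ℚ ℚ.< c
  positive zero    0<c = 0<c
  positive (suc n) (a , b , S<a , fn<b , a+b<c) = ℚ.<-trans (ℚ.+-mono-< (positive n S<a) (f>0 n fn<b)) a+b<c
  identity : ∀ a b p q → ((p ℚ.- (a ℚ.- b)) ℚ.+ (ℚ.- q ℚ.- p)) ℚ.+ (q ℚ.- b) ≡ ℚ.- a
  identity = solve-∀ ℚ-ring
  contradict : ∃[ N ] (∀ n → N ℕ.≤ n → ∣ partialSum f n - cut v ∣ < ι (ℚ.- q)) → ⊥
  contradict (N , close) with close N ℕ.≤-refl
  ... | p , ((a , b , S<a , b<v , a-b<p) , _) , p<-q = ℚ.<-irrefl refl (begin-strict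
    0ℚ              <⟨ p<q⇒0<q-p (Below⇒<Above v b<v v<q) ⟩
    q ℚ.- b         <⟨ <-lin₂ a-b<p p<-q (identity a b p q) ⟩
    ℚ.- a           <⟨ ℚ.neg-antimono-< (positive N S<a) ⟩
    ℚ.- 0ℚ          ∎)
    where open ℚ.≤-Reasoning

Interval : ℚ → ℚ → Subset
Interval lo hi x = Lift (lsuc 0ℓ) (ι lo ≤ cut x × cut x ≤ ι hi)

interval-diameter : ∀ {lo hi r} → lo ℚ.≤ hi → hi ℚ.- lo ≡ r → IsDiameter (Interval lo hi) (fromℚ r)
interval-diameter {lo} {hi} {r} lo≤hi hi-lo≡r = bound , attained
  where
  lo≤ : ∀ (x : ℝ) {a} → Above (cut x) a → ι lo ≤ cut x → lo ℚ.≤ a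
  lo≤ x {a} x<a lo≤x = ℚ.≮⇒≥ λ a<lo → lo≤x (a , x<a , a<lo)
  ≤hi : ∀ (x : ℝ) {a} → Below (cut x) a → cut x ≤ ι hi → a ℚ.≤ hi
  ≤hi x {a} a<x x≤hi = ℚ.≮⇒≥ λ hi<a → x≤hi (a , hi<a , a<x)
  identity₁ : ∀ a b h l q → ((h ℚ.- a) ℚ.+ (b ℚ.- l)) ℚ.+ (a ℚ.- b) ≡ h ℚ.- l
  identity₁ = solve-∀ ℚ-ring
  identity₂ : ∀ a b h l q → ((h ℚ.- b) ℚ.+ (a ℚ.- l)) ℚ.+ ℚ.- (a ℚ.- b) ≡ h ℚ.- l
  identity₂ = solve-∀ ℚ-ring
  -‿swap-< : ∀ {a q} → a ℚ.< ℚ.- q → q ℚ.< ℚ.- a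
  -‿swap-< {a} {q} a<-q = <-lin₁ a<-q (identity a q)
    where
    identity : ∀ a q → (ℚ.- q ℚ.- a) ℚ.+ q ≡ ℚ.- a
    identity = solve-∀ ℚ-ring
  bound : ∀ ((x , y , _) : Σ[ x ∈ ℝ ] Σ[ y ∈ ℝ ] x ∈ Interval lo hi × y ∈ Interval lo hi) → ∣ cut x - cut y ∣ ≤ ι r
  bound (x , y , lift (lo≤x , x≤hi) , lift (lo≤y , y≤hi)) (q , r<q , q<∣x-y∣) = contradict q<∣x-y∣
    where
    hi-lo<q : hi ℚ.- lo ℚ.< q
    hi-lo<q = subst (ℚ._< q) (sym hi-lo≡r) r<q
    contradict : Below ∣ cut x - cut y ∣ q → ⊥
    contradict (inj₁ q<0) = ℚ.<-irrefl refl (ℚ.<-trans (ℚ.≤-<-trans (p≤q⇒0≤q-p lo≤hi) hi-lo<q) q<0)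
    contradict (inj₂ (inj₁ (a , b , a<x , y<b , q<a-b))) = ℚ.<-irrefl refl (ℚ.<-trans q<a-b (ℚ.≤-<-trans
      (≤-lin₂ (≤hi x a<x x≤hi) (lo≤ y y<b lo≤y) (identity₁ a b hi lo q)) hi-lo<q))
    contradict (inj₂ (inj₂ (a , b , x<a , b<y , a-b<-q))) = ℚ.<-irrefl refl (ℚ.<-trans (-‿swap-< a-b<-q) (ℚ.≤-<-trans
      (≤-lin₂ (≤hi y b<y y≤hi) (lo≤ x x<a lo≤x) (identity₂ a b hi lo q)) hi-lo<q))
  hi∈ : fromℚ hi ∈ Interval lo hi
  hi∈ = lift ((λ (q , hi<q , q<lo) → ℚ.<-irrefl refl (ℚ.<-≤-trans (ℚ.<-trans hi<q q<lo) lo≤hi))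
             , λ (q , hi<q , q<hi) → ℚ.<-asym hi<q q<hi)
  lo∈ : fromℚ lo ∈ Interval lo hi
  lo∈ = lift ((λ (q , lo<q , q<lo) → ℚ.<-asym lo<q q<lo)
             , λ (q , hi<q , q<lo) → ℚ.<-irrefl refl (ℚ.<-≤-trans (ℚ.<-trans hi<q q<lo) lo≤hi))
  attained : ∀ q → q ℚ.< r → Σ[ (x , y , _) ∈ (Σ[ x ∈ ℝ ] Σ[ y ∈ ℝ ] x ∈ Interval lo hi × y ∈ Interval lo hi) ] Below ∣ cut x - cut y ∣ q
  attained q q<r = (fromℚ hi , fromℚ lo , hi∈ , lo∈) ,
    AtLeast.below (∣∣-atLeast (−-atLeast (ι-atLeast hi) (ι-atMost lo))) (subst (q ℚ.<_) (sym hi-lo≡r) q<r)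

when : ∀ {P : Set} → Dec P → ℚ → ℚ
when (yes _) p = p
when (no  _) p = 0ℚ

∑-when : ∀ N p L → N ℕ.≤ L → ∑ (λ i → when (i ℕ.<? N) p) L ≡ fromℕ N ℚ.* p
∑-when N p L N≤L = trans (truncated L) (cong (λ m → fromℕ m ℚ.* p) (ℕ.m≥n⇒m⊓n≡n N≤L))
  where
  open ≡-Reasoning
  add : ∀ m → (1ℚ ℚ.+ m) ℚ.* p ≡ m ℚ.* p ℚ.+ p
  add m = identity m p
    where
    identity : ∀ m p → (1ℚ ℚ.+ m) ℚ.* p ≡ m ℚ.* p ℚ.+ p
    identity = solve-∀ ℚ-ring
  truncated : ∀ L → ∑ (λ i → when (i ℕ.<? N) p) L ≡ fromℕ (L ℕ.⊓ N) ℚ.* p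
  truncated zero = sym (ℚ.*-zeroˡ p)
  truncated (suc L) with truncated L | L ℕ.<? N
  ... | ih | yes L<N = begin
    ∑ (λ i → when (i ℕ.<? N) p) L ℚ.+ p     ≡⟨ cong (ℚ._+ p) ih ⟩
    fromℕ (L ℕ.⊓ N) ℚ.* p ℚ.+ p             ≡⟨ cong (λ m → fromℕ m ℚ.* p ℚ.+ p) (ℕ.m≤n⇒m⊓n≡m (ℕ.<⇒≤ L<N)) ⟩
    fromℕ L ℚ.* p ℚ.+ p                     ≡⟨ add (fromℕ L) ⟨
    (1ℚ ℚ.+ fromℕ L) ℚ.* p                  ≡⟨ cong (ℚ._* p) (fromℕ-suc L) ⟨
    fromℕ (suc L) ℚ.* p                     ≡⟨ cong (λ m → fromℕ m ℚ.* p) (ℕ.m≤n⇒m⊓n≡m L<N) ⟨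
    fromℕ (suc L ℕ.⊓ N) ℚ.* p               ∎
  ... | ih | no L≮N = begin
    ∑ (λ i → when (i ℕ.<? N) p) L ℚ.+ 0ℚ    ≡⟨ ℚ.+-identityʳ _ ⟩
    ∑ (λ i → when (i ℕ.<? N) p) L           ≡⟨ ih ⟩
    fromℕ (L ℕ.⊓ N) ℚ.* p                   ≡⟨ cong (λ m → fromℕ m ℚ.* p) (ℕ.m≥n⇒m⊓n≡n (ℕ.≮⇒≥ L≮N)) ⟩
    fromℕ N ℚ.* p                           ≡⟨ cong (λ m → fromℕ m ℚ.* p) (ℕ.m≥n⇒m⊓n≡n (ℕ.m≤n⇒m≤1+n (ℕ.≮⇒≥ L≮N))) ⟨
    fromℕ (suc L ℕ.⊓ N) ℚ.* p               ∎

HasSum-eventually : ∀ {f : ℕ → Cut} {a : ℕ → ℚ} {v} N → (∀ i → AtLeast (f i) (a i)) → (∀ i → AtMost (f i) (a i)) →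
                    (∀ L → N ℕ.≤ L → ∑ a L ≡ v) → HasSum f (ι v)
HasSum-eventually {f} {a} {v} N a≤f f≤a ∑a≡v ε 0<ε = N , λ L N≤L → ∣∣<ι
  (−-atLeast (partialSum-atLeast a≤f L) (ι-atMost v))
  (−-atMost (partialSum-atMost f≤a L) (ι-atLeast v))
  (subst (ℚ.- ε ℚ.<_) (sym (difference L N≤L)) (ℚ.neg-antimono-< 0<ε))
  (subst (ℚ._< ε) (sym (difference L N≤L)) 0<ε)
  where
  difference : ∀ L → N ℕ.≤ L → ∑ a L ℚ.- v ≡ 0ℚ
  difference L N≤L = trans (cong (ℚ._- v) (∑a≡v L N≤L)) (ℚ.+-inverseʳ v)

module _ {E : Subset} (E⊆ : ∀ {x} → x ∈ E → cut 0ℝ < cut x × cut x ≤ cut 1ℝ) (k : ℕ) (δ : ℝ) where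

  private K = suc k

  module IntervalCover (l : ℕ) (0<l : 0 ℕ.< l) (small : ∀ {q} → Above (cut δ) q → ½ ^ℚ (K ℕ.* l) ℚ.< q) where

    e = K ℕ.* l
    -- The grid has half the width `½ ^ e` of the intervals, since `grid-search` determines a point
    -- only up to two adjacent cells. `N` counts the centres `0 , h , … , 1`.
    h = ½ ^ℚ suc e
    N = suc (2 ℕ.^ suc e)

    -- From index `N` on the intervals degenerate to single points, which contribute `0ˢ = 0` and
    -- fill up the finite cover.
    halfWidth : ℕ → ℚ
    halfWidth i = when (i ℕ.<? N) h

    width : ℕ → ℚ
    width i = when (i ℕ.<? N) (½ ^ℚ e)

    lo hi : ℕ → ℚ
    lo i = fromℕ i ℚ.* h ℚ.- halfWidth i
    hi i = fromℕ i ℚ.* h ℚ.+ halfWidth i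

    0≤halfWidth : ∀ i → 0ℚ ℚ.≤ halfWidth i
    0≤halfWidth i with i ℕ.<? N
    ... | yes _ = ℚ.<⇒≤ (½^-pos (suc e))
    ... | no  _ = ℚ.≤-refl

    lo≤hi : ∀ i → lo i ℚ.≤ hi i
    lo≤hi i = ≤-lin₂ (0≤halfWidth i) (0≤halfWidth i) (identity (fromℕ i ℚ.* h) (halfWidth i))
      where
      identity : ∀ c η → ((η ℚ.- 0ℚ) ℚ.+ (η ℚ.- 0ℚ)) ℚ.+ (c ℚ.- η) ≡ c ℚ.+ η
      identity = solve-∀ ℚ-ring

    hi-lo : ∀ i → hi i ℚ.- lo i ≡ width i
    hi-lo i with i ℕ.<? N
    ... | yes _ = trans (identity (fromℕ i ℚ.* h) h) (½^-double e)
      where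
      identity : ∀ c η → c ℚ.+ η ℚ.- (c ℚ.- η) ≡ η ℚ.+ η
      identity = solve-∀ ℚ-ring
    ... | no _ = identity (fromℕ i ℚ.* h)
      where
      identity : ∀ c → c ℚ.+ 0ℚ ℚ.- (c ℚ.- 0ℚ) ≡ 0ℚ
      identity = solve-∀ ℚ-ring

    width≤δ : ∀ i → ι (width i) ≤ cut δ
    width≤δ i (q , δ<q , q<width) with i ℕ.<? N
    ... | yes _ = ℚ.<-asym q<width (small δ<q)
    ... | no  _ = ℚ.<-asym q<width (ℚ.<-trans (½^-pos e) (small δ<q))

    covered : ∀ {x} → x ∈ E → ∃[ i ] x ∈ Interval (lo i) (hi i)
    covered {x} x∈E = locate (E⊆ x∈E) (grid-search x (½^-pos (suc e)) (2 ℕ.^ suc e))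
      where
      locate : cut 0ℝ < cut x × cut x ≤ cut 1ℝ →
               ∃[ i ] i ℕ.≤ 2 ℕ.^ suc e × (∀ {j} → i ≡ suc j → Below (cut x) (fromℕ j ℚ.* h)) ×
                      (i ℕ.< 2 ℕ.^ suc e → Above (cut x) (fromℕ (suc i) ℚ.* h)) →
               ∃[ i ] x ∈ Interval (lo i) (hi i)
      locate ((q₀ , 0<q₀ , q₀<x) , x≤1) (i , i≤n , left , right) = i , x∈
        where
        left-end : ∀ i → (∀ {j} → i ≡ suc j → Below (cut x) (fromℕ j ℚ.* h)) → ∀ {q} → Above (cut x) q → ¬ (q ℚ.< fromℕ i ℚ.* h ℚ.- h)
        left-end zero left {q} x<q q<lo = ℚ.<-irrefl refl (ℚ.<-trans (ℚ.<-trans 0<q₀ (Below⇒<Above x q₀<x x<q))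
          (ℚ.<-trans q<lo (<-lin₁ (½^-pos (suc e)) (identity h))))
          where
          identity : ∀ h → (h ℚ.- 0ℚ) ℚ.+ (0ℚ ℚ.* h ℚ.- h) ≡ 0ℚ
          identity = solve-∀ ℚ-ring
        left-end (suc j) left {q} x<q q<lo = ℚ.<-asym (Below⇒<Above x (left refl) x<q)
          (subst (q ℚ.<_) (trans (cong (ℚ._- h) (fromℕ-suc-* j h)) (identity (fromℕ j ℚ.* h) h)) q<lo)
          where
          identity : ∀ a h → a ℚ.+ h ℚ.- h ≡ a
          identity = solve-∀ ℚ-ring
        right-end : ∀ {q} → fromℕ i ℚ.* h ℚ.+ h ℚ.< q → Below (cut x) q → ⊥
        right-end {q} hi<q q<x with i ℕ.<? 2 ℕ.^ suc e
        ... | yes i<n = ℚ.<-asym (Below⇒<Above x q<x (right i<n)) (subst (ℚ._< q) (sym (fromℕ-suc-* i h)) hi<q)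
        -- At the last centre the search gives no upper bound, but there the right end is `1 + h`.
        ... | no  i≮n = x≤1 (q , ℚ.<-trans 1<hi hi<q , q<x)
          where
          1<hi : 1ℚ ℚ.< fromℕ i ℚ.* h ℚ.+ h
          1<hi = subst (ℚ._< fromℕ i ℚ.* h ℚ.+ h)
            (trans (ℚ.+-identityʳ (fromℕ i ℚ.* h)) (trans (cong (λ m → fromℕ m ℚ.* h) (ℕ.≤-antisym i≤n (ℕ.≮⇒≥ i≮n))) (fromℕ[2^n]*½^n≡1 (suc e))))
            (ℚ.+-monoʳ-< (fromℕ i ℚ.* h) (½^-pos (suc e)))
        x∈ : x ∈ Interval (lo i) (hi i)
        x∈ with i ℕ.<? N
        ... | yes _  = lift ((λ (q , x<q , q<lo) → left-end i left x<q q<lo) , λ (q , hi<q , q<x) → right-end hi<q q<x)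
        ... | no i≮N = ⊥-elim (i≮N (s≤s i≤n))

    cover : DeltaCover δ E
    cover = record
      { member     = λ i → Interval (lo i) (hi i)
      ; diam       = λ i → fromℚ (width i)
      ; isDiameter = λ i → interval-diameter (lo≤hi i) (hi-lo i)
      ; diam≤δ     = width≤δ
      ; covers     = λ {x} → covered {x}
      }

    total : ℚ
    total = fromℕ N ℚ.* ½ ^ℚ (suc K ℕ.* l)

    0<e : 0 ℕ.< e
    0<e = ℕ.≤-trans 0<l (ℕ.m≤m+n l (k ℕ.* l))

    power-identity : (½ ^ℚ (suc K ℕ.* l)) ^ℚ K ≡ (½ ^ℚ e) ^ℚ suc K
    power-identity = trans (^-assocʳ ½ (suc K ℕ.* l) K)
      (trans (cong (½ ^ℚ_) (identity k l)) (sym (^-assocʳ ½ e (suc K))))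
      where
      identity : ∀ k l → suc k ℕ.* (suc (suc k) ℕ.* l) ≡ suc (suc k) ℕ.* (suc k ℕ.* l)
      identity = ℕSolver.solve-∀

    hasSum : HasSum (λ i → ι (width i) ^ ι (exponent k)) (ι total)
    hasSum = HasSum-eventually N term-atLeast term-atMost (∑-when N (½ ^ℚ (suc K ℕ.* l)))
      where
      term-atLeast : ∀ i → AtLeast (ι (width i) ^ ι (exponent k)) (when (i ℕ.<? N) (½ ^ℚ (suc K ℕ.* l)))
      term-atLeast i with i ℕ.<? N
      ... | yes _ = r^exponent-atLeast k (½^-pos e) (½^-antimono-< {0} {e} 0<e) (½^-pos (suc K ℕ.* l)) power-identity
      ... | no  _ = 0^exponent-atLeast k
      term-atMost : ∀ i → AtMost (ι (width i) ^ ι (exponent k)) (when (i ℕ.<? N) (½ ^ℚ (suc K ℕ.* l)))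
      term-atMost i with i ℕ.<? N
      ... | yes _ = r^exponent-atMost k (½^-pos e) (½^-antimono-< {0} {e} 0<e) (½^-pos (suc K ℕ.* l)) power-identity
      ... | no  _ = 0^exponent-atMost k

    -- The exponent `(1 + K) l` is `l + e` by computation. About `2 ^ e` intervals cancel the part
    -- `e`, and the factor `½ ^ l` remains.
    total≤ : total ℚ.≤ fromℕ 4 ℚ.* ½ ^ℚ l
    total≤ = begin
      fromℕ N ℚ.* ½ ^ℚ (l ℕ.+ e)                             ≤⟨ *-monoˡ-≤ {½ ^ℚ (l ℕ.+ e)} (ℚ.<⇒≤ (½^-pos (l ℕ.+ e))) (fromℕ-mono-≤ {N} {4 ℕ.* 2 ℕ.^ e} N≤) ⟩
      fromℕ (4 ℕ.* 2 ℕ.^ e) ℚ.* ½ ^ℚ (l ℕ.+ e)               ≡⟨ cong₂ ℚ._*_ (fromℕ-* 4 (2 ℕ.^ e)) (^-homo-* ½ l e) ⟩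
      fromℕ 4 ℚ.* fromℕ (2 ℕ.^ e) ℚ.* (½ ^ℚ l ℚ.* ½ ^ℚ e)    ≡⟨ regroup (fromℕ 4) (fromℕ (2 ℕ.^ e)) (½ ^ℚ l) (½ ^ℚ e) ⟩
      fromℕ 4 ℚ.* ½ ^ℚ l ℚ.* (fromℕ (2 ℕ.^ e) ℚ.* ½ ^ℚ e)    ≡⟨ cong (fromℕ 4 ℚ.* ½ ^ℚ l ℚ.*_) (fromℕ[2^n]*½^n≡1 e) ⟩
      fromℕ 4 ℚ.* ½ ^ℚ l ℚ.* 1ℚ                              ≡⟨ ℚ.*-identityʳ (fromℕ 4 ℚ.* ½ ^ℚ l) ⟩
      fromℕ 4 ℚ.* ½ ^ℚ l                                     ∎
      where
      open ℚ.≤-Reasoning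
      regroup : ∀ a b c d → a ℚ.* b ℚ.* (c ℚ.* d) ≡ a ℚ.* c ℚ.* (b ℚ.* d)
      regroup = solve-∀ ℚ-ring
      N≤ : N ℕ.≤ 4 ℕ.* 2 ℕ.^ e
      N≤ = ℕ-lin₁ 1 (ℕ.+-mono-≤ (ℕ.m^n>0 2 e) (ℕ.m^n>0 2 e)) (identity (2 ℕ.^ e))
        where
        identity : ∀ p → suc (2 ℕ.* p) ℕ.+ (p ℕ.+ p) ℕ.+ 1 ≡ 4 ℕ.* p ℕ.+ 2
        identity = ℕSolver.solve-∀

  hasSmallCover : cut 0ℝ < cut δ → ∀ {ε} → 0ℚ ℚ.< ε →
    Σ[ (C , v , _) ∈ (Σ[ C ∈ DeltaCover δ E ] Σ[ v ∈ ℝ ] HasSum (λ i → cut (diam C i) ^ ι (exponent k)) (cut v)) ] Above (cut v) ε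
  hasSmallCover (q₀ , 0<q₀ , q₀<δ) {ε} 0<ε = build (∃½^-below 0<q₀) (∃½^-below-scaled (fromℕ 4) 0<ε)
    where
    build : ∃[ a ] ½ ^ℚ a ℚ.< q₀ → ∃[ b ] fromℕ 4 ℚ.* ½ ^ℚ b ℚ.< ε → _
    build (a , ½^a<q₀) (b , 4½^b<ε) = (cover , fromℚ total , hasSum) , ℚ.≤-<-trans total≤ (ℚ.≤-<-trans
        (*-monoʳ-≤ {fromℕ 4} {½ ^ℚ l} {½ ^ℚ b} (0≤fromℕ 4) (½^-antimono-≤ {b} {l} (ℕ.m≤n⇒m≤1+n (ℕ.m≤n+m b a)))) 4½^b<ε)
      where
      -- `a` brings the widths below `δ` and `b` brings the total below `ε`; the successor makes the
      -- width `½ ^ e` less than 1.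
      l = suc (a ℕ.+ b)
      small : ∀ {q} → Above (cut δ) q → ½ ^ℚ (K ℕ.* l) ℚ.< q
      small δ<q = ℚ.≤-<-trans (½^-antimono-≤ {a} {K ℕ.* l} (ℕ.≤-trans (ℕ.m≤n⇒m≤1+n (ℕ.m≤m+n a b)) (ℕ.m≤m+n l (k ℕ.* l))))
        (ℚ.<-trans ½^a<q₀ (Below⇒<Above δ q₀<δ δ<q))
      open IntervalCover l (s≤s z≤n) small

-- Every premeasure is exactly 0: sums over covers are nonnegative, and for each `δ` there are
-- covers with arbitrarily small sum. The exponents `1 + 1 / (k + 1)` come arbitrarily close to 1.
dimension≤1 : ∀ {E : Subset} → (∀ {x} → x ∈ E → cut 0ℝ < cut x × cut x ≤ cut 1ℝ) → ∀ q → 1ℚ ℚ.< q →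
  Σ[ (s , _) ∈ (Σ[ s ∈ ℝ ] cut 0ℝ < cut s × IsHausdorffMeasure s E 0ℝ) ] Above (cut s) q
dimension≤1 {E} E⊆ q 1<q = build (archimedean 1ℚ (p<q⇒0<q-p 1<q))
  where
  build : ∃[ n ] 1ℚ ℚ.< fromℕ n ℚ.* (q ℚ.- 1ℚ) → _
  build (k , 1<k[q-1]) = (fromℚ (exponent k) , (1ℚ , 0<1 , 1<exponent k) , measure) , exponent<q
    where
    measure : IsHausdorffMeasure (fromℚ (exponent k)) E 0ℝ
    measure = (λ _ _ → 0ℝ)
      , (λ δ δ>0 → (λ (C , v , hasSum) → HasSum-nonneg (λ i → proj₁) v hasSum) , λ ε 0<ε → hasSmallCover {E} E⊆ k δ δ>0 0<ε)
      , (λ _ (p , 0<p , p<0) → ℚ.<-asym 0<p p<0) , λ p p<0 → (1ℝ , ½ , 0<½ , ½<1) , p<0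
    exponent<q : exponent k ℚ.< q
    exponent<q = /-< (suc (suc k)) (suc k) {q} (subst₂ ℚ._<_ (sym (trans (fromℕ-suc (suc k)) (cong (1ℚ ℚ.+_) (fromℕ-suc k)))) (cong (q ℚ.*_) (sym (fromℕ-suc k)))
      (<-lin₂ 1<k[q-1] 1<q (identity (fromℕ k) q)))
      where
      identity : ∀ m q → ((m ℚ.* (q ℚ.- 1ℚ) ℚ.- 1ℚ) ℚ.+ (q ℚ.- 1ℚ)) ℚ.+ (1ℚ ℚ.+ (1ℚ ℚ.+ m)) ≡ q ℚ.* (1ℚ ℚ.+ m)
      identity = solve-∀ ℚ-ring

-- The bits of the constructed points.  Bit n has weight 2^-(n+1), and
-- n + 1 = 2^(block n) + offset n.  In block k the first c k bits are forced to
-- be 0, which produces the large digit of that block; outside these runs every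
-- (1+m₀)-th bit is forced to be 1, and all other bits are free.

indicator : ∀ {P : Set} → Dec P → ℕ
indicator (yes _) = 1
indicator (no  _) = 0

count : ∀ {P : ℕ → Set} → (∀ n → Dec (P n)) → ℕ → ℕ
count P? zero    = 0
count P? (suc n) = count P? n ℕ.+ indicator (P? n)

isFree : Maybe Bool → ℕ
isFree nothing  = 1
isFree (just _) = 0

freeCount : (ℕ → Maybe Bool) → ℕ → ℕ
freeCount constraint zero    = 0
freeCount constraint (suc n) = freeCount constraint n ℕ.+ isFree (constraint n)

tick : ℕ × ℕ → ℕ × ℕ
tick (k , o) with suc o ℕ.<? 2 ℕ.^ k
... | yes _ = k , suc o
... | no  _ = suc k , 0

clock : ℕ → ℕ × ℕ
clock zero    = 0 , 0
clock (suc n) = tick (clock n)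

block offset : ℕ → ℕ
block  n = proj₁ (clock n)
offset n = proj₂ (clock n)

clock-spec : ∀ n → suc n ≡ 2 ℕ.^ block n ℕ.+ offset n × offset n ℕ.< 2 ℕ.^ block n
clock-spec zero = refl , s≤s z≤n
clock-spec (suc n) with clock n | clock-spec n
... | k , o | eq , o<2^k with suc o ℕ.<? 2 ℕ.^ k
...   | yes 1+o<2^k = trans (cong suc eq) (sym (ℕ.+-suc (2 ℕ.^ k) o)) , 1+o<2^k
...   | no  1+o≮2^k = trans (cong suc eq) (trans (sym (ℕ.+-suc (2 ℕ.^ k) o))
          (trans (cong (2 ℕ.^ k ℕ.+_) (ℕ.≤-antisym o<2^k (ℕ.≮⇒≥ 1+o≮2^k))) (identity (2 ℕ.^ k)))) , ℕ.m^n>0 2 (suc k)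
  where
  identity : ∀ p → p ℕ.+ p ≡ 2 ℕ.* p ℕ.+ 0
  identity = ℕSolver.solve-∀

2^-gap : ∀ {j k o} → j ℕ.< k → o ℕ.< 2 ℕ.^ j → 2 ℕ.^ j ℕ.+ o ℕ.< 2 ℕ.^ k
2^-gap {j} {k} {o} j<k o<2^j = ℕ.≤-trans (ℕ.+-monoʳ-< (2 ℕ.^ j) o<2^j)
  (ℕ.≤-trans (ℕ.≤-reflexive (cong (2 ℕ.^ j ℕ.+_) (sym (ℕ.+-identityʳ (2 ℕ.^ j))))) (ℕ.^-monoʳ-≤ 2 j<k))

clock-unique : ∀ {n k o} → suc n ≡ 2 ℕ.^ k ℕ.+ o → o ℕ.< 2 ℕ.^ k → clock n ≡ (k , o)
clock-unique {n} {k} {o} eq o<2^k with clock n | clock-spec n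
... | k′ , o′ | eq′ , o′<2^k′ with ℕ.<-cmp k′ k
...   | tri≈ _ refl _ = cong (k ,_) (ℕ.+-cancelˡ-≡ (2 ℕ.^ k) o′ o (trans (sym eq′) eq))
...   | tri< k′<k _ _ = ⊥-elim (ℕ.<-irrefl (trans (sym eq′) eq) (ℕ.<-≤-trans (2^-gap k′<k o′<2^k′) (ℕ.m≤m+n (2 ℕ.^ k) o)))
...   | tri> _ _ k<k′ = ⊥-elim (ℕ.<-irrefl (trans (sym eq) eq′) (ℕ.<-≤-trans (2^-gap k<k′ o<2^k) (ℕ.m≤m+n (2 ℕ.^ k′) o′)))

forced : ∀ {A B : Set} → Dec A → Dec B → Maybe Bool
forced (yes _) _       = just false
forced (no  _) (yes _) = just true
forced (no  _) (no  _) = nothing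

-- `sparse` serves twice: `4 m c k ≤ 2 ^ k` makes the zero runs rare compared with the forced ones,
-- and the summand `m` leaves room in block `k` for a one after its run. Blocks without a run are
-- exempt, the first ones being too short.
module Constraint (c : ℕ → ℕ) (m₀ : ℕ)
                  (sparse : ∀ k → 0 ℕ.< c k → 4 ℕ.* suc m₀ ℕ.* (c k ℕ.+ suc m₀) ℕ.≤ 2 ℕ.^ k) where

  m : ℕ
  m = suc m₀

  -- This is `− n` modulo `m`, the distance from `n` to the next multiple of `m`.
  countdown : ℕ → ℕ
  countdown zero    = 0
  countdown (suc n) with countdown n
  ... | zero  = m₀
  ... | suc r = r

  Frozen Due : ℕ → Set
  Frozen n = offset n ℕ.< c (block n)
  Due    n = countdown n ≡ 0

  frozen? : ∀ n → Dec (Frozen n)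
  frozen? n = offset n ℕ.<? c (block n)

  due? : ∀ n → Dec (Due n)
  due? n = countdown n ℕ.≟ 0

  constraint : ℕ → Maybe Bool
  constraint n = forced (frozen? n) (due? n)

  countdown≤ : ∀ n → countdown n ℕ.≤ m₀
  countdown≤ zero = z≤n
  countdown≤ (suc n) with countdown n | countdown≤ n
  ... | zero  | _     = ℕ.≤-refl
  ... | suc r | r<m₀  = ℕ.<⇒≤ r<m₀

  countdown-due : ∀ n r → countdown n ≡ r → Due (n ℕ.+ r)
  countdown-due n zero    eq = trans (cong countdown (ℕ.+-identityʳ n)) eq
  countdown-due n (suc r) eq = trans (cong countdown (ℕ.+-suc n r)) (countdown-due (suc n) r (step eq))
    where
    step : countdown n ≡ suc r → countdown (suc n) ≡ r
    step eq with countdown n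
    step refl | .(suc r) = refl

  -- The count is `n / m` rounded up, and `countdown n` is the rounding error.
  m*count-due : ∀ n → m ℕ.* count due? n ≡ n ℕ.+ countdown n
  m*count-due zero = ℕ.*-zeroʳ m
  m*count-due (suc n) with m*count-due n
  ... | ih with countdown n
  ...   | zero  = trans (ℕ.*-distribˡ-+ m (count due? n) 1) (trans (cong₂ ℕ._+_ ih (ℕ.*-identityʳ m)) (identity n m₀))
    where
    identity : ∀ n k → n ℕ.+ 0 ℕ.+ suc k ≡ suc n ℕ.+ k
    identity = ℕSolver.solve-∀
  ...   | suc r = trans (cong (m ℕ.*_) (ℕ.+-identityʳ (count due? n))) (trans ih (ℕ.+-suc n r))

  4m*c≤2^k : ∀ k → 4 ℕ.* m ℕ.* c k ℕ.≤ 2 ℕ.^ k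
  4m*c≤2^k k with c k in eq
  ... | zero  = subst (ℕ._≤ 2 ℕ.^ k) (sym (ℕ.*-zeroʳ (4 ℕ.* m))) z≤n
  ... | suc i = ℕ.≤-trans (ℕ.*-monoʳ-≤ (4 ℕ.* m) (ℕ.m≤m+n (suc i) m))
                  (subst (λ i → 4 ℕ.* m ℕ.* (i ℕ.+ m) ℕ.≤ 2 ℕ.^ k) eq (sparse k (subst (0 ℕ.<_) (sym eq) (s≤s z≤n))))

  -- A place that enters the count leaves the rest of the run, so inside a block their sum never
  -- increases.
  frozen-step : ∀ o z i (d : Dec (o ℕ.< z)) → i ℕ.+ indicator d ℕ.+ (z ℕ.∸ suc o) ℕ.≤ i ℕ.+ (z ℕ.∸ o)
  frozen-step o z i (yes o<z) = ℕ.≤-reflexive (trans (ℕ.+-assoc i 1 _) (cong (i ℕ.+_) (sym (ℕ.+-∸-assoc 1 o<z))))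
  frozen-step o z i (no  o≮z) = ℕ.≤-reflexive (trans (cong (ℕ._+ (z ℕ.∸ suc o)) (ℕ.+-identityʳ i))
    (cong (i ℕ.+_) (trans (ℕ.m≤n⇒m∸n≡0 (ℕ.m≤n⇒m≤1+n (ℕ.≮⇒≥ o≮z))) (sym (ℕ.m≤n⇒m∸n≡0 (ℕ.≮⇒≥ o≮z))))))

  -- Counting in advance the rest of the current run makes the bound inductive.
  count-frozen-ahead : ∀ n → 4 ℕ.* m ℕ.* (count frozen? n ℕ.+ (c (block n) ℕ.∸ offset n)) ℕ.≤ 2 ℕ.* 2 ℕ.^ block n
  count-frozen-ahead zero = ℕ.≤-trans (4m*c≤2^k 0) (s≤s z≤n)
  count-frozen-ahead (suc n) with clock n | count frozen? n ℕ.+ indicator (frozen? n) | frozen-step (offset n) (c (block n)) (count frozen? n) (frozen? n) | count-frozen-ahead n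
  ... | k , o | Z | step | ih with suc o ℕ.<? 2 ℕ.^ k
  ...   | yes _ = ℕ.≤-trans (ℕ.*-monoʳ-≤ (4 ℕ.* m) step) ih
  -- On entering block `k + 1` the old count accounts for at most `2 * 2 ^ k = 2 ^ (k + 1)` and the
  -- new run for at most another `2 ^ (k + 1)`.
  ...   | no  _ = ℕ.≤-trans (ℕ.≤-reflexive (ℕ.*-distribˡ-+ (4 ℕ.* m) Z (c (suc k))))
    (ℕ.≤-trans (ℕ.+-mono-≤ (ℕ.≤-trans (ℕ.*-monoʳ-≤ (4 ℕ.* m) (ℕ.≤-trans (ℕ.m≤m+n Z _) step)) ih) (4m*c≤2^k (suc k)))
      (ℕ.≤-reflexive (cong (2 ℕ.^ suc k ℕ.+_) (sym (ℕ.+-identityʳ (2 ℕ.^ suc k))))))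

  count-frozen : ∀ n → 4 ℕ.* m ℕ.* count frozen? n ℕ.≤ 2 ℕ.* suc n
  count-frozen n = ℕ.≤-trans (ℕ.*-monoʳ-≤ (4 ℕ.* m) (ℕ.m≤m+n (count frozen? n) _)) (ℕ.≤-trans (count-frozen-ahead n)
    (ℕ.*-monoʳ-≤ 2 (ℕ.≤-trans (ℕ.m≤m+n (2 ℕ.^ block n) (offset n)) (ℕ.≤-reflexive (sym (proj₁ (clock-spec n)))))))

  covered-count : ∀ n → n ℕ.≤ freeCount constraint n ℕ.+ count frozen? n ℕ.+ count due? n
  covered-count zero = z≤n
  covered-count (suc n) = ℕ-lin₂ 0 (covered-count n) (some (frozen? n) (due? n))
    (identity n (freeCount constraint n) (count frozen? n) (count due? n)
      (isFree (constraint n)) (indicator (frozen? n)) (indicator (due? n)))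
    where
    some : ∀ {A B : Set} (a : Dec A) (b : Dec B) → 1 ℕ.≤ isFree (forced a b) ℕ.+ indicator a ℕ.+ indicator b
    some (yes _) _       = s≤s z≤n
    some (no  _) (yes _) = s≤s z≤n
    some (no  _) (no  _) = s≤s z≤n
    identity : ∀ n f z d f′ z′ d′ → suc n ℕ.+ ((f ℕ.+ z ℕ.+ d) ℕ.+ (f′ ℕ.+ z′ ℕ.+ d′)) ℕ.+ 0 ≡
               f ℕ.+ f′ ℕ.+ (z ℕ.+ z′) ℕ.+ (d ℕ.+ d′) ℕ.+ (n ℕ.+ 1)
    identity = ℕSolver.solve-∀

  -- Frozen places have density at most `1 / (2 m)` and due places `1 / m`, so up to bounded terms
  -- the free places have density at least `1 − 3 / (2 m)`.
  freeCount-large : ∀ n → 2 ℕ.* m ℕ.* n ℕ.≤ 2 ℕ.* m ℕ.* freeCount constraint n ℕ.+ (3 ℕ.* n ℕ.+ 2 ℕ.* m ℕ.+ 1)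
  freeCount-large n = ℕ.≤-trans (ℕ.*-monoʳ-≤ (2 ℕ.* m) (covered-count n))
    (ℕ-lin₃ 2 frozen-few due-few due-few (identity m₀ (freeCount constraint n) (count frozen? n) (count due? n) n))
    where
    frozen-few : 2 ℕ.* m ℕ.* count frozen? n ℕ.≤ suc n
    frozen-few = ℕ.*-cancelˡ-≤ 2 (ℕ.≤-trans (ℕ.≤-reflexive (double m (count frozen? n))) (count-frozen n))
      where
      double : ∀ m z → 2 ℕ.* (2 ℕ.* m ℕ.* z) ≡ 4 ℕ.* m ℕ.* z
      double = ℕSolver.solve-∀
    due-few : m ℕ.* count due? n ℕ.≤ n ℕ.+ m₀
    due-few = ℕ.≤-trans (ℕ.≤-reflexive (m*count-due n)) (ℕ.+-monoʳ-≤ n (countdown≤ n))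
    identity : ∀ k f z d n → 2 ℕ.* suc k ℕ.* (f ℕ.+ z ℕ.+ d) ℕ.+ (suc n ℕ.+ ((n ℕ.+ k) ℕ.+ (n ℕ.+ k))) ℕ.+ 2 ≡
               2 ℕ.* suc k ℕ.* f ℕ.+ (3 ℕ.* n ℕ.+ 2 ℕ.* suc k ℕ.+ 1) ℕ.+ (2 ℕ.* suc k ℕ.* z ℕ.+ (suc k ℕ.* d ℕ.+ suc k ℕ.* d))
    identity = ℕSolver.solve-∀

  forced-one : ∀ n → ¬ Frozen n → Due n → constraint n ≡ just true
  forced-one n ¬frozen due with frozen? n | due? n
  ... | yes frozen | _       = ⊥-elim (¬frozen frozen)
  ... | no _       | yes _   = refl
  ... | no _       | no ¬due = ⊥-elim (¬due due)

  c≤2^k : ∀ k → c k ℕ.≤ 2 ℕ.^ k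
  c≤2^k k = ℕ.≤-trans (ℕ.m≤m+n (c k) _) (4m*c≤2^k k)

  forced-zero : ∀ n k o → suc n ≡ 2 ℕ.^ k ℕ.+ o → o ℕ.< c k → constraint n ≡ just false
  forced-zero n k o eq o<c with frozen? n
  ... | yes _ = refl
  ... | no ¬frozen = ⊥-elim (¬frozen (subst (λ (k , o) → o ℕ.< c k) (sym (clock-unique eq (ℕ.<-≤-trans o<c (c≤2^k k)))) o<c))

  -- The next due place may fall into a run of zeros; then the first due place after that run is
  -- taken. By `sparse` it still belongs to the same block, so it cannot fall into another run.
  next-one : ∀ n → ∃[ g ] constraint (n ℕ.+ g) ≡ just true × g ℕ.≤ c (block (n ℕ.+ countdown n)) ℕ.+ 2 ℕ.* m
  next-one n = decide (frozen? n₁)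
    where
    n₁ = n ℕ.+ countdown n
    k  = block n₁
    countdown≤m : ∀ p → countdown p ℕ.≤ m
    countdown≤m p = ℕ.m≤n⇒m≤1+n (countdown≤ p)
    decide : Dec (Frozen n₁) → ∃[ g ] constraint (n ℕ.+ g) ≡ just true × g ℕ.≤ c k ℕ.+ 2 ℕ.* m
    decide (no ¬frozen) = countdown n , forced-one n₁ ¬frozen (countdown-due n (countdown n) refl) ,
      ℕ.≤-trans (countdown≤m n) (ℕ.≤-trans (ℕ.m≤m+n m _) (ℕ.m≤n+m (2 ℕ.* m) (c k)))
    decide (yes o<c) = g , subst (λ p → constraint p ≡ just true) (sym n+g≡) (forced-one n₂ ¬frozen (countdown-due e (countdown e) refl)) , g≤
      where
      o = offset n₁
      e = n₁ ℕ.+ (c k ℕ.∸ o)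
      g = countdown n ℕ.+ (c k ℕ.∸ o) ℕ.+ countdown e
      n₂ = e ℕ.+ countdown e
      n+g≡ : n ℕ.+ g ≡ n₂
      n+g≡ = identity n (countdown n) (c k ℕ.∸ o) (countdown e)
        where
        identity : ∀ a b c d → a ℕ.+ (b ℕ.+ c ℕ.+ d) ≡ a ℕ.+ b ℕ.+ c ℕ.+ d
        identity = ℕSolver.solve-∀
      after : suc n₂ ≡ 2 ℕ.^ k ℕ.+ (c k ℕ.+ countdown e)
      after = trans (cong (λ p → p ℕ.+ (c k ℕ.∸ o) ℕ.+ countdown e) (proj₁ (clock-spec n₁)))
        (trans (identity (2 ℕ.^ k) o (c k ℕ.∸ o) (countdown e)) (cong (λ z → 2 ℕ.^ k ℕ.+ (z ℕ.+ countdown e)) (ℕ.m+[n∸m]≡n (ℕ.<⇒≤ o<c))))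
        where
        identity : ∀ a b c d → a ℕ.+ b ℕ.+ c ℕ.+ d ≡ a ℕ.+ ((b ℕ.+ c) ℕ.+ d)
        identity = ℕSolver.solve-∀
      within : c k ℕ.+ countdown e ℕ.< 2 ℕ.^ k
      within = ℕ.≤-trans (ℕ.≤-reflexive (sym (ℕ.+-suc (c k) (countdown e)))) (ℕ.≤-trans (ℕ.+-monoʳ-≤ (c k) (s≤s (countdown≤ e)))
        (ℕ.≤-trans (ℕ.m≤m+n (c k ℕ.+ m) _) (sparse k (ℕ.≤-<-trans z≤n o<c))))
      ¬frozen : ¬ Frozen n₂
      ¬frozen frozen = ℕ.<-irrefl refl (ℕ.<-≤-trans (subst (λ (k , o) → o ℕ.< c k) (clock-unique after within) frozen) (ℕ.m≤m+n (c k) (countdown e)))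
      g≤ : g ℕ.≤ c k ℕ.+ 2 ℕ.* m
      g≤ = ℕ-lin₃ 0 (countdown≤m n) (countdown≤m e) (ℕ.m∸n≤m (c k) o) (identity (countdown n) (c k ℕ.∸ o) (countdown e) (c k) m)
        where
        identity : ∀ a b d c m → a ℕ.+ b ℕ.+ d ℕ.+ (m ℕ.+ (m ℕ.+ c)) ℕ.+ 0 ≡ c ℕ.+ 2 ℕ.* m ℕ.+ (a ℕ.+ (d ℕ.+ b))
        identity = ℕSolver.solve-∀

  module _ (bit : ℕ → Bool) (respects : ∀ n {v} → constraint n ≡ just v → bit n ≡ v) where

    one? : ∀ n → Dec (bit n ≡ true)
    one? n = bit n Bool.≟ true

    count-due≤ : ∀ n → count due? n ℕ.≤ count one? n ℕ.+ count frozen? n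
    count-due≤ zero = z≤n
    count-due≤ (suc n) = ℕ-lin₂ 0 (count-due≤ n) (some (respects n))
      (identity (count due? n) (count one? n) (count frozen? n) (indicator (due? n)) (indicator (one? n)) (indicator (frozen? n)))
      where
      some : (∀ {v} → forced (frozen? n) (due? n) ≡ just v → bit n ≡ v) → indicator (due? n) ℕ.≤ indicator (one? n) ℕ.+ indicator (frozen? n)
      some resp with frozen? n | due? n | one? n
      ... | _     | no _  | _      = z≤n
      ... | yes _ | yes _ | o      = ℕ.m≤n+m 1 (indicator o)
      ... | no _  | yes _ | yes _  = s≤s z≤n
      ... | no _  | yes _ | no ¬one = ⊥-elim (¬one (resp refl))
      identity : ∀ d o z d′ o′ z′ → d ℕ.+ d′ ℕ.+ ((o ℕ.+ z) ℕ.+ (o′ ℕ.+ z′)) ℕ.+ 0 ≡ o ℕ.+ o′ ℕ.+ (z ℕ.+ z′) ℕ.+ (d ℕ.+ d′)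
      identity = ℕSolver.solve-∀

    count-one-large : ∀ n → n ℕ.≤ 2 ℕ.* m ℕ.* count one? n ℕ.+ 1
    count-one-large n = ℕ.*-cancelˡ-≤ 2 (ℕ-lin₃ (4 ℕ.* countdown n) (ℕ.≤-reflexive (cong (4 ℕ.*_) (sym (m*count-due n))))
      (ℕ.*-monoʳ-≤ (4 ℕ.* m) (count-due≤ n)) (count-frozen n)
      (identity n (count due? n) (count one? n) (count frozen? n) (countdown n) m))
      where
      identity : ∀ n d o z r m → 2 ℕ.* n ℕ.+ (4 ℕ.* (m ℕ.* d) ℕ.+ (4 ℕ.* m ℕ.* (o ℕ.+ z) ℕ.+ 2 ℕ.* suc n)) ℕ.+ 4 ℕ.* r ≡
                 2 ℕ.* (2 ℕ.* m ℕ.* o ℕ.+ 1) ℕ.+ (4 ℕ.* (n ℕ.+ r) ℕ.+ (4 ℕ.* m ℕ.* d ℕ.+ 4 ℕ.* m ℕ.* z))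
      identity = ℕSolver.solve-∀

-- The real number and the digits given by a sequence of bits

bitValue : Bool → ℕ
bitValue true  = 1
bitValue false = 0

prefix : (ℕ → Bool) → ℕ → ℕ
prefix bit zero    = 0
prefix bit (suc n) = 2 ℕ.* prefix bit n ℕ.+ bitValue (bit n)

maxDigit-≥ : ∀ d {n i} → i ℕ.< n → d i ℕ.≤ maxDigit d n
maxDigit-≥ d {suc n} {i} i<1+n with ℕ.m<1+n⇒m<n∨m≡n i<1+n
... | inj₁ i<n  = ℕ.≤-trans (maxDigit-≥ d i<n) (ℕ.m≤m⊔n (maxDigit d n) (d n))
... | inj₂ refl = ℕ.m≤n⊔m (maxDigit d n) (d n)

maxDigit-attained : ∀ d n → ∃[ i ] i ℕ.< suc n × maxDigit d (suc n) ≡ d i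
maxDigit-attained d zero = 0 , s≤s z≤n , refl
maxDigit-attained d (suc n) with ℕ.⊔-sel (maxDigit d (suc n)) (d (suc n)) | maxDigit-attained d n
... | inj₁ eq | i , i<1+n , eq′ = i , ℕ.m≤n⇒m≤1+n i<1+n , trans eq eq′
... | inj₂ eq | _               = suc n , ℕ.≤-refl , eq

module Expansion (bit : ℕ → Bool) (next : ∀ n → ∃[ g ] bit (n ℕ.+ g) ≡ true) where

  X : ℕ → ℚ
  X n = fromℕ (prefix bit n) ℚ.* ½ ^ℚ n

  bitWeight : ℕ → ℚ
  bitWeight n = fromℕ (bitValue (bit n)) ℚ.* ½ ^ℚ suc n

  X-suc : ∀ n → X (suc n) ≡ X n ℚ.+ bitWeight n
  X-suc n = begin
    fromℕ (2 ℕ.* P ℕ.+ v) ℚ.* (½ ℚ.* ½ ^ℚ n)                        ≡⟨ cong (ℚ._* (½ ℚ.* ½ ^ℚ n)) (trans (fromℕ-+ (2 ℕ.* P) v) (cong (ℚ._+ fromℕ v) (fromℕ-* 2 P))) ⟩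
    (fromℕ 2 ℚ.* fromℕ P ℚ.+ fromℕ v) ℚ.* (½ ℚ.* ½ ^ℚ n)            ≡⟨ identity (fromℕ P) (fromℕ v) (½ ^ℚ n) ⟩
    fromℕ P ℚ.* ½ ^ℚ n ℚ.+ fromℕ v ℚ.* (½ ℚ.* ½ ^ℚ n)               ∎
    where
    open ≡-Reasoning
    P = prefix bit n
    v = bitValue (bit n)
    identity : ∀ p v h → (fromℕ 2 ℚ.* p ℚ.+ v) ℚ.* (½ ℚ.* h) ≡ p ℚ.* h ℚ.+ v ℚ.* (½ ℚ.* h)
    identity = solve-∀ ℚ-ring

  X-zero : ∀ {n} → bit n ≡ false → X (suc n) ≡ X n
  X-zero {n} eq = trans (X-suc n) (trans (cong (λ b → X n ℚ.+ fromℕ (bitValue b) ℚ.* ½ ^ℚ suc n) eq)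
    (trans (cong (X n ℚ.+_) (ℚ.*-zeroˡ (½ ^ℚ suc n))) (ℚ.+-identityʳ (X n))))

  X-one : ∀ {n} → bit n ≡ true → X (suc n) ≡ X n ℚ.+ ½ ^ℚ suc n
  X-one {n} eq = trans (X-suc n) (trans (cong (λ b → X n ℚ.+ fromℕ (bitValue b) ℚ.* ½ ^ℚ suc n) eq)
    (cong (X n ℚ.+_) (ℚ.*-identityˡ (½ ^ℚ suc n))))

  X≤X-suc : ∀ n → X n ℚ.≤ X (suc n)
  X≤X-suc n with bit n in eq
  ... | true  = subst (X n ℚ.≤_) (sym (trans (cong (λ b → fromℕ (2 ℕ.* prefix bit n ℕ.+ bitValue b) ℚ.* ½ ^ℚ suc n) (sym eq)) (X-one eq)))
                  (subst (ℚ._≤ X n ℚ.+ ½ ^ℚ suc n) (ℚ.+-identityʳ (X n)) (ℚ.+-monoʳ-≤ (X n) (ℚ.<⇒≤ (½^-pos (suc n)))))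
  ... | false = ℚ.≤-reflexive (sym (trans (cong (λ b → fromℕ (2 ℕ.* prefix bit n ℕ.+ bitValue b) ℚ.* ½ ^ℚ suc n) (sym eq)) (X-zero eq)))

  X-suc≤ : ∀ n → X (suc n) ℚ.+ ½ ^ℚ suc n ℚ.≤ X n ℚ.+ ½ ^ℚ n
  X-suc≤ n = begin
    X (suc n) ℚ.+ h                        ≡⟨ cong (ℚ._+ h) (X-suc n) ⟩
    X n ℚ.+ fromℕ v ℚ.* h ℚ.+ h            ≤⟨ ℚ.+-monoˡ-≤ h (ℚ.+-monoʳ-≤ (X n) (ℚ.≤-trans (*-monoˡ-≤ {h} (ℚ.<⇒≤ (½^-pos (suc n))) (fromℕ-mono-≤ {v} {1} (v≤1 (bit n)))) (ℚ.≤-reflexive (ℚ.*-identityˡ h)))) ⟩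
    X n ℚ.+ h ℚ.+ h                        ≡⟨ ℚ.+-assoc (X n) h h ⟩
    X n ℚ.+ (h ℚ.+ h)                      ≡⟨ cong (X n ℚ.+_) (½^-double n) ⟩
    X n ℚ.+ ½ ^ℚ n                         ∎
    where
    open ℚ.≤-Reasoning
    h = ½ ^ℚ suc n
    v = bitValue (bit n)
    v≤1 : ∀ b → bitValue b ℕ.≤ 1
    v≤1 true  = s≤s z≤n
    v≤1 false = z≤n

  X-mono : ∀ n k → X n ℚ.≤ X (k ℕ.+ n)
  X-mono n zero    = ℚ.≤-refl
  X-mono n (suc k) = ℚ.≤-trans (X-mono n k) (X≤X-suc (k ℕ.+ n))

  X+½^-antimono : ∀ n k → X (k ℕ.+ n) ℚ.+ ½ ^ℚ (k ℕ.+ n) ℚ.≤ X n ℚ.+ ½ ^ℚ n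
  X+½^-antimono n zero    = ℚ.≤-refl
  X+½^-antimono n (suc k) = ℚ.≤-trans (X-suc≤ (k ℕ.+ n)) (X+½^-antimono n k)

  X<X+½^ : ∀ m n → X m ℚ.< X n ℚ.+ ½ ^ℚ n
  X<X+½^ m n = ℚ.≤-<-trans (subst (λ k → X m ℚ.≤ X k) (ℕ.+-comm n m) (X-mono m n))
    (ℚ.<-≤-trans (subst (ℚ._< X (m ℕ.+ n) ℚ.+ ½ ^ℚ (m ℕ.+ n)) (ℚ.+-identityʳ (X (m ℕ.+ n))) (ℚ.+-monoʳ-< (X (m ℕ.+ n)) (½^-pos (m ℕ.+ n))))
      (X+½^-antimono n m))

  x : ℝ
  x = record
    { cut        = ⟪ (λ q → ∃[ n ] q ℚ.< X n) , (λ q → ∃[ n ] X n ℚ.+ ½ ^ℚ n ℚ.< q) ⟫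
    ; isDedekind = record
      { below-inhabited = ℚ.- 1ℚ , 0 , ℚ.negative⁻¹ (ℚ.- 1ℚ)
      ; above-inhabited = fromℕ 2 , 0 , fromℕ-mono-< {1} {2} (s≤s (s≤s z≤n))
      ; below-lower     = λ p<q (n , q<X) → n , ℚ.<-trans p<q q<X
      ; above-upper     = λ p<q (n , X<p) → n , ℚ.<-trans X<p p<q
      ; below-open      = λ (n , p<X) → let q , p<q , q<X = ℚ.<-dense p<X in q , p<q , n , q<X
      ; above-open      = λ (n , X<q) → let p , X<p , p<q = ℚ.<-dense X<q in p , p<q , n , X<p
      ; disjoint        = λ ((m , q<X) , (n , X<q)) → ℚ.<-asym (X<X+½^ m n) (ℚ.<-trans X<q q<X)
      ; located         = λ {p} {q} p<q → locate p q (∃½^-below (p<q⇒0<q-p p<q))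
      }
    }
    where
    locate : ∀ p q → ∃[ n ] ½ ^ℚ n ℚ.< q ℚ.- p → (∃[ n ] p ℚ.< X n) ⊎ (∃[ n ] X n ℚ.+ ½ ^ℚ n ℚ.< q)
    locate p q (n , ½^n<q-p) with p ℚ.<? X n
    ... | yes p<X = inj₁ (n , p<X)
    ... | no  p≮X = inj₂ (n , <≤-lin₂ ½^n<q-p (ℚ.≮⇒≥ p≮X) (identity p q (X n) (½ ^ℚ n)))
      where
      identity : ∀ p q x h → ((q ℚ.- p ℚ.- h) ℚ.+ (p ℚ.- x)) ℚ.+ (x ℚ.+ h) ≡ q
      identity = solve-∀ ℚ-ring

  X≤x : ∀ n → AtLeast (cut x) (X n)
  X≤x n = atLeast λ c<X → n , c<X

  x≤X+½^ : ∀ n → AtMost (cut x) (X n ℚ.+ ½ ^ℚ n)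
  x≤X+½^ n = atMost λ X<c → n , X<c

  x≤1 : cut x ≤ cut 1ℝ
  x≤1 (q , 1<q , (n , q<X)) = ℚ.<-asym (X<X+½^ n 0) (ℚ.<-trans 1<q q<X)

  first-one : ∀ n g → bit (n ℕ.+ g) ≡ true → ∃[ h ] h ℕ.≤ g × bit (n ℕ.+ h) ≡ true × (∀ i → i ℕ.< h → bit (n ℕ.+ i) ≡ false)
  first-one n zero    one = 0 , z≤n , one , λ _ ()
  first-one n (suc g) one with bit n in eq
  ... | true  = 0 , z≤n , trans (cong bit (ℕ.+-identityʳ n)) eq , λ _ ()
  ... | false with first-one (suc n) g (trans (cong bit (sym (ℕ.+-suc n g))) one)
  ...   | h , h≤g , one′ , zeros = suc h , s≤s h≤g , trans (cong bit (ℕ.+-suc n h)) one′ , zeros′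
    where
    zeros′ : ∀ i → i ℕ.< suc h → bit (n ℕ.+ i) ≡ false
    zeros′ zero    _         = trans (cong bit (ℕ.+-identityʳ n)) eq
    zeros′ (suc i) (s≤s i<h) = trans (cong bit (ℕ.+-suc n i)) (zeros i i<h)

  gap : ℕ → ℕ
  gap n = proj₁ (first-one n (proj₁ (next n)) (proj₂ (next n)))

  gap≤next : ∀ n → gap n ℕ.≤ proj₁ (next n)
  gap≤next n = proj₁ (proj₂ (first-one n (proj₁ (next n)) (proj₂ (next n))))

  gap-one : ∀ n → bit (n ℕ.+ gap n) ≡ true
  gap-one n = proj₁ (proj₂ (proj₂ (first-one n (proj₁ (next n)) (proj₂ (next n)))))

  gap-zeros : ∀ n i → i ℕ.< gap n → bit (n ℕ.+ i) ≡ false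
  gap-zeros n = proj₂ (proj₂ (proj₂ (first-one n (proj₁ (next n)) (proj₂ (next n)))))

  -- `start i` is the place just after the `i`-th one. Since bit `p` has weight `½ ^ (p + 1)`, the
  -- exponent of the next one is `start (suc i)`, and its difference from `start i` is the digit.
  start digit : ℕ → ℕ
  start zero    = 0
  start (suc i) = start i ℕ.+ suc (gap (start i))
  digit i = suc (gap (start i))

  digitSum-digit : ∀ i → digitSum digit i ≡ start (suc i)
  digitSum-digit zero    = refl
  digitSum-digit (suc i) = cong (ℕ._+ digit (suc i)) (digitSum-digit i)

  i≤start : ∀ i → i ℕ.≤ start i
  i≤start zero    = z≤n
  i≤start (suc i) = ℕ.≤-trans (s≤s (ℕ.≤-trans (i≤start i) (ℕ.m≤m+n (start i) (gap (start i))))) (ℕ.≤-reflexive (sym (ℕ.+-suc (start i) (gap (start i)))))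

  X-gap : ∀ n j → j ℕ.≤ gap n → X (n ℕ.+ j) ≡ X n
  X-gap n zero    _   = cong X (ℕ.+-identityʳ n)
  X-gap n (suc j) j<g = trans (cong X (ℕ.+-suc n j)) (trans (X-zero (gap-zeros n j j<g)) (X-gap n j (ℕ.<⇒≤ j<g)))

  X-start : ∀ i → X (start (suc i)) ≡ X (start i) ℚ.+ ½ ^ℚ digitSum digit i
  X-start i = begin
    X (start (suc i))                        ≡⟨ cong X (ℕ.+-suc s g) ⟩
    X (suc (s ℕ.+ g))                        ≡⟨ X-one (gap-one s) ⟩
    X (s ℕ.+ g) ℚ.+ ½ ^ℚ suc (s ℕ.+ g)       ≡⟨ cong₂ ℚ._+_ (X-gap s g ℕ.≤-refl) (cong (½ ^ℚ_) (trans (sym (ℕ.+-suc s g)) (sym (digitSum-digit i)))) ⟩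
    X s ℚ.+ ½ ^ℚ digitSum digit i            ∎
    where
    open ≡-Reasoning
    s = start i
    g = gap (start i)

  ∑-digits : ∀ n → ∑ (λ i → ½ ^ℚ digitSum digit i) n ≡ X (start n)
  ∑-digits zero    = refl
  ∑-digits (suc n) = trans (cong (ℚ._+ ½ ^ℚ digitSum digit n) (∑-digits n)) (sym (X-start n))

  isExpansion : IsExpansion x digit
  isExpansion = (λ i → s≤s z≤n) , λ ε 0<ε → close (∃½^-below 0<ε)
    where
    close : ∀ {ε} → ∃[ N ] ½ ^ℚ N ℚ.< ε → ∃[ N ] (∀ n → N ℕ.≤ n → ∣ partialSum (λ i → ι (½ ^ℚ digitSum digit i)) n - cut x ∣ < ι ε)
    close {ε} (N , ½^N<ε) = N , λ n N≤n → ∣∣<ι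
      (−-atLeast (S-atLeast n) (x≤X+½^ (start n))) (−-atMost (S-atMost n) (X≤x (start n)))
      (<-lin₁ (ℚ.≤-<-trans (½^-antimono-≤ {N} {start n} (ℕ.≤-trans N≤n (i≤start n))) ½^N<ε) (identity (X (start n)) (½ ^ℚ start n) ε))
      (subst (ℚ._< ε) (sym (ℚ.+-inverseʳ (X (start n)))) (ℚ.<-trans (½^-pos N) ½^N<ε))
      where
      S-atLeast : ∀ n → AtLeast (partialSum (λ i → ι (½ ^ℚ digitSum digit i)) n) (X (start n))
      S-atLeast n = subst (AtLeast _) (∑-digits n) (partialSum-atLeast (λ i → ι-atLeast (½ ^ℚ digitSum digit i)) n)
      S-atMost : ∀ n → AtMost (partialSum (λ i → ι (½ ^ℚ digitSum digit i)) n) (X (start n))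
      S-atMost n = subst (AtMost _) (∑-digits n) (partialSum-atMost (λ i → ι-atMost (½ ^ℚ digitSum digit i)) n)
      identity : ∀ x h e → (e ℚ.- h) ℚ.+ ℚ.- e ≡ x ℚ.- (x ℚ.+ h)
      identity = solve-∀ ℚ-ring

  0<x : cut 0ℝ < cut x
  0<x = let q , 0<q , q<h = ℚ.<-dense (½^-pos (start 1)) in
    q , 0<q , start 1 , subst (q ℚ.<_) (sym (trans (X-start 0) (trans (cong (ℚ._+ ½ ^ℚ start 1) (ℚ.*-zeroˡ 1ℚ)) (ℚ.+-identityˡ (½ ^ℚ start 1))))) q<h

  one? : ∀ n → Dec (bit n ≡ true)
  one? n = bit n Bool.≟ true

  count-gap : ∀ n j → j ℕ.≤ gap n → count one? (n ℕ.+ j) ≡ count one? n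
  count-gap n zero    _   = cong (count one?) (ℕ.+-identityʳ n)
  count-gap n (suc j) j<g = trans (cong (count one?) (ℕ.+-suc n j)) (trans (cong (count one? (n ℕ.+ j) ℕ.+_) (zero-indicator (one? (n ℕ.+ j))))
    (trans (ℕ.+-identityʳ _) (count-gap n j (ℕ.<⇒≤ j<g))))
    where
    zero-indicator : (d : Dec (bit (n ℕ.+ j) ≡ true)) → indicator d ≡ 0
    zero-indicator (no _)    = refl
    zero-indicator (yes one) with trans (sym one) (gap-zeros n j j<g)
    ... | ()

  count-start : ∀ i → count one? (start i) ≡ i
  count-start zero    = refl
  count-start (suc i) = trans (cong (count one?) (ℕ.+-suc s g)) (trans (cong₂ ℕ._+_ (trans (count-gap s g ℕ.≤-refl) (count-start i)) (one-indicator (one? (s ℕ.+ g)))) (ℕ.+-comm i 1))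
    where
    s = start i
    g = gap (start i)
    one-indicator : (d : Dec (bit (s ℕ.+ g) ≡ true)) → indicator d ≡ 1
    one-indicator (yes _)   = refl
    one-indicator (no ¬one) = ⊥-elim (¬one (gap-one s))

  start-reaches : ∀ p → ∃[ i ] start i ℕ.≤ p × p ℕ.< start (suc i)
  start-reaches zero = 0 , z≤n , s≤s z≤n
  start-reaches (suc p) with start-reaches p
  ... | i , s≤p , p<s′ with suc p ℕ.<? start (suc i)
  ...   | yes 1+p<s′ = i , ℕ.m≤n⇒m≤1+n s≤p , 1+p<s′
  ...   | no  1+p≮s′ = suc i , ℕ.≮⇒≥ 1+p≮s′ , ℕ.≤-<-trans p<s′ (ℕ.m<m+n (start (suc i)) (s≤s z≤n))

  -- The stretch of the digit that contains place `p` ends in a one, which must lie beyond the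
  -- zeros. Its index is at most its starting place, hence at most `p`.
  long-digit : ∀ p r → (∀ o → o ℕ.< r → bit (p ℕ.+ o) ≡ false) → ∃[ i ] r ℕ.< digit i × i ℕ.≤ p
  long-digit p r zeros with start-reaches p
  ... | i , s≤p , p<s′ = i , ℕ.+-cancelˡ-< s r (digit i) (ℕ.≤-<-trans (ℕ.+-monoˡ-≤ r s≤p)
          (ℕ.<-≤-trans (s≤s run≤e) (ℕ.≤-reflexive (sym (ℕ.+-suc s (gap s)))))) , ℕ.≤-trans (i≤start i) s≤p
    where
    s = start i
    e = s ℕ.+ gap s
    p≤e : p ℕ.≤ e
    p≤e = ℕ.≤-pred (ℕ.≤-trans p<s′ (ℕ.≤-reflexive (ℕ.+-suc s (gap s))))
    run≤e : p ℕ.+ r ℕ.≤ e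
    run≤e with ℕ.m≤n⇒∃[o]m+o≡n p≤e
    ... | o , p+o≡e with o ℕ.<? r
    ...   | no  o≮r = ℕ.≤-trans (ℕ.+-monoʳ-≤ p (ℕ.≮⇒≥ o≮r)) (ℕ.≤-reflexive p+o≡e)
    ...   | yes o<r with trans (sym (gap-one s)) (trans (cong bit (sym p+o≡e)) (zeros o o<r))
    ...     | ()

-- The growth of the largest digit

fromℕ-^ : ∀ k → fromℕ 2 ^ℚ k ≡ fromℕ (2 ℕ.^ k)
fromℕ-^ zero    = refl
fromℕ-^ (suc k) = trans (cong (fromℕ 2 ℚ.*_) (fromℕ-^ k)) (sym (fromℕ-* 2 (2 ℕ.^ k)))

log₂-below : ∀ {n} k → 2 ℕ.^ k ℕ.< n → Below (log₂ n) (fromℕ k)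
log₂-below {n} k 2^k<n = inj₂ (⟨⟩<-exponent k 1 (0≤fromℕ 2) (0≤fromℕ n)
  (subst₂ ℚ._<_ (sym (fromℕ-^ k)) (sym (ℚ.*-identityʳ (fromℕ n))) (fromℕ-mono-< {2 ℕ.^ k} {n} 2^k<n)))

log₂-above : ∀ {n} k → n ℕ.< 2 ℕ.^ k → Above (log₂ n) (fromℕ k)
log₂-above {n} k n<2^k = 0≤fromℕ k , <⟨⟩-exponent k 1 (0≤fromℕ n) (0≤fromℕ 2)
  (subst₂ ℚ._<_ (sym (ℚ.*-identityʳ (fromℕ n))) (sym (fromℕ-^ k)) (fromℕ-mono-< {n} {2 ℕ.^ k} n<2^k))

÷-atMost : ∀ {p y b u} → Below y b → 0ℚ ℚ.< b → p ℚ.≤ u ℚ.* b → AtMost (ι p ÷ y) u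
÷-atMost {p} {y} {b} {u} b<y 0<b p≤ub = atMost λ {c} u<c →
  let a , p<a , a<cb = ℚ.<-dense {p} {c ℚ.* b} (ℚ.≤-<-trans p≤ub (*-monoˡ-< {b} {u} {c} 0<b u<c))
  in a , b , p<a , b<y , 0<b , a<cb

÷-atLeast : ∀ {p y b u} → Above y b → 0ℚ ℚ.< b → u ℚ.* b ℚ.≤ p → AtLeast (ι p ÷ y) u
÷-atLeast {p} {y} {b} {u} y<b 0<b ub≤p = atLeast λ {c} c<u →
  let a , cb<a , a<p = ℚ.<-dense {c ℚ.* b} {p} (ℚ.<-≤-trans (*-monoˡ-< {b} {c} {u} 0<b c<u) ub≤p)
  in inj₂ (a , b , a<p , y<b , cb<a)

approximate : ∀ (z : ℝ) → cut 0ℝ < cut z → ∀ {θ} → 0ℚ ℚ.< θ →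
              ∃[ p ] ∃[ q ] 0ℚ ℚ.≤ p × AtLeast (cut z) p × Above (cut z) q × q ℚ.- p ℚ.≤ θ
approximate z (q₀ , 0<q₀ , q₀<z) {θ} 0<θ = build (∃½^-below 0<θ) (IsDedekind.above-inhabited (isDedekind z))
  where
  build : ∃[ j ] ½ ^ℚ j ℚ.< θ → ∃[ b ] Above (cut z) b → _
  build (j , ½^j<θ) (b , z<b) = find (archimedean b (½^-pos (suc j)))
    where
    h = ½ ^ℚ suc j
    two-steps : ∀ k → fromℕ (suc (suc k)) ℚ.* h ℚ.- fromℕ k ℚ.* h ℚ.≤ θ
    two-steps k = ℚ.≤-trans (ℚ.≤-reflexive (trans (cong (ℚ._- fromℕ k ℚ.* h) (trans (fromℕ-suc-* (suc k) h) (cong (ℚ._+ h) (fromℕ-suc-* k h))))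
      (trans (identity (fromℕ k ℚ.* h) h) (½^-double j)))) (ℚ.<⇒≤ ½^j<θ)
      where
      identity : ∀ a h → a ℚ.+ h ℚ.+ h ℚ.- a ≡ h ℚ.+ h
      identity = solve-∀ ℚ-ring
    find : ∃[ n ] b ℚ.< fromℕ n ℚ.* h → _
    find (n , b<nh) = finish (grid-search z (½^-pos (suc j)) n)
      where
      right-bound : ∀ k → k ℕ.≤ n → (k ℕ.< n → Above (cut z) (fromℕ (suc k) ℚ.* h)) → Above (cut z) (fromℕ (suc k) ℚ.* h)
      right-bound k k≤n right with k ℕ.<? n
      ... | yes k<n = right k<n
      ... | no  k≮n = IsDedekind.above-upper (isDedekind z) (ℚ.<-≤-trans b<nh
              (*-monoˡ-≤ {h} {fromℕ n} {fromℕ (suc k)} (ℚ.<⇒≤ (½^-pos (suc j))) (fromℕ-mono-≤ {n} {suc k} (ℕ.m≤n⇒m≤1+n (ℕ.≮⇒≥ k≮n))))) z<b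
      finish : ∃[ k ] k ℕ.≤ n × (∀ {i} → k ≡ suc i → Below (cut z) (fromℕ i ℚ.* h)) ×
                      (k ℕ.< n → Above (cut z) (fromℕ (suc k) ℚ.* h)) → _
      finish (zero , k≤n , left , right) = 0ℚ , fromℕ 1 ℚ.* h , ℚ.≤-refl , ℝ-atLeast z (IsDedekind.below-lower (isDedekind z) 0<q₀ q₀<z) , right-bound 0 k≤n right ,
        ≤-lin₂ (two-steps 0) (ℚ.<⇒≤ (½^-pos (suc j))) (trans (cong (λ m → (θ ℚ.- (m ℚ.* h ℚ.- 0ℚ ℚ.* h)) ℚ.+ (h ℚ.- 0ℚ) ℚ.+ (1ℚ ℚ.* h ℚ.- 0ℚ)) (fromℕ-suc 1)) (identity θ h))
        where
        identity : ∀ t h → (t ℚ.- ((1ℚ ℚ.+ 1ℚ) ℚ.* h ℚ.- 0ℚ ℚ.* h)) ℚ.+ (h ℚ.- 0ℚ) ℚ.+ (1ℚ ℚ.* h ℚ.- 0ℚ) ≡ t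
        identity = solve-∀ ℚ-ring
      finish (suc i , k≤n , left , right) = fromℕ i ℚ.* h , fromℕ (suc (suc i)) ℚ.* h , *-nonneg (0≤fromℕ i) (ℚ.<⇒≤ (½^-pos (suc j))) ,
        ℝ-atLeast z (left refl) , right-bound (suc i) k≤n right , two-steps i

-- n is only required to be within 1 of (k + 1) α: an exact floor cannot be
-- computed from a cut.
IsFloor : ℝ → ℕ → ℕ → ℕ → Set
IsFloor α a k n = n ℕ.≤ a ℕ.* suc k ×
  (∀ {q} → Above (cut α) q → fromℕ n ℚ.< q ℚ.* fromℕ (suc k) ℚ.+ 1ℚ) ×
  (∀ {q} → Below (cut α) q → q ℚ.* fromℕ (suc k) ℚ.< fromℕ n ℚ.+ 1ℚ)

scaled-floor : ∀ (α : ℝ) → cut 0ℝ < cut α → ∀ {a} → Above (cut α) (fromℕ a) → ∀ k → ∃[ n ] IsFloor α a k n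
scaled-floor α (q₀ , 0<q₀ , q₀<α) {a} α<a k = finish (grid-search α 0<h (a ℕ.* suc k))
  where
  h = + 1 ℚ./ suc k
  K = fromℕ (suc k)
  hK≡1 : h ℚ.* K ≡ 1ℚ
  hK≡1 = /-*-cancel 1 (suc k)
  jhK≡j : ∀ j → fromℕ j ℚ.* h ℚ.* K ≡ fromℕ j
  jhK≡j j = trans (ℚ.*-assoc (fromℕ j) h K) (trans (cong (fromℕ j ℚ.*_) hK≡1) (ℚ.*-identityʳ (fromℕ j)))
  0<K : 0ℚ ℚ.< K
  0<K = 0<fromℕ-suc k
  0<h : 0ℚ ℚ.< h
  0<h = /-<-/ 0 1 1 (suc k) (s≤s z≤n)
  finish : ∃[ n ] n ℕ.≤ a ℕ.* suc k × (∀ {j} → n ≡ suc j → Below (cut α) (fromℕ j ℚ.* h)) ×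
                  (n ℕ.< a ℕ.* suc k → Above (cut α) (fromℕ (suc n) ℚ.* h)) → _
  finish (n , n≤ , left , right) = n , n≤ , (λ {q} → n-1-precedes n left) , λ {q} → n+1-exceeds
    where
    n-1-precedes : ∀ n → (∀ {j} → n ≡ suc j → Below (cut α) (fromℕ j ℚ.* h)) → ∀ {q} → Above (cut α) q → fromℕ n ℚ.< q ℚ.* K ℚ.+ 1ℚ
    n-1-precedes zero left {q} α<q = ℚ.+-mono-< (*-pos (ℚ.<-trans 0<q₀ (Below⇒<Above α q₀<α α<q)) 0<K) 0<1
    n-1-precedes (suc j) left {q} α<q = subst₂ ℚ._<_ (trans (cong (ℚ._+ 1ℚ) (jhK≡j j)) (trans (ℚ.+-comm (fromℕ j) 1ℚ) (sym (fromℕ-suc j)))) refl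
      (ℚ.+-monoˡ-< 1ℚ (*-monoˡ-< {K} {fromℕ j ℚ.* h} {q} 0<K (Below⇒<Above α (left refl) α<q)))
    n+1-exceeds : ∀ {q} → Below (cut α) q → q ℚ.* K ℚ.< fromℕ n ℚ.+ 1ℚ
    n+1-exceeds {q} q<α with n ℕ.<? a ℕ.* suc k
    ... | yes n< = subst (q ℚ.* K ℚ.<_) (trans (jhK≡j (suc n)) (trans (fromℕ-suc n) (ℚ.+-comm 1ℚ (fromℕ n))))
            (*-monoˡ-< {K} {q} {fromℕ (suc n) ℚ.* h} 0<K (Below⇒<Above α q<α (right n<)))
    ... | no  n≮ = ℚ.<-trans (subst (q ℚ.* K ℚ.<_) (trans (sym (fromℕ-* a (suc k))) (cong fromℕ (ℕ.≤-antisym (ℕ.≮⇒≥ n≮) n≤)))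
            (*-monoˡ-< {K} {q} {fromℕ a} 0<K (Below⇒<Above α q<α α<a)))
            (subst (ℚ._< fromℕ n ℚ.+ 1ℚ) (ℚ.+-identityʳ (fromℕ n)) (ℚ.+-monoʳ-< (fromℕ n) 0<1))

-- With `k = B + (1 + B + o)` the power splits into `2 ^ B`, which exceeds `B`, and
-- `2 * 2 ^ (B + o)`, which is at least `k + 1`.
linear≤2^ : ∀ B → ∃[ k₀ ] (∀ k → k₀ ℕ.≤ k → B ℕ.* suc k ℕ.≤ 2 ℕ.^ k)
linear≤2^ B = B ℕ.+ suc B , bound
  where
  bound : ∀ k → B ℕ.+ suc B ℕ.≤ k → B ℕ.* suc k ℕ.≤ 2 ℕ.^ k
  bound k k₀≤k with ℕ.m≤n⇒∃[o]m+o≡n k₀≤k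
  ... | o , refl = ℕ.≤-trans (ℕ.*-mono-≤ (ℕ.<⇒≤ (n<2^n B)) (ℕ.≤-trans (ℕ-lin₁ 0 (ℕ.m≤m+n B o) (identity B o)) (ℕ.*-monoʳ-≤ 2 (n<2^n (B ℕ.+ o)))))
    (ℕ.≤-reflexive (trans (sym (ℕ.^-distribˡ-+-* 2 B (suc (B ℕ.+ o)))) (cong (2 ℕ.^_) (sym (ℕ.+-assoc B (suc B) o)))))
    where
    identity : ∀ b o → suc (b ℕ.+ suc b ℕ.+ o) ℕ.+ (b ℕ.+ o) ℕ.+ 0 ≡ 2 ℕ.* suc (b ℕ.+ o) ℕ.+ b
    identity = ℕSolver.solve-∀

block-large : ∀ K n → 2 ℕ.^ K ℕ.≤ suc n → K ℕ.≤ block n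
block-large K n 2^K≤1+n = ℕ.≮⇒≥ λ block<K → ℕ.<-irrefl refl (ℕ.<-≤-trans (subst (ℕ._< 2 ℕ.^ K) (sym (proj₁ (clock-spec n))) (2^-gap block<K (proj₂ (clock-spec n)))) 2^K≤1+n)

2^block≤ : ∀ n → 2 ℕ.^ block n ℕ.≤ suc n
2^block≤ n = subst (2 ℕ.^ block n ℕ.≤_) (sym (proj₁ (clock-spec n))) (ℕ.m≤m+n (2 ℕ.^ block n) (offset n))

<2^[1+block] : ∀ n → suc n ℕ.< 2 ℕ.^ suc (block n)
<2^[1+block] n = subst (ℕ._< 2 ℕ.^ suc (block n)) (sym (proj₁ (clock-spec n))) (2^-gap {block n} ℕ.≤-refl (proj₂ (clock-spec n)))

-- As `log₂ (n + 1)` lies between `block n` and `block n + 1`, it suffices to compare `L` with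
-- multiples of the block number up to bounded errors, collected in `C`. The lower estimate is asked
-- only from block `k₀` on, since early runs may be absent.
Lim-÷-log₂ : ∀ (α : ℝ) → cut 0ℝ < cut α → (L : ℕ → ℕ) → ∀ C k₀ →
             (∀ n {q} → Above (cut α) q → fromℕ (L (suc n)) ℚ.≤ q ℚ.* fromℕ (block n ℕ.+ C) ℚ.+ fromℕ C) →
             (∀ n → k₀ ℕ.≤ block n → ∀ {q} → Below (cut α) q → q ℚ.* fromℕ (suc (block n)) ℚ.≤ fromℕ (L (suc n)) ℚ.+ 1ℚ) →
             Lim (λ n → ι (fromℕ (L n)) ÷ log₂ n) (cut α)
Lim-÷-log₂ α α>0 L C k₀ L≤ ≤L ε 0<ε = build (approximate α α>0 0<θ)
  where
  θ = ½ ℚ.* (½ ℚ.* ε)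
  0<θ : 0ℚ ℚ.< θ
  0<θ = *-pos 0<½ (*-pos 0<½ 0<ε)
  build : ∃[ p ] ∃[ q ] 0ℚ ℚ.≤ p × AtLeast (cut α) p × Above (cut α) q × q ℚ.- p ℚ.≤ θ → _
  build (p , q , 0≤p , p≤α , α<q , q-p≤θ) = choose (archimedean (q ℚ.* (1ℚ ℚ.+ fromℕ C) ℚ.+ fromℕ C ℚ.+ fromℕ 2) 0<θ)
    where
    choose : ∃[ M ] q ℚ.* (1ℚ ℚ.+ fromℕ C) ℚ.+ fromℕ C ℚ.+ fromℕ 2 ℚ.< fromℕ M ℚ.* θ →
             ∃[ N ] (∀ n → N ℕ.≤ n → ∣ ι (fromℕ (L n)) ÷ log₂ n - cut α ∣ < ι ε)
    choose (M , M-large) = 2 ℕ.^ K , close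
      where
      K = suc (suc M ℕ.+ k₀)
      close : ∀ n → 2 ℕ.^ K ℕ.≤ n → ∣ ι (fromℕ (L n)) ÷ log₂ n - cut α ∣ < ι ε
      close zero 2^K≤0 = ⊥-elim (ℕ.<-irrefl refl (ℕ.<-≤-trans (ℕ.m^n>0 2 K) 2^K≤0))
      close (suc n) 2^K≤1+n = at-block (block n) refl (block-large K n 2^K≤1+n)
        where
        at-block : ∀ κ → block n ≡ κ → K ℕ.≤ κ → ∣ ι (fromℕ (L (suc n))) ÷ log₂ (suc n) - cut α ∣ < ι ε
        -- The lower bound used for `log₂ (n + 1)` is `κ = block n − 1`: the logarithm can equal
        -- `block n`, and membership in the cut is strict.
        at-block (suc κ) block≡ (s≤s M+k₀≤κ) = ∣∣<ι (−-atLeast quotient≥ (ℝ-atMost α α<q)) (−-atMost quotient≤ p≤α)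
            (<≤-lin₂ 0<ε′ q-p≤θ (id-lower p q ε)) (<≤-lin₂ 0<ε′ q-p≤θ (id-upper p q ε))
          where
          open ℚ.≤-Reasoning
          k = fromℕ κ
          1+M≤κ : suc M ℕ.≤ κ
          1+M≤κ = ℕ.≤-trans (ℕ.m≤m+n (suc M) k₀) M+k₀≤κ
          0<k : 0ℚ ℚ.< k
          0<k = fromℕ-mono-< {0} {κ} (ℕ.≤-trans (s≤s z≤n) 1+M≤κ)
          0<ε′ : 0ℚ ℚ.< ½ ℚ.* ε
          0<ε′ = *-pos 0<½ 0<ε
          id-lower : ∀ p q e → ((½ ℚ.* e ℚ.- 0ℚ) ℚ.+ (½ ℚ.* (½ ℚ.* e) ℚ.- (q ℚ.- p))) ℚ.+ ℚ.- e ≡ p ℚ.- ½ ℚ.* (½ ℚ.* e) ℚ.- q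
          id-lower = solve-∀ ℚ-ring
          id-upper : ∀ p q e → ((½ ℚ.* e ℚ.- 0ℚ) ℚ.+ (½ ℚ.* (½ ℚ.* e) ℚ.- (q ℚ.- p))) ℚ.+ (q ℚ.+ ½ ℚ.* (½ ℚ.* e) ℚ.- p) ≡ e
          id-upper = solve-∀ ℚ-ring
          Q = q ℚ.* (1ℚ ℚ.+ fromℕ C) ℚ.+ fromℕ C
          0≤Q : 0ℚ ℚ.≤ Q
          0≤Q = ℚ.+-mono-≤ (*-nonneg {q} {1ℚ ℚ.+ fromℕ C} 0≤q (ℚ.+-mono-≤ (ℚ.<⇒≤ 0<1) (0≤fromℕ C))) (0≤fromℕ C)
            where
            0≤q : 0ℚ ℚ.≤ q
            0≤q = let q₀ , 0<q₀ , q₀<α = α>0 in ℚ.<⇒≤ (ℚ.<-trans 0<q₀ (Below⇒<Above α q₀<α α<q))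
          Q+2≤kθ : Q ℚ.+ fromℕ 2 ℚ.≤ k ℚ.* θ
          Q+2≤kθ = ℚ.≤-trans (ℚ.<⇒≤ M-large) (*-monoˡ-≤ {θ} {fromℕ M} {k} (ℚ.<⇒≤ 0<θ) (fromℕ-mono-≤ {M} {κ} (ℕ.<⇒≤ 1+M≤κ)))
          Q≤kθ : Q ℚ.≤ k ℚ.* θ
          Q≤kθ = ≤-lin₂ Q+2≤kθ (0≤fromℕ 2) (identity Q (k ℚ.* θ))
            where
            identity : ∀ Q t → ((t ℚ.- (Q ℚ.+ fromℕ 2)) ℚ.+ (fromℕ 2 ℚ.- 0ℚ)) ℚ.+ Q ≡ t
            identity = solve-∀ ℚ-ring
          2≤kθ : fromℕ 2 ℚ.≤ k ℚ.* θ
          2≤kθ = ≤-lin₂ Q+2≤kθ 0≤Q (identity Q (k ℚ.* θ))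
            where
            identity : ∀ Q t → ((t ℚ.- (Q ℚ.+ fromℕ 2)) ℚ.+ (Q ℚ.- 0ℚ)) ℚ.+ fromℕ 2 ≡ t
            identity = solve-∀ ℚ-ring
          quotient≤ : AtMost (ι (fromℕ (L (suc n))) ÷ log₂ (suc n)) (q ℚ.+ θ)
          quotient≤ = ÷-atMost (log₂-below κ (ℕ.<-≤-trans (ℕ.^-monoʳ-< 2 (s≤s (s≤s z≤n)) (ℕ.n<1+n κ)) (subst (λ j → 2 ℕ.^ j ℕ.≤ suc n) block≡ (2^block≤ n)))) 0<k
            (begin
              fromℕ (L (suc n))                                   ≤⟨ L≤ n α<q ⟩
              q ℚ.* fromℕ (block n ℕ.+ C) ℚ.+ fromℕ C             ≡⟨ cong (λ j → q ℚ.* j ℚ.+ fromℕ C) (trans (cong (λ j → fromℕ (j ℕ.+ C)) block≡) (trans (fromℕ-suc (κ ℕ.+ C)) (cong (1ℚ ℚ.+_) (fromℕ-+ κ C)))) ⟩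
              q ℚ.* (1ℚ ℚ.+ (k ℚ.+ fromℕ C)) ℚ.+ fromℕ C          ≤⟨ ≤-lin₁ Q≤kθ (identity q k (fromℕ C) θ) ⟩
              (q ℚ.+ θ) ℚ.* k                                     ∎)
            where
            identity : ∀ q k c t → (k ℚ.* t ℚ.- (q ℚ.* (1ℚ ℚ.+ c) ℚ.+ c)) ℚ.+ (q ℚ.* (1ℚ ℚ.+ (k ℚ.+ c)) ℚ.+ c) ≡ (q ℚ.+ t) ℚ.* k
            identity = solve-∀ ℚ-ring
          K₂ = fromℕ (suc (suc κ))
          1≤½θK₂ : 1ℚ ℚ.≤ ½ ℚ.* θ ℚ.* K₂
          1≤½θK₂ = ≤-lin₂ (*-monoʳ-≤ {½} {fromℕ 2} {k ℚ.* θ} (ℚ.<⇒≤ 0<½) 2≤kθ) (ℚ.<⇒≤ 0<θ)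
            (trans (identity k θ) (cong (½ ℚ.* θ ℚ.*_) (sym (trans (fromℕ-suc (suc κ)) (cong (1ℚ ℚ.+_) (fromℕ-suc κ))))))
            where
            identity : ∀ k t → ((½ ℚ.* (k ℚ.* t) ℚ.- ½ ℚ.* fromℕ 2) ℚ.+ (t ℚ.- 0ℚ)) ℚ.+ 1ℚ ≡ ½ ℚ.* t ℚ.* (1ℚ ℚ.+ (1ℚ ℚ.+ k))
            identity = solve-∀ ℚ-ring
          -- The bound `p ≤ α` is not strict, whereas the estimate for `L` needs a rational properly
          -- below `α`; half of `θ` is spent on this and the other half absorbs the error 1.
          p-½θ<p : p ℚ.- ½ ℚ.* θ ℚ.< p
          p-½θ<p = <-lin₁ (*-pos 0<½ 0<θ) (identity p (½ ℚ.* θ))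
            where
            identity : ∀ p t → (t ℚ.- 0ℚ) ℚ.+ (p ℚ.- t) ≡ p
            identity = solve-∀ ℚ-ring
          quotient≥ : AtLeast (ι (fromℕ (L (suc n))) ÷ log₂ (suc n)) (p ℚ.- θ)
          quotient≥ = ÷-atLeast (log₂-above (suc (suc κ)) (subst (λ j → suc n ℕ.< 2 ℕ.^ suc j) block≡ (<2^[1+block] n))) (0<fromℕ-suc (suc κ))
            (≤-lin₂ (subst (λ j → (p ℚ.- ½ ℚ.* θ) ℚ.* fromℕ (suc j) ℚ.≤ fromℕ (L (suc n)) ℚ.+ 1ℚ) block≡
                (≤L n (subst (k₀ ℕ.≤_) (sym block≡) (ℕ.≤-trans (ℕ.m≤n+m k₀ (suc M)) (ℕ.m≤n⇒m≤1+n M+k₀≤κ))) (AtLeast.below p≤α p-½θ<p)))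
              1≤½θK₂ (identity p θ K₂ (fromℕ (L (suc n)))))
            where
            identity : ∀ p t K l → ((l ℚ.+ 1ℚ ℚ.- (p ℚ.- ½ ℚ.* t) ℚ.* K) ℚ.+ (½ ℚ.* t ℚ.* K ℚ.- 1ℚ)) ℚ.+ (p ℚ.- t) ℚ.* K ≡ l
            identity = solve-∀ ℚ-ring

natural-above : ∀ (z : ℝ) → ∃[ a ] Above (cut z) (fromℕ a)
natural-above z = raise (IsDedekind.above-inhabited (isDedekind z))
  where
  raise : ∃[ b ] Above (cut z) b → ∃[ a ] Above (cut z) (fromℕ a)
  raise (b , z<b) with ∃-fromℕ-above b
  ... | a , b<a = a , IsDedekind.above-upper (isDedekind z) {b} {fromℕ a} b<a z<b

affine-bound : ∀ {q} → 0ℚ ℚ.< q → ∀ {n e l k N C} → l ℕ.≤ n ℕ.+ e → fromℕ n ℚ.< q ℚ.* fromℕ k ℚ.+ 1ℚ →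
               k ℕ.≤ N → suc e ℕ.≤ C → fromℕ l ℚ.≤ q ℚ.* fromℕ N ℚ.+ fromℕ C
affine-bound {q} 0<q {n} {e} {l} {k} {N} {C} l≤n+e n<qk+1 k≤N e<C = begin
  fromℕ l                                      ≤⟨ fromℕ-mono-≤ {l} {n ℕ.+ e} l≤n+e ⟩
  fromℕ (n ℕ.+ e)                              ≡⟨ fromℕ-+ n e ⟩
  fromℕ n ℚ.+ fromℕ e                          ≤⟨ ℚ.+-monoˡ-≤ (fromℕ e) (ℚ.<⇒≤ n<qk+1) ⟩
  q ℚ.* fromℕ k ℚ.+ 1ℚ ℚ.+ fromℕ e             ≡⟨ ℚ.+-assoc (q ℚ.* fromℕ k) 1ℚ (fromℕ e) ⟩
  q ℚ.* fromℕ k ℚ.+ (1ℚ ℚ.+ fromℕ e)           ≡⟨ cong (q ℚ.* fromℕ k ℚ.+_) (fromℕ-suc e) ⟨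
  q ℚ.* fromℕ k ℚ.+ fromℕ (suc e)              ≤⟨ ℚ.+-mono-≤ (*-monoʳ-≤ {q} {fromℕ k} {fromℕ N} (ℚ.<⇒≤ 0<q) (fromℕ-mono-≤ {k} {N} k≤N)) (fromℕ-mono-≤ {suc e} {C} e<C) ⟩
  q ℚ.* fromℕ N ℚ.+ fromℕ C                    ∎
  where open ℚ.≤-Reasoning

raise-bound : ∀ {x n l} → n ℕ.≤ l → x ℚ.< fromℕ n ℚ.+ 1ℚ → x ℚ.≤ fromℕ l ℚ.+ 1ℚ
raise-bound {x} {n} {l} n≤l x<n+1 = ℚ.≤-trans (ℚ.<⇒≤ x<n+1) (ℚ.+-monoˡ-≤ 1ℚ (fromℕ-mono-≤ {n} {l} n≤l))

-- The constructed points belong to the set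

module RunLengths (α : ℝ) (α>0 : cut 0ℝ < cut α) (a : ℕ) (floor : ∀ k → ∃[ n ] IsFloor α a k n) (m₀ : ℕ) where

  c̃ : ℕ → ℕ
  c̃ k = proj₁ (floor k)

  fits? : ∀ k → Dec (4 ℕ.* suc m₀ ℕ.* (c̃ k ℕ.+ suc m₀) ℕ.≤ 2 ℕ.^ k)
  fits? k = 4 ℕ.* suc m₀ ℕ.* (c̃ k ℕ.+ suc m₀) ℕ.≤? 2 ℕ.^ k

  -- A run that is too long for its block is dropped. This happens for finitely many blocks only and
  -- does not affect the limit.
  c : ℕ → ℕ
  c k with fits? k
  ... | yes _ = c̃ k
  ... | no  _ = 0

  sparse : ∀ k → 0 ℕ.< c k → 4 ℕ.* suc m₀ ℕ.* (c k ℕ.+ suc m₀) ℕ.≤ 2 ℕ.^ k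
  sparse k 0<c with fits? k
  ... | yes fits = fits

  c≤c̃ : ∀ k → c k ℕ.≤ c̃ k
  c≤c̃ k with fits? k
  ... | yes _ = ℕ.≤-refl
  ... | no  _ = z≤n

  c-eventually : ∃[ k₀ ] (∀ k → k₀ ℕ.≤ k → c k ≡ c̃ k)
  c-eventually = let k₀ , bound = linear≤2^ B in k₀ , λ k k₀≤k → equal k (bound k k₀≤k)
    where
    B = 4 ℕ.* suc m₀ ℕ.* (a ℕ.+ suc m₀)
    equal : ∀ k → B ℕ.* suc k ℕ.≤ 2 ℕ.^ k → c k ≡ c̃ k
    equal k bound with fits? k
    ... | yes _   = refl
    ... | no ¬fits = ⊥-elim (¬fits (ℕ.≤-trans (ℕ.*-monoʳ-≤ (4 ℕ.* suc m₀)
            (ℕ.+-mono-≤ (proj₁ (proj₂ (floor k))) (ℕ.m≤m*n (suc m₀) (suc k))))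
            (ℕ.≤-trans (ℕ.≤-reflexive (identity (4 ℕ.* suc m₀) a (suc m₀) (suc k))) bound)))
      where
      identity : ∀ f a m k → f ℕ.* (a ℕ.* k ℕ.+ m ℕ.* k) ≡ f ℕ.* (a ℕ.+ m) ℕ.* k
      identity = ℕSolver.solve-∀

  open Constraint c m₀ sparse

  module _ (bit : ℕ → Bool) (respects : ∀ n {v} → constraint n ≡ just v → bit n ≡ v) where

    open Expansion bit (λ n → proj₁ (next-one n) , respects _ (proj₁ (proj₂ (next-one n))))

    -- The exponent is chosen so that `(3 m + 2) (n + 1) < 2 ^ (3 m + 2) * 2 ^ (block n + 1) = 2 ^
    -- (block n + C)`.
    C : ℕ
    C = 3 ℕ.* m ℕ.+ 3

    -- The `i`-th digit starts at a place of order `2 m n` by `count-one-large`, so the block that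
    -- bounds its length through `next-one` exceeds `block n` by less than the constant `C`.
    digit≤ : ∀ n i → i ℕ.< suc n → ∃[ k ] digit i ℕ.≤ c k ℕ.+ (2 ℕ.* m ℕ.+ 1) × suc k ℕ.≤ block n ℕ.+ C
    digit≤ n i (s≤s i≤n) = k , ℕ.≤-trans (s≤s (ℕ.≤-trans (gap≤next p) (proj₂ (proj₂ (next-one p))))) (ℕ.≤-reflexive (identity (c k) (2 ℕ.* m))) , k<
      where
      p = start i
      k = block (p ℕ.+ countdown p)
      identity : ∀ a b → suc (a ℕ.+ b) ≡ a ℕ.+ (b ℕ.+ 1)
      identity = ℕSolver.solve-∀
      p≤ : p ℕ.≤ 2 ℕ.* m ℕ.* n ℕ.+ 1
      p≤ = ℕ.≤-trans (count-one-large bit respects p) (ℕ.+-monoˡ-≤ 1 (ℕ.*-monoʳ-≤ (2 ℕ.* m) (ℕ.≤-trans (ℕ.≤-reflexive (count-start i)) i≤n)))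
      position≤ : suc (p ℕ.+ countdown p) ℕ.≤ (3 ℕ.* m ℕ.+ 2) ℕ.* suc n
      position≤ = ℕ-lin₂ (m ℕ.* n ℕ.+ 2 ℕ.* n ℕ.+ 2 ℕ.* m ℕ.+ 1) p≤ (countdown≤ p) (identity′ p (countdown p) m₀ n)
        where
        identity′ : ∀ p d k n → suc (p ℕ.+ d) ℕ.+ ((2 ℕ.* suc k ℕ.* n ℕ.+ 1) ℕ.+ k) ℕ.+ (suc k ℕ.* n ℕ.+ 2 ℕ.* n ℕ.+ 2 ℕ.* suc k ℕ.+ 1) ≡
                    (3 ℕ.* suc k ℕ.+ 2) ℕ.* suc n ℕ.+ (p ℕ.+ d)
        identity′ = ℕSolver.solve-∀
      k< : suc k ℕ.≤ block n ℕ.+ C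
      k< = ℕ.≮⇒≥ λ block+C<1+k → ℕ.<-irrefl refl (begin-strict
        2 ℕ.^ k                                          ≤⟨ 2^block≤ (p ℕ.+ countdown p) ⟩
        suc (p ℕ.+ countdown p)                          ≤⟨ position≤ ⟩
        (3 ℕ.* m ℕ.+ 2) ℕ.* suc n                        ≤⟨ ℕ.*-monoˡ-≤ (suc n) (ℕ.<⇒≤ (n<2^n (3 ℕ.* m ℕ.+ 2))) ⟩
        2 ℕ.^ (3 ℕ.* m ℕ.+ 2) ℕ.* suc n                  <⟨ ℕ.*-monoʳ-< (2 ℕ.^ (3 ℕ.* m ℕ.+ 2)) {{ℕ.m^n≢0 2 (3 ℕ.* m ℕ.+ 2)}} (<2^[1+block] n) ⟩
        2 ℕ.^ (3 ℕ.* m ℕ.+ 2) ℕ.* 2 ℕ.^ suc (block n)    ≡⟨ ℕ.^-distribˡ-+-* 2 (3 ℕ.* m ℕ.+ 2) (suc (block n)) ⟨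
        2 ℕ.^ (3 ℕ.* m ℕ.+ 2 ℕ.+ suc (block n))          ≡⟨ cong (2 ℕ.^_) (regroup (3 ℕ.* m) (block n)) ⟩
        2 ℕ.^ (block n ℕ.+ C)                            ≤⟨ ℕ.^-monoʳ-≤ 2 (ℕ.<⇒≤pred block+C<1+k) ⟩
        2 ℕ.^ k                                          ∎)
        where
        open ℕ.≤-Reasoning
        regroup : ∀ a b → a ℕ.+ 2 ℕ.+ suc b ≡ b ℕ.+ (a ℕ.+ 3)
        regroup = ℕSolver.solve-∀

    maxDigit≤ : ∀ n {q} → Above (cut α) q → fromℕ (maxDigit digit (suc n)) ℚ.≤ q ℚ.* fromℕ (block n ℕ.+ C) ℚ.+ fromℕ C
    maxDigit≤ n {q} α<q = affine-bound 0<q {c̃ k} {2 ℕ.* m ℕ.+ 1} {maxDigit digit (suc n)} {suc k} {block n ℕ.+ C} {C}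
        maxDigit≤c̃ (proj₁ (proj₂ (proj₂ (floor k))) α<q) 1+k≤ constants
      where
      i = proj₁ (maxDigit-attained digit n)
      d≤ = digit≤ n i (proj₁ (proj₂ (maxDigit-attained digit n)))
      k = proj₁ d≤
      1+k≤ = proj₂ (proj₂ d≤)
      maxDigit≤c̃ : maxDigit digit (suc n) ℕ.≤ c̃ k ℕ.+ (2 ℕ.* m ℕ.+ 1)
      maxDigit≤c̃ = ℕ.≤-trans (ℕ.≤-reflexive (proj₂ (proj₂ (maxDigit-attained digit n))))
        (ℕ.≤-trans (proj₁ (proj₂ d≤)) (ℕ.+-monoˡ-≤ (2 ℕ.* m ℕ.+ 1) (c≤c̃ k)))
      0<q : 0ℚ ℚ.< q
      0<q = let q₀ , 0<q₀ , q₀<α = α>0 in ℚ.<-trans 0<q₀ (Below⇒<Above α q₀<α α<q)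
      constants : suc (2 ℕ.* m ℕ.+ 1) ℕ.≤ C
      constants = ℕ.≤-trans (ℕ.≤-reflexive (identity (2 ℕ.* m))) (ℕ.+-mono-≤ (ℕ.*-monoˡ-≤ m (s≤s (s≤s (z≤n {1})))) (s≤s (s≤s (z≤n {1}))))
        where
        identity : ∀ a → suc (a ℕ.+ 1) ≡ a ℕ.+ 2
        identity = ℕSolver.solve-∀

    c<digit : ∀ k → ∃[ i ] c k ℕ.< digit i × i ℕ.< 2 ℕ.^ k
    c<digit k = from-pred (2 ℕ.^ k) refl (ℕ.m^n>0 2 k)
      where
      from-pred : ∀ N → 2 ℕ.^ k ≡ N → 0 ℕ.< N → ∃[ i ] c k ℕ.< digit i × i ℕ.< N
      -- Bits are counted from 0 but blocks from `n + 1`, so the run of block `k` starts at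
      -- `p = 2 ^ k − 1`.
      from-pred (suc p) 2^k≡ _ =
        let i , c<d , i≤p = long-digit p (c k) λ o o<c → respects (p ℕ.+ o) (forced-zero (p ℕ.+ o) k o (cong (ℕ._+ o) (sym 2^k≡)) o<c)
        in i , c<d , s≤s i≤p

    ≤maxDigit : ∀ n → proj₁ c-eventually ℕ.≤ block n → ∀ {q} → Below (cut α) q →
                q ℚ.* fromℕ (suc (block n)) ℚ.≤ fromℕ (maxDigit digit (suc n)) ℚ.+ 1ℚ
    ≤maxDigit n k₀≤ {q} q<α = raise-bound {q ℚ.* fromℕ (suc k)} {c̃ k} {maxDigit digit (suc n)} c̃≤ (proj₂ (proj₂ (proj₂ (floor k))) q<α)
      where
      k = block n
      i = proj₁ (c<digit k)
      c̃≤ : c̃ k ℕ.≤ maxDigit digit (suc n)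
      c̃≤ = ℕ.≤-trans (ℕ.≤-reflexive (sym (proj₂ c-eventually k k₀≤))) (ℕ.≤-trans (ℕ.<⇒≤ (proj₁ (proj₂ (c<digit k))))
        (maxDigit-≥ digit {suc n} {i} (ℕ.<-≤-trans (proj₂ (proj₂ (c<digit k))) (2^block≤ n))))

    x∈MaxDigitSet : x ∈ MaxDigitSet α
    x∈MaxDigitSet = lift (0<x , x≤1 , digit , isExpansion ,
      Lim-÷-log₂ α α>0 (maxDigit digit) C (proj₁ c-eventually) maxDigit≤ ≤maxDigit)

-- Avoiding a weighted sequence of dyadic cylinders

∑-nonneg : ∀ {f} → (∀ i → 0ℚ ℚ.≤ f i) → ∀ n → 0ℚ ℚ.≤ ∑ f n
∑-nonneg 0≤f zero    = ℚ.≤-refl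
∑-nonneg 0≤f (suc n) = ℚ.+-mono-≤ (∑-nonneg 0≤f n) (0≤f n)

∑-mono : ∀ {f g} → (∀ i → f i ℚ.≤ g i) → ∀ n → ∑ f n ℚ.≤ ∑ g n
∑-mono f≤g zero    = ℚ.≤-refl
∑-mono f≤g (suc n) = ℚ.+-mono-≤ (∑-mono f≤g n) (f≤g n)

∑-+ : ∀ f g n → ∑ (λ i → f i ℚ.+ g i) n ≡ ∑ f n ℚ.+ ∑ g n
∑-+ f g zero    = refl
∑-+ f g (suc n) = trans (cong (ℚ._+ (f n ℚ.+ g n)) (∑-+ f g n)) (identity (∑ f n) (∑ g n) (f n) (g n))
  where
  identity : ∀ a b c d → a ℚ.+ b ℚ.+ (c ℚ.+ d) ≡ a ℚ.+ c ℚ.+ (b ℚ.+ d)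
  identity = solve-∀ ℚ-ring

∑-* : ∀ K f n → ∑ (λ i → K ℚ.* f i) n ≡ K ℚ.* ∑ f n
∑-* K f zero    = sym (ℚ.*-zeroʳ K)
∑-* K f (suc n) = trans (cong (ℚ._+ K ℚ.* f n) (∑-* K f n)) (sym (ℚ.*-distribˡ-+ K (∑ f n) (f n)))

∑-split : ∀ f m n → ∑ f (m ℕ.+ n) ≡ ∑ f m ℚ.+ ∑ (λ i → f (m ℕ.+ i)) n
∑-split f m zero    = trans (cong (∑ f) (ℕ.+-identityʳ m)) (sym (ℚ.+-identityʳ (∑ f m)))
∑-split f m (suc n) = trans (cong (∑ f) (ℕ.+-suc m n)) (trans (cong (ℚ._+ f (m ℕ.+ n)) (∑-split f m n)) (ℚ.+-assoc (∑ f m) _ (f (m ℕ.+ n))))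

∑-extend : ∀ {f} → (∀ i → 0ℚ ℚ.≤ f i) → ∀ m n → ∑ f m ℚ.≤ ∑ f (n ℕ.+ m)
∑-extend 0≤f m zero    = ℚ.≤-refl
∑-extend {f} 0≤f m (suc n) = ℚ.≤-trans (∑-extend 0≤f m n)
  (subst (ℚ._≤ ∑ f (n ℕ.+ m) ℚ.+ f (n ℕ.+ m)) (ℚ.+-identityʳ (∑ f (n ℕ.+ m))) (ℚ.+-monoʳ-≤ (∑ f (n ℕ.+ m)) (0≤f (n ℕ.+ m))))

term≤∑ : ∀ {f} → (∀ i → 0ℚ ℚ.≤ f i) → ∀ {i n} → i ℕ.< n → f i ℚ.≤ ∑ f n
term≤∑ {f} 0≤f {i} {suc n} i<1+n with ℕ.m<1+n⇒m<n∨m≡n i<1+n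
... | inj₁ i<n  = subst (ℚ._≤ ∑ f n ℚ.+ f n) (ℚ.+-identityʳ (f i)) (ℚ.+-mono-≤ (term≤∑ 0≤f i<n) (0≤f n))
... | inj₂ refl = subst (ℚ._≤ ∑ f n ℚ.+ f n) (ℚ.+-identityˡ (f n)) (ℚ.+-monoˡ-≤ (f n) (∑-nonneg 0≤f n))

HasTails : (ℕ → ℚ) → Set
HasTails W = ∀ {ε} → 0ℚ ℚ.< ε → ∃[ M ] (∀ L → ∑ (λ i → W (M ℕ.+ i)) L ℚ.≤ ε)

-- A supermartingale argument: charge i n N bounds the conditional probability
-- of hitting the i-th obstacle from the cylinder with the n-bit prefix N.  The
-- total charge is an infinite sum, so it is kept below 1 up to errors
-- ½^(n+2), which the tail bound allows to decide from finitely many terms.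
module Greedy
  (constraint : ℕ → Maybe Bool) (charge : ℕ → ℕ → ℕ → ℚ) (W K : ℕ → ℚ)
  (0≤charge : ∀ i n N → 0ℚ ℚ.≤ charge i n N)
  (charge-free : ∀ i n N → constraint n ≡ nothing →
                 charge i (suc n) (2 ℕ.* N ℕ.+ 0) ℚ.+ charge i (suc n) (2 ℕ.* N ℕ.+ 1) ℚ.≤ charge i n N ℚ.+ charge i n N)
  (charge-forced : ∀ i n N {b} → constraint n ≡ just b → charge i (suc n) (2 ℕ.* N ℕ.+ bitValue b) ℚ.≤ charge i n N)
  (0≤K : ∀ n → 0ℚ ℚ.≤ K n)
  (charge≤ : ∀ i n N → charge i n N ℚ.≤ K n ℚ.* W i)
  (charge-initial : ∀ L → ∑ (λ i → charge i 0 0) L ℚ.≤ ½)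
  (tails : HasTails W) where

  threshold : ℕ → ℚ
  threshold n = 1ℚ ℚ.- ½ ^ℚ suc n

  Safe : ℕ → ℕ → Set
  Safe n N = ∀ L → ∑ (λ i → charge i n N) L ℚ.≤ threshold n

  Step : ℕ → ℕ → Maybe Bool → Set
  Step n N v = ∃[ b ] (∀ {b′} → v ≡ just b′ → b ≡ b′) × Safe (suc n) (2 ℕ.* N ℕ.+ bitValue b)

  threshold-suc : ∀ n → threshold n ℚ.+ ½ ^ℚ suc (suc n) ≡ threshold (suc n)
  threshold-suc n = trans (cong (λ h → 1ℚ ℚ.- h ℚ.+ ½ ^ℚ suc (suc n)) (sym (½^-double (suc n)))) (identity (½ ^ℚ suc (suc n)))
    where
    identity : ∀ h → 1ℚ ℚ.- (h ℚ.+ h) ℚ.+ h ≡ 1ℚ ℚ.- h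
    identity = solve-∀ ℚ-ring

  step-forced : ∀ n N b → constraint n ≡ just b → Safe n N → Step n N (just b)
  step-forced n N b eq safe = b , (λ { refl → refl }) , λ L → begin
    ∑ (λ i → charge i (suc n) (2 ℕ.* N ℕ.+ bitValue b)) L    ≤⟨ ∑-mono (λ i → charge-forced i n N eq) L ⟩
    ∑ (λ i → charge i n N) L                                 ≤⟨ safe L ⟩
    threshold n                                              ≡⟨ ℚ.+-identityʳ (threshold n) ⟨
    threshold n ℚ.+ 0ℚ                                       ≤⟨ ℚ.+-monoʳ-≤ (threshold n) (ℚ.<⇒≤ (½^-pos (suc (suc n)))) ⟩
    threshold n ℚ.+ ½ ^ℚ suc (suc n)                         ≡⟨ threshold-suc n ⟩
    threshold (suc n)                                        ∎
    where open ℚ.≤-Reasoning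

  step-free : ∀ n N → constraint n ≡ nothing → Safe n N → Step n N nothing
  -- `M` is so large that, for either value of the bit, the charges from index `M` on add up to at
  -- most the allowed error `½ ^ (n + 2)`. The choice then depends on a finite sum of rationals.
  step-free n N eq safe = let j , small = ∃½^-below-scaled (K (suc n)) (½^-pos (suc (suc n)))
                              M , tail = tails (½^-pos j)
                          in select M (λ L → ℚ.≤-trans (*-monoʳ-≤ {K (suc n)} (0≤K (suc n)) (tail L)) (ℚ.<⇒≤ small))
    where
    module _ (M : ℕ) (tail : ∀ L → K (suc n) ℚ.* ∑ (λ i → W (M ℕ.+ i)) L ℚ.≤ ½ ^ℚ suc (suc n)) where
      S : ℕ → ℚ
      S v = ∑ (λ i → charge i (suc n) (2 ℕ.* N ℕ.+ v)) M

      extend : ∀ v → S v ℚ.≤ threshold n → Safe (suc n) (2 ℕ.* N ℕ.+ v)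
      extend v S≤ L = begin
        ∑ f L                                                        ≤⟨ ∑-extend (λ i → 0≤charge i (suc n) (2 ℕ.* N ℕ.+ v)) L M ⟩
        ∑ f (M ℕ.+ L)                                                ≡⟨ ∑-split f M L ⟩
        S v ℚ.+ ∑ (λ i → f (M ℕ.+ i)) L                              ≤⟨ ℚ.+-mono-≤ S≤ (∑-mono (λ i → charge≤ (M ℕ.+ i) (suc n) (2 ℕ.* N ℕ.+ v)) L) ⟩
        threshold n ℚ.+ ∑ (λ i → K (suc n) ℚ.* W (M ℕ.+ i)) L        ≡⟨ cong (threshold n ℚ.+_) (∑-* (K (suc n)) (λ i → W (M ℕ.+ i)) L) ⟩
        threshold n ℚ.+ K (suc n) ℚ.* ∑ (λ i → W (M ℕ.+ i)) L        ≤⟨ ℚ.+-monoʳ-≤ (threshold n) (tail L) ⟩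
        threshold n ℚ.+ ½ ^ℚ suc (suc n)                             ≡⟨ threshold-suc n ⟩
        threshold (suc n)                                            ∎
        where
        open ℚ.≤-Reasoning
        f = λ i → charge i (suc n) (2 ℕ.* N ℕ.+ v)

      S+S≤ : S 0 ℚ.+ S 1 ℚ.≤ threshold n ℚ.+ threshold n
      S+S≤ = begin
        S 0 ℚ.+ S 1                                                  ≡⟨ ∑-+ (λ i → charge i (suc n) (2 ℕ.* N ℕ.+ 0)) (λ i → charge i (suc n) (2 ℕ.* N ℕ.+ 1)) M ⟨
        ∑ (λ i → charge i (suc n) (2 ℕ.* N ℕ.+ 0) ℚ.+ charge i (suc n) (2 ℕ.* N ℕ.+ 1)) M
                                                                     ≤⟨ ∑-mono (λ i → charge-free i n N eq) M ⟩
        ∑ (λ i → charge i n N ℚ.+ charge i n N) M                    ≡⟨ ∑-+ (λ i → charge i n N) (λ i → charge i n N) M ⟩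
        ∑ (λ i → charge i n N) M ℚ.+ ∑ (λ i → charge i n N) M        ≤⟨ ℚ.+-mono-≤ (safe M) (safe M) ⟩
        threshold n ℚ.+ threshold n                                  ∎
        where open ℚ.≤-Reasoning

      -- Averaging: the two finite sums total at most twice the threshold, so they cannot both
      -- exceed it.
      second : ¬ (S 0 ℚ.≤ threshold n) → S 1 ℚ.≤ threshold n
      second S₀≰ = ℚ.<⇒≤ (<≤-lin₂ (ℚ.≰⇒> S₀≰) S+S≤ (identity (S 0) (S 1) (threshold n)))
        where
        identity : ∀ a b t → ((a ℚ.- t) ℚ.+ (t ℚ.+ t ℚ.- (a ℚ.+ b))) ℚ.+ b ≡ t
        identity = solve-∀ ℚ-ring

      decide : Dec (S 0 ℚ.≤ threshold n) → Step n N nothing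
      decide (yes S₀≤) = false , (λ ()) , extend 0 S₀≤
      decide (no  S₀≰) = true  , (λ ()) , extend 1 (second S₀≰)

      select : Step n N nothing
      select = decide (S 0 ℚ.≤? threshold n)

  step-for : ∀ n N v → constraint n ≡ v → Safe n N → Step n N v
  step-for n N nothing  eq = step-free n N eq
  step-for n N (just b) eq = step-forced n N b eq

  step : ∀ n N → Safe n N → Step n N (constraint n)
  step n N = step-for n N (constraint n) refl

  path : ∀ n → ∃[ N ] Safe n N
  path zero    = 0 , charge-initial
  path (suc n) = let N , safe = path n
                     b , _ , safe′ = step n N safe
                 in 2 ℕ.* N ℕ.+ bitValue b , safe′

  bit : ℕ → Bool
  bit n = proj₁ (step n (proj₁ (path n)) (proj₂ (path n)))

  bit-respects : ∀ n {b} → constraint n ≡ just b → bit n ≡ b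
  bit-respects n = proj₁ (proj₂ (step n (proj₁ (path n)) (proj₂ (path n))))

  prefix≡path : ∀ n → prefix bit n ≡ proj₁ (path n)
  prefix≡path zero    = refl
  prefix≡path (suc n) = cong (λ N → 2 ℕ.* N ℕ.+ bitValue (bit n)) (prefix≡path n)

  charge<1 : ∀ i n → charge i n (prefix bit n) ℚ.< 1ℚ
  charge<1 i n = begin-strict
    charge i n (prefix bit n)                       ≡⟨ cong (charge i n) (prefix≡path n) ⟩
    charge i n (proj₁ (path n))                     ≤⟨ term≤∑ (λ i → 0≤charge i n (proj₁ (path n))) {i} {suc i} ℕ.≤-refl ⟩
    ∑ (λ i → charge i n (proj₁ (path n))) (suc i)   ≤⟨ proj₂ (path n) (suc i) ⟩
    1ℚ ℚ.- ½ ^ℚ suc n                               <⟨ ℚ.+-monoʳ-< 1ℚ (ℚ.neg-antimono-< (½^-pos (suc n))) ⟩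
    1ℚ ℚ.- 0ℚ                                       ∎
    where open ℚ.≤-Reasoning

-- Conditional probabilities of hitting a dyadic cylinder

when-mono : ∀ {P Q : Set} {p q} (d : Dec P) (e : Dec Q) → (P → Q) → 0ℚ ℚ.≤ q → p ℚ.≤ q → when d p ℚ.≤ when e q
when-mono (yes P) (yes Q) _   _   p≤q = p≤q
when-mono (yes P) (no ¬Q) P→Q _   _   = ⊥-elim (¬Q (P→Q P))
when-mono (no _)  (yes _) _   0≤q _   = 0≤q
when-mono (no _)  (no _)  _   _   _   = ℚ.≤-refl

when-exclusive : ∀ {P P′ Q : Set} {h} (d : Dec P) (d′ : Dec P′) (e : Dec Q) → ¬ (P × P′) → (P → Q) → (P′ → Q) → 0ℚ ℚ.≤ h →
                 when d (h ℚ.+ h) ℚ.+ when d′ (h ℚ.+ h) ℚ.≤ when e h ℚ.+ when e h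
when-exclusive         (yes P) (yes P′) _       ¬both _ _ _ = ⊥-elim (¬both (P , P′))
when-exclusive         (yes P) (no _)   (no ¬Q) _ P→Q _ _   = ⊥-elim (¬Q (P→Q P))
when-exclusive         (no _)  (yes P′) (no ¬Q) _ _ P′→Q _  = ⊥-elim (¬Q (P′→Q P′))
when-exclusive {h = h} (yes _) (no _)   (yes _) _ _ _ _     = ℚ.≤-reflexive (ℚ.+-identityʳ (h ℚ.+ h))
when-exclusive {h = h} (no _)  (yes _)  (yes _) _ _ _ _     = ℚ.≤-reflexive (ℚ.+-identityˡ (h ℚ.+ h))
when-exclusive         (no _)  (no _)   (yes _) _ _ _ 0≤h   = ℚ.+-mono-≤ 0≤h 0≤h
when-exclusive         (no _)  (no _)   (no _)  _ _ _ _     = ℚ.≤-refl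

when≤ : ∀ {P : Set} (d : Dec P) {p} → 0ℚ ℚ.≤ p → when d p ℚ.≤ p
when≤ (yes _) _   = ℚ.≤-refl
when≤ (no _)  0≤p = 0≤p

0≤when : ∀ {P : Set} (d : Dec P) {p} → 0ℚ ℚ.≤ p → 0ℚ ℚ.≤ when d p
0≤when (yes _) 0≤p = 0≤p
0≤when (no _)  _   = ℚ.≤-refl

when-true : ∀ {P : Set} (d : Dec P) {p} → P → when d p ≡ p
when-true (yes _) _ = refl
when-true (no ¬P) P = ⊥-elim (¬P P)

-- The dyadic intervals [t, t + 1) / 2ʲ and [N, N + 1) / 2ⁿ overlap.
Overlap : (j t n N : ℕ) → Set
Overlap j t n N = N ℕ.* 2 ℕ.^ j ℕ.< suc t ℕ.* 2 ℕ.^ n × t ℕ.* 2 ℕ.^ n ℕ.< suc N ℕ.* 2 ℕ.^ j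

overlap? : ∀ j t n N → Dec (Overlap j t n N)
overlap? j t n N = (N ℕ.* 2 ℕ.^ j ℕ.<? suc t ℕ.* 2 ℕ.^ n) ×-dec (t ℕ.* 2 ℕ.^ n ℕ.<? suc N ℕ.* 2 ℕ.^ j)

overlap-parent : ∀ {j t n N v} → v ℕ.≤ 1 → Overlap j t (suc n) (2 ℕ.* N ℕ.+ v) → Overlap j t n N
overlap-parent {j} {t} {n} {N} {v} v≤1 (N<t , t<N) =
  ℕ.*-cancelˡ-< 2 _ _ (ℕ.≤-<-trans
    (ℕ.≤-trans (ℕ.≤-reflexive (sym (ℕ.*-assoc 2 N (2 ℕ.^ j)))) (ℕ.*-monoˡ-≤ (2 ℕ.^ j) (ℕ.m≤m+n (2 ℕ.* N) v)))
    (ℕ.<-≤-trans N<t (ℕ.≤-reflexive (swap (suc t) (2 ℕ.^ n))))) ,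
  ℕ.*-cancelˡ-< 2 _ _ (ℕ.≤-<-trans (ℕ.≤-reflexive (sym (swap t (2 ℕ.^ n))))
    (ℕ.<-≤-trans t<N (ℕ.≤-trans (ℕ.*-monoˡ-≤ (2 ℕ.^ j) (s≤s (ℕ.+-monoʳ-≤ (2 ℕ.* N) v≤1))) (ℕ.≤-reflexive (double N (2 ℕ.^ j))))))
  where
  swap : ∀ t p → t ℕ.* (2 ℕ.* p) ≡ 2 ℕ.* (t ℕ.* p)
  swap = ℕSolver.solve-∀
  double : ∀ N p → suc (2 ℕ.* N ℕ.+ 1) ℕ.* p ≡ 2 ℕ.* (suc N ℕ.* p)
  double = ℕSolver.solve-∀

-- Measured in units of `½ ^ j`, the point separating the two children is the integer
-- `(2 N + 1) * 2 ^ i`. Overlapping both would put it strictly between `t` and `t + 1`.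
overlap-one-child : ∀ {j t n N} → n ℕ.< j → ¬ (Overlap j t (suc n) (2 ℕ.* N ℕ.+ 0) × Overlap j t (suc n) (2 ℕ.* N ℕ.+ 1))
overlap-one-child {j} {t} {n} {N} n<j ((_ , t<) , (<t , _)) with ℕ.m≤n⇒∃[o]m+o≡n n<j
... | i , refl = ℕ.<-irrefl refl (ℕ.<-≤-trans (ℕ.*-cancelʳ-< (2 ℕ.^ suc n) t (a ℕ.* 2 ℕ.^ i) t<′)
                   (ℕ.≤-pred (ℕ.*-cancelʳ-< (2 ℕ.^ suc n) (a ℕ.* 2 ℕ.^ i) (suc t) <t′)))
  where
  a = 2 ℕ.* N ℕ.+ 1
  refine : ∀ a → a ℕ.* 2 ℕ.^ (suc n ℕ.+ i) ≡ a ℕ.* 2 ℕ.^ i ℕ.* 2 ℕ.^ suc n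
  refine a = trans (cong (a ℕ.*_) (trans (ℕ.^-distribˡ-+-* 2 (suc n) i) (ℕ.*-comm (2 ℕ.^ suc n) (2 ℕ.^ i)))) (sym (ℕ.*-assoc a (2 ℕ.^ i) (2 ℕ.^ suc n)))
  t<′ : t ℕ.* 2 ℕ.^ suc n ℕ.< a ℕ.* 2 ℕ.^ i ℕ.* 2 ℕ.^ suc n
  t<′ = ℕ.<-≤-trans t< (ℕ.≤-reflexive (trans (cong (ℕ._* 2 ℕ.^ (suc n ℕ.+ i)) (trans (sym (ℕ.+-suc (2 ℕ.* N) 0)) refl)) (refine a)))
  <t′ : a ℕ.* 2 ℕ.^ i ℕ.* 2 ℕ.^ suc n ℕ.< suc t ℕ.* 2 ℕ.^ suc n
  <t′ = ℕ.≤-<-trans (ℕ.≤-reflexive (sym (refine a))) <t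

freeCount-mono : ∀ constraint {m n} → m ℕ.≤ n → freeCount constraint m ℕ.≤ freeCount constraint n
freeCount-mono constraint {m} m≤n with ℕ.m≤n⇒∃[o]m+o≡n m≤n
... | o , refl = go o
  where
  go : ∀ o → freeCount constraint m ℕ.≤ freeCount constraint (m ℕ.+ o)
  go zero    = ℕ.≤-reflexive (cong (freeCount constraint) (sym (ℕ.+-identityʳ m)))
  go (suc o) = ℕ.≤-trans (go o) (ℕ.≤-trans (ℕ.m≤m+n _ (isFree (constraint (m ℕ.+ o)))) (ℕ.≤-reflexive (cong (freeCount constraint) (sym (ℕ.+-suc m o)))))

module Avoidance (constraint : ℕ → Maybe Bool) (level : ℕ → ℕ) (target : ℕ → ℕ → ℕ)
  (small : ∀ L → ∑ (λ i → fromℕ 4 ℚ.* ½ ^ℚ freeCount constraint (level i)) L ℚ.≤ ½)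
  (tails : HasTails (λ i → fromℕ 4 ℚ.* ½ ^ℚ freeCount constraint (level i))) where

  F : ℕ → ℕ
  F = freeCount constraint

  -- With `F j − F n` free bits still to come before level `j`, at most one of their
  -- `2 ^ (F j − F n)` values leads into the target. It is only an upper bound, as forced bits may
  -- miss the target. Truncated subtraction makes the charge 1 once no free bit is left and the
  -- intervals still overlap.
  cylinderCharge : (j t n N : ℕ) → ℚ
  cylinderCharge j t n N = when (overlap? j t n N) (½ ^ℚ (F j ℕ.∸ F n))

  0≤cylinderCharge : ∀ j t n N → 0ℚ ℚ.≤ cylinderCharge j t n N
  0≤cylinderCharge j t n N = 0≤when (overlap? j t n N) (ℚ.<⇒≤ (½^-pos (F j ℕ.∸ F n)))

  -- If free bits remain, then `n < j`, at most one child meets the target, and its charge is twice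
  -- that of the parent. If none remain, the exponent stays 0 and each child is charged at most as
  -- much as the parent.
  cylinderCharge-free : ∀ j t n N → constraint n ≡ nothing →
    cylinderCharge j t (suc n) (2 ℕ.* N ℕ.+ 0) ℚ.+ cylinderCharge j t (suc n) (2 ℕ.* N ℕ.+ 1) ℚ.≤ cylinderCharge j t n N ℚ.+ cylinderCharge j t n N
  cylinderCharge-free j t n N eq = cases (F j ℕ.∸ F n) refl (F j ℕ.∸ F (suc n))
      (trans (cong (λ v → F j ℕ.∸ (F n ℕ.+ isFree v)) eq) (trans (cong (F j ℕ.∸_) (ℕ.+-comm (F n) 1)) (sym (ℕ.pred[m∸n]≡m∸[1+n] (F j) (F n)))))
    where
    d₀ = overlap? j t (suc n) (2 ℕ.* N ℕ.+ 0)
    d₁ = overlap? j t (suc n) (2 ℕ.* N ℕ.+ 1)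
    d  = overlap? j t n N
    cases : ∀ e → F j ℕ.∸ F n ≡ e → ∀ e′ → e′ ≡ ℕ.pred (F j ℕ.∸ F n) →
            when d₀ (½ ^ℚ e′) ℚ.+ when d₁ (½ ^ℚ e′) ℚ.≤ when d (½ ^ℚ (F j ℕ.∸ F n)) ℚ.+ when d (½ ^ℚ (F j ℕ.∸ F n))
    cases e eq e′ eq′ = subst (λ f → when d₀ (½ ^ℚ e′) ℚ.+ when d₁ (½ ^ℚ e′) ℚ.≤ when d (½ ^ℚ f) ℚ.+ when d (½ ^ℚ f)) (sym eq)
        (subst (λ f → when d₀ (½ ^ℚ f) ℚ.+ when d₁ (½ ^ℚ f) ℚ.≤ when d (½ ^ℚ e) ℚ.+ when d (½ ^ℚ e)) (sym (trans eq′ (cong ℕ.pred eq))) (by-exponent e eq))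
      where
      by-exponent : ∀ e → F j ℕ.∸ F n ≡ e → when d₀ (½ ^ℚ ℕ.pred e) ℚ.+ when d₁ (½ ^ℚ ℕ.pred e) ℚ.≤ when d (½ ^ℚ e) ℚ.+ when d (½ ^ℚ e)
      by-exponent zero    _  = ℚ.+-mono-≤ (when-mono d₀ d (overlap-parent {j} {t} {n} {N} z≤n) (ℚ.<⇒≤ 0<1) ℚ.≤-refl)
                                          (when-mono d₁ d (overlap-parent {j} {t} {n} {N} ℕ.≤-refl) (ℚ.<⇒≤ 0<1) ℚ.≤-refl)
      by-exponent (suc e) eq = subst (λ h → when d₀ h ℚ.+ when d₁ h ℚ.≤ when d (½ ^ℚ suc e) ℚ.+ when d (½ ^ℚ suc e)) (½^-double e)
        (when-exclusive d₀ d₁ d (overlap-one-child {j} {t} {n} {N} n<j) (overlap-parent {j} {t} {n} {N} z≤n) (overlap-parent {j} {t} {n} {N} ℕ.≤-refl) (ℚ.<⇒≤ (½^-pos (suc e))))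
        where
        n<j : n ℕ.< j
        n<j = ℕ.≰⇒> λ j≤n → 0≢suc (trans (sym (ℕ.m≤n⇒m∸n≡0 (freeCount-mono constraint j≤n))) eq)
          where
          0≢suc : ¬ (0 ≡ suc e)
          0≢suc ()

  cylinderCharge-forced : ∀ j t n N {b} → constraint n ≡ just b → cylinderCharge j t (suc n) (2 ℕ.* N ℕ.+ bitValue b) ℚ.≤ cylinderCharge j t n N
  cylinderCharge-forced j t n N {b} eq = when-mono (overlap? j t (suc n) (2 ℕ.* N ℕ.+ bitValue b)) (overlap? j t n N)
      (overlap-parent {j} {t} {n} {N} (bitValue≤1 b)) (ℚ.<⇒≤ (½^-pos (F j ℕ.∸ F n)))
      (ℚ.≤-reflexive (cong (λ f → ½ ^ℚ (F j ℕ.∸ f)) (trans (cong (λ v → F n ℕ.+ isFree v) eq) (ℕ.+-identityʳ (F n)))))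
    where
    bitValue≤1 : ∀ b → bitValue b ℕ.≤ 1
    bitValue≤1 true  = ℕ.≤-refl
    bitValue≤1 false = z≤n

  -- A product of a factor for the prefix and one for the obstacle, so that tails of the obstacle
  -- weights control the tails of the charges at every prefix.
  cylinderCharge≤ : ∀ j t n N → cylinderCharge j t n N ℚ.≤ fromℕ (2 ℕ.^ F n) ℚ.* ½ ^ℚ F j
  cylinderCharge≤ j t n N = ℚ.≤-trans (when≤ (overlap? j t n N) (ℚ.<⇒≤ (½^-pos (F j ℕ.∸ F n)))) (bound (F j) (F n))
    where
    open ℚ.≤-Reasoning
    bound : ∀ a b → ½ ^ℚ (a ℕ.∸ b) ℚ.≤ fromℕ (2 ℕ.^ b) ℚ.* ½ ^ℚ a
    bound a b = begin
      ½ ^ℚ (a ℕ.∸ b)                                            ≡⟨ ℚ.*-identityˡ (½ ^ℚ (a ℕ.∸ b)) ⟨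
      1ℚ ℚ.* ½ ^ℚ (a ℕ.∸ b)                                     ≡⟨ cong (ℚ._* ½ ^ℚ (a ℕ.∸ b)) (fromℕ[2^n]*½^n≡1 b) ⟨
      fromℕ (2 ℕ.^ b) ℚ.* ½ ^ℚ b ℚ.* ½ ^ℚ (a ℕ.∸ b)             ≡⟨ ℚ.*-assoc (fromℕ (2 ℕ.^ b)) (½ ^ℚ b) (½ ^ℚ (a ℕ.∸ b)) ⟩
      fromℕ (2 ℕ.^ b) ℚ.* (½ ^ℚ b ℚ.* ½ ^ℚ (a ℕ.∸ b))           ≡⟨ cong (fromℕ (2 ℕ.^ b) ℚ.*_) (^-homo-* ½ b (a ℕ.∸ b)) ⟨
      fromℕ (2 ℕ.^ b) ℚ.* ½ ^ℚ (b ℕ.+ (a ℕ.∸ b))                ≤⟨ *-monoʳ-≤ {fromℕ (2 ℕ.^ b)} {½ ^ℚ (b ℕ.+ (a ℕ.∸ b))} {½ ^ℚ a} (0≤fromℕ (2 ℕ.^ b)) (½^-antimono-≤ {a} {b ℕ.+ (a ℕ.∸ b)} (ℕ.m≤n+m∸n a b)) ⟩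
      fromℕ (2 ℕ.^ b) ℚ.* ½ ^ℚ a                                ∎

  charge : ℕ → ℕ → ℕ → ℚ
  charge i n N = ∑ (λ e → cylinderCharge (level i) (target i e) n N) 4

  weight : ℕ → ℚ
  weight i = fromℕ 4 ℚ.* ½ ^ℚ F (level i)

  four : ∀ K w → ∑ (λ _ → K ℚ.* w) 4 ≡ K ℚ.* (fromℕ 4 ℚ.* w)
  four = identity
    where
    identity : ∀ K w → 0ℚ ℚ.+ K ℚ.* w ℚ.+ K ℚ.* w ℚ.+ K ℚ.* w ℚ.+ K ℚ.* w ≡ K ℚ.* (fromℕ 4 ℚ.* w)
    identity = solve-∀ ℚ-ring

  charge≤ : ∀ i n N → charge i n N ℚ.≤ fromℕ (2 ℕ.^ F n) ℚ.* weight i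
  charge≤ i n N = ℚ.≤-trans (∑-mono (λ e → cylinderCharge≤ (level i) (target i e) n N) 4)
    (ℚ.≤-reflexive (four (fromℕ (2 ℕ.^ F n)) (½ ^ℚ F (level i))))

  charge-free : ∀ i n N → constraint n ≡ nothing →
                charge i (suc n) (2 ℕ.* N ℕ.+ 0) ℚ.+ charge i (suc n) (2 ℕ.* N ℕ.+ 1) ℚ.≤ charge i n N ℚ.+ charge i n N
  charge-free i n N eq = subst₂ ℚ._≤_
    (∑-+ (λ e → cylinderCharge (level i) (target i e) (suc n) (2 ℕ.* N ℕ.+ 0)) (λ e → cylinderCharge (level i) (target i e) (suc n) (2 ℕ.* N ℕ.+ 1)) 4)
    (∑-+ (λ e → cylinderCharge (level i) (target i e) n N) (λ e → cylinderCharge (level i) (target i e) n N) 4)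
    (∑-mono (λ e → cylinderCharge-free (level i) (target i e) n N eq) 4)

  charge-initial : ∀ L → ∑ (λ i → charge i 0 0) L ℚ.≤ ½
  charge-initial L = ℚ.≤-trans (∑-mono (λ i → ℚ.≤-trans (charge≤ i 0 0) (ℚ.≤-reflexive (ℚ.*-identityˡ (weight i)))) L) (small L)

  open Greedy constraint charge weight (λ n → fromℕ (2 ℕ.^ F n))
    (λ i n N → ∑-nonneg (λ e → 0≤cylinderCharge (level i) (target i e) n N) 4)
    charge-free
    (λ i n N eq → ∑-mono (λ e → cylinderCharge-forced (level i) (target i e) n N eq) 4)
    (λ n → 0≤fromℕ (2 ℕ.^ F n)) charge≤ charge-initial tails public using (bit; bit-respects; charge<1)

  -- A target that is reached at its own level carries charge 1, whereas the chosen bits keep every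
  -- charge below 1.
  bit-avoids : ∀ i e → e ℕ.< 4 → prefix bit (level i) ≢ target i e
  bit-avoids i e e<4 prefix≡target = ℚ.<-irrefl refl (begin-strict
    1ℚ                                                                 ≡⟨ cong (½ ^ℚ_) (ℕ.n∸n≡0 (F j)) ⟨
    ½ ^ℚ (F j ℕ.∸ F j)                                                 ≡⟨ when-true (overlap? j (target i e) j (prefix bit j)) hit ⟨
    cylinderCharge j (target i e) j (prefix bit j)                     ≤⟨ term≤∑ (λ e → 0≤cylinderCharge j (target i e) j (prefix bit j)) e<4 ⟩
    charge i j (prefix bit j)                                          <⟨ charge<1 i j ⟩
    1ℚ                                                                 ∎)
    where
    open ℚ.≤-Reasoning
    j = level i
    hit : Overlap j (target i e) j (prefix bit j)
    hit = subst (λ N → Overlap j (target i e) j N) (sym prefix≡target)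
      (ℕ.*-monoˡ-< (2 ℕ.^ j) {{ℕ.m^n≢0 2 j}} (ℕ.n<1+n (target i e)) , ℕ.*-monoˡ-< (2 ℕ.^ j) {{ℕ.m^n≢0 2 j}} (ℕ.n<1+n (target i e)))

-- From covers of small total mass to obstacles

partialSum-below-lower : ∀ (f : ℕ → Cut) n {a} → Below (partialSum f n) a → AtLeast (partialSum f n) a
partialSum-below-lower f zero    a<0                     = atLeast λ c<a → ℚ.<-trans c<a a<0
partialSum-below-lower f (suc n) (p , q , p<S , q<f , a<p+q) = atLeast λ c<a → p , q , p<S , q<f , ℚ.<-trans c<a a<p+q

module MassBound {f : ℕ → Cut} (separate : ∀ i {c d} → Below (f i) c → Above (f i) d → c ℚ.< d)
                 (v : ℝ) (hasSum : HasSum f (cut v)) {ρ : ℕ → ℚ} (0≤ρ : ∀ i → 0ℚ ℚ.≤ ρ i) (ρ≤f : ∀ i → AtLeast (f i) (ρ i)) where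

  -- The lower bounds `ρ` replace the terms only from `M` on. Keeping the true partial sum before
  -- `M` is what permits a tail of `ρ` to be estimated by the difference of two partial sums of `f`.
  extend : ∀ M {a} → AtLeast (partialSum f M) a → ∀ L → AtLeast (partialSum f (M ℕ.+ L)) (a ℚ.+ ∑ (λ i → ρ (M ℕ.+ i)) L)
  extend M {a} a≤S zero    = subst₂ (λ n a → AtLeast (partialSum f n) a) (sym (ℕ.+-identityʳ M)) (sym (ℚ.+-identityʳ a)) a≤S
  extend M {a} a≤S (suc L) = subst₂ (λ n a → AtLeast (partialSum f n) a) (sym (ℕ.+-suc M L)) (ℚ.+-assoc a (∑ (λ i → ρ (M ℕ.+ i)) L) (ρ (M ℕ.+ L)))
    (+-atLeast (extend M a≤S L) (ρ≤f (M ℕ.+ L)))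

  atLeast≤ : ∀ n {a b} → AtLeast (partialSum f n) a → Above (partialSum f n) b → a ℚ.≤ b
  atLeast≤ n a≤S S<b = ℚ.≮⇒≥ λ b<a → ℚ.<-irrefl refl (partialSum-separate separate n (AtLeast.below a≤S b<a) S<b)

  mass≤ : ∀ {q} → Above (cut v) q → ∀ {ε} → 0ℚ ℚ.< ε → ∀ L → ∑ ρ L ℚ.≤ q ℚ.+ ε
  mass≤ {q} v<q {ε} 0<ε L = bound (hasSum ε 0<ε)
    where
    bound : ∃[ N ] (∀ n → N ℕ.≤ n → ∣ partialSum f n - cut v ∣ < ι ε) → ∑ ρ L ℚ.≤ q ℚ.+ ε
    bound (N , close) with close (N ℕ.+ L) (ℕ.m≤m+n N L)
    ... | p , ((a , b , S<a , b<v , a-b<p) , _) , p<ε = ℚ.≤-trans (∑-extend 0≤ρ L N)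
            (ℚ.≤-trans (atLeast≤ (N ℕ.+ L) (partialSum-atLeast ρ≤f (N ℕ.+ L)) S<a)
              (ℚ.<⇒≤ (<-lin₂ (ℚ.<-trans a-b<p p<ε) (Below⇒<Above v b<v v<q) (identity a b q ε))))
      where
      identity : ∀ a b q e → ((e ℚ.- (a ℚ.- b)) ℚ.+ (q ℚ.- b)) ℚ.+ a ≡ q ℚ.+ e
      identity = solve-∀ ℚ-ring

  -- The partial sums at `M` and `M + L` both lie within `ε / 2` of `v`, so what is added between
  -- them is at most `ε`.
  mass-tails : ∀ {ε} → 0ℚ ℚ.< ε → ∃[ N ] (∀ M → N ℕ.≤ M → ∀ L → ∑ (λ i → ρ (M ℕ.+ i)) L ℚ.≤ ε)
  mass-tails {ε} 0<ε = bound (hasSum (½ ℚ.* ε) (*-pos 0<½ 0<ε))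
    where
    bound : ∃[ N ] (∀ n → N ℕ.≤ n → ∣ partialSum f n - cut v ∣ < ι (½ ℚ.* ε)) → _
    bound (N , close) = N , tail
      where
      tail : ∀ M → N ℕ.≤ M → ∀ L → ∑ (λ i → ρ (M ℕ.+ i)) L ℚ.≤ ε
      tail M N≤M L with close M N≤M | close (M ℕ.+ L) (ℕ.≤-trans N≤M (ℕ.m≤m+n M L))
      ... | p , (_ , (a , b , a<S , v<b , -p<a-b)) , p<ε | p′ , ((a′ , b′ , S<a′ , b′<v , a′-b′<p′) , _) , p′<ε =
        ≤-lin₂ (≤-lin₂ (ℚ.<⇒≤ (ℚ.<-trans a′-b′<p′ p′<ε)) (ℚ.<⇒≤ (Below⇒<Above v b′<v v<b)) (identity₁ a′ b b′ (½ ℚ.* ε)))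
          (≤-lin₂ (ℚ.<⇒≤ (<-lin₂ -p<a-b p<ε (identity₂ a b p (½ ℚ.* ε)))) (atLeast≤ (M ℕ.+ L) (extend M (partialSum-below-lower f M a<S) L) S<a′)
            (identity₃ a a′ b (½ ℚ.* ε) (∑ (λ i → ρ (M ℕ.+ i)) L)))
          (identity₄ a′ b ε (∑ (λ i → ρ (M ℕ.+ i)) L))
        where
        identity₁ : ∀ a′ b b′ e → ((e ℚ.- (a′ ℚ.- b′)) ℚ.+ (b ℚ.- b′)) ℚ.+ a′ ≡ b ℚ.+ e
        identity₁ = solve-∀ ℚ-ring
        identity₂ : ∀ a b p e → ((a ℚ.- b ℚ.- ℚ.- p) ℚ.+ (e ℚ.- p)) ℚ.+ b ≡ a ℚ.+ e
        identity₂ = solve-∀ ℚ-ring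
        identity₃ : ∀ a a′ b e s → ((a ℚ.+ e ℚ.- b) ℚ.+ (a′ ℚ.- (a ℚ.+ s))) ℚ.+ (b ℚ.+ s) ≡ a′ ℚ.+ e
        identity₃ = solve-∀ ℚ-ring
        identity₄ : ∀ a′ b e s → ((b ℚ.+ ½ ℚ.* e ℚ.- a′) ℚ.+ (a′ ℚ.+ ½ ℚ.* e ℚ.- (b ℚ.+ s))) ℚ.+ s ≡ e
        identity₄ = solve-∀ ℚ-ring

geometric : ∀ M L → ∑ (λ i → ½ ^ℚ suc (M ℕ.+ i)) L ℚ.≤ ½ ^ℚ M
geometric M L = subst (∑ (λ i → ½ ^ℚ suc (M ℕ.+ i)) L ℚ.≤_) (exact L)
  (subst (ℚ._≤ ∑ (λ i → ½ ^ℚ suc (M ℕ.+ i)) L ℚ.+ ½ ^ℚ (M ℕ.+ L)) (ℚ.+-identityʳ (∑ (λ i → ½ ^ℚ suc (M ℕ.+ i)) L)) (ℚ.+-monoʳ-≤ (∑ (λ i → ½ ^ℚ suc (M ℕ.+ i)) L) (ℚ.<⇒≤ (½^-pos (M ℕ.+ L)))))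
  where
  exact : ∀ L → ∑ (λ i → ½ ^ℚ suc (M ℕ.+ i)) L ℚ.+ ½ ^ℚ (M ℕ.+ L) ≡ ½ ^ℚ M
  exact zero    = trans (ℚ.+-identityˡ (½ ^ℚ (M ℕ.+ 0))) (cong (½ ^ℚ_) (ℕ.+-identityʳ M))
  exact (suc L) = begin
    ∑ g L ℚ.+ ½ ^ℚ suc (M ℕ.+ L) ℚ.+ ½ ^ℚ (M ℕ.+ suc L)       ≡⟨ cong (λ n → ∑ g L ℚ.+ ½ ^ℚ suc (M ℕ.+ L) ℚ.+ ½ ^ℚ n) (ℕ.+-suc M L) ⟩
    ∑ g L ℚ.+ ½ ^ℚ suc (M ℕ.+ L) ℚ.+ ½ ^ℚ suc (M ℕ.+ L)       ≡⟨ ℚ.+-assoc (∑ g L) _ _ ⟩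
    ∑ g L ℚ.+ (½ ^ℚ suc (M ℕ.+ L) ℚ.+ ½ ^ℚ suc (M ℕ.+ L))     ≡⟨ cong (∑ g L ℚ.+_) (½^-double (M ℕ.+ L)) ⟩
    ∑ g L ℚ.+ ½ ^ℚ (M ℕ.+ L)                                  ≡⟨ exact L ⟩
    ½ ^ℚ M                                                    ∎
    where
    open ≡-Reasoning
    g = λ i → ½ ^ℚ suc (M ℕ.+ i)

prefix<2^n : ∀ bit n → prefix bit n ℕ.< 2 ℕ.^ n
prefix<2^n bit zero    = s≤s z≤n
prefix<2^n bit (suc n) = ℕ-lin₃ 0 (prefix<2^n bit n) (prefix<2^n bit n) (bitValue≤1 (bit n)) (identity (prefix bit n) (bitValue (bit n)) (2 ℕ.^ n))
  where
  bitValue≤1 : ∀ b → bitValue b ℕ.≤ 1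
  bitValue≤1 true  = ℕ.≤-refl
  bitValue≤1 false = z≤n
  identity : ∀ p v q → suc (2 ℕ.* p ℕ.+ v) ℕ.+ (q ℕ.+ (q ℕ.+ 1)) ℕ.+ 0 ≡ 2 ℕ.* q ℕ.+ (suc p ℕ.+ (suc p ℕ.+ v))
  identity = ℕSolver.solve-∀

≤-scaled : ∀ {m n} h → 0ℚ ℚ.< h → m ℕ.≤ n → fromℕ m ℚ.* h ℚ.≤ fromℕ n ℚ.* h
≤-scaled {m} {n} h 0<h m≤n = *-monoˡ-≤ {h} {fromℕ m} {fromℕ n} (ℚ.<⇒≤ 0<h) (fromℕ-mono-≤ {m} {n} m≤n)

-- A set of diameter r < h containing y meets at most four of the intervals
-- [N h, (N + 1) h].
module Position (U : Subset) (r : ℝ) (isDiam : IsDiameter U r) (y : ℝ) (y∈U : y ∈ U)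
                (h : ℚ) (0<h : 0ℚ ℚ.< h) (r<h : Above (cut r) h) (k : ℕ)
                (left : ∀ {j} → k ≡ suc j → Below (cut y) (fromℕ j ℚ.* h)) where

  module _ (x : ℝ) (x∈U : x ∈ U) (N : ℕ) (N≤x : AtLeast (cut x) (fromℕ N ℚ.* h)) (x≤N : AtMost (cut x) (fromℕ N ℚ.* h ℚ.+ h)) where

    far-apart : Below ∣ cut x - cut y ∣ h → ⊥
    far-apart h<∣x-y∣ = proj₁ isDiam (x , y , x∈U , y∈U) (h , r<h , h<∣x-y∣)

    N≤1+k : Above (cut y) (fromℕ (suc k) ℚ.* h) → N ℕ.≤ suc k
    N≤1+k y<k+1 = ℕ.≮⇒≥ λ 1+k<N → contradict 1+k<N (IsDedekind.above-open (isDedekind y) y<k+1)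
      where
      contradict : suc k ℕ.< N → ∃[ b ] b ℚ.< fromℕ (suc k) ℚ.* h × Above (cut y) b → ⊥
      contradict 1+k<N (b , b<k+1 , y<b) =
        let a , b+h<a , a<N = ℚ.<-dense {b ℚ.+ h} {fromℕ N ℚ.* h} (ℚ.<-≤-trans (ℚ.+-monoˡ-< h b<k+1)
              (subst (ℚ._≤ fromℕ N ℚ.* h) (fromℕ-suc-* (suc k) h) (≤-scaled {suc (suc k)} {N} h 0<h 1+k<N)))
        in far-apart (inj₂ (inj₁ (a , b , AtLeast.below N≤x a<N , y<b , <-lin₁ b+h<a (identity a b h))))
        where
        identity : ∀ a b h → (a ℚ.- (b ℚ.+ h)) ℚ.+ h ≡ a ℚ.- b
        identity = solve-∀ ℚ-ring

    k≤N+2 : k ℕ.≤ N ℕ.+ 2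
    k≤N+2 = by-cases k left
      where
      contradict : ∀ j → N ℕ.+ 2 ℕ.≤ j → ∃[ b ] fromℕ j ℚ.* h ℚ.< b × Below (cut y) b → ⊥
      contradict j N+2≤j (b , j<b , b<y) =
        let a , N+1<a , a<b-h = ℚ.<-dense {fromℕ N ℚ.* h ℚ.+ h} {b ℚ.- h} (<-lin₁ (ℚ.≤-<-trans
              (subst (ℚ._≤ fromℕ j ℚ.* h) (trans (fromℕ-suc-* (suc N) h) (cong (ℚ._+ h) (fromℕ-suc-* N h)))
                (≤-scaled {suc (suc N)} {j} h 0<h (ℕ.≤-trans (ℕ.≤-reflexive (ℕ.+-comm 2 N)) N+2≤j))) j<b) (identity₁ (fromℕ N ℚ.* h) b h))
        in far-apart (inj₂ (inj₂ (a , b , AtMost.above x≤N N+1<a , b<y , <-lin₁ a<b-h (identity₂ a b h))))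
        where
        identity₁ : ∀ n b h → (b ℚ.- (n ℚ.+ h ℚ.+ h)) ℚ.+ (n ℚ.+ h) ≡ b ℚ.- h
        identity₁ = solve-∀ ℚ-ring
        identity₂ : ∀ a b h → (b ℚ.- h ℚ.- a) ℚ.+ (a ℚ.- b) ≡ ℚ.- h
        identity₂ = solve-∀ ℚ-ring
      by-cases : ∀ k → (∀ {j} → k ≡ suc j → Below (cut y) (fromℕ j ℚ.* h)) → k ℕ.≤ N ℕ.+ 2
      by-cases zero    _    = z≤n
      by-cases (suc j) left = ℕ.≰⇒> λ N+2≤j → contradict j N+2≤j (IsDedekind.below-open (isDedekind y) (left refl))

    -- The point `y` lies between `(k − 1) h` and `(k + 1) h`, and `x` is within `h` of it, which
    -- leaves `N` from `k − 2` to `k + 1`. If the search ended at `k = n`, then `N < n` replaces the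
    -- missing right end. Truncation in the subtraction is harmless because `k + e = N + 2`.
    near : ∀ n → k ℕ.≤ n → (k ℕ.< n → Above (cut y) (fromℕ (suc k) ℚ.* h)) → N ℕ.< n → ∃[ e ] e ℕ.< 4 × N ≡ k ℕ.+ e ℕ.∸ 2
    near n k≤n right N<n with ℕ.m≤n⇒∃[o]m+o≡n k≤N+2
    ... | e , k+e≡N+2 = e , ℕ.+-cancelˡ-< k e 4 (subst (ℕ._< k ℕ.+ 4) (sym k+e≡N+2) (ℕ.≤-trans (s≤s (ℕ.+-monoˡ-≤ 2 (N≤ (k ℕ.<? n)))) (ℕ.≤-reflexive (identity k)))) ,
                        sym (trans (cong (ℕ._∸ 2) k+e≡N+2) (ℕ.m+n∸n≡m N 2))
      where
      identity : ∀ k → suc (suc k ℕ.+ 2) ≡ k ℕ.+ 4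
      identity = ℕSolver.solve-∀
      N≤ : Dec (k ℕ.< n) → N ℕ.≤ suc k
      N≤ (yes k<n) = N≤1+k (right k<n)
      N≤ (no  k≮n) = ℕ.m≤n⇒m≤1+n (ℕ.<⇒≤ (ℕ.<-≤-trans N<n (ℕ.≮⇒≥ k≮n)))

-- The search stops at level `n` because `r` may be zero. Otherwise the scale is determined up to a
-- factor 4, locatedness choosing between overlapping alternatives. The assumption `r ≤ ½` rules out
-- that the search ends before a scale above `r` has been found.
scale-of : ∀ (r : ℝ) → cut r ≤ ι ½ → ∀ n → ∃[ j ] Above (cut r) (½ ^ℚ j) × (j ≡ n ⊎ Below (cut r) (½ ^ℚ suc (suc j)))
scale-of r r≤½ n = from-search (search (λ k → Above (cut r) (½ ^ℚ k)) (λ k → Below (cut r) (½ ^ℚ suc k))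
    (λ k → swap (IsDedekind.located (isDedekind r) (½^-antimono-< {k} {suc k} ℕ.≤-refl))) (suc n))
  where
  swap : ∀ {P Q : Set} → P ⊎ Q → Q ⊎ P
  swap (inj₁ p) = inj₂ p
  swap (inj₂ q) = inj₁ q
  from-search : ∃[ k ] k ℕ.≤ suc n × (∀ {j} → k ≡ suc j → Above (cut r) (½ ^ℚ j)) × (k ℕ.< suc n → Below (cut r) (½ ^ℚ suc k)) → _
  from-search (zero , _ , _ , right) = let q , ½<q , q<r = IsDedekind.below-open (isDedekind r) (right (s≤s z≤n)) in ⊥-elim (r≤½ (q , ½<q , q<r))
  from-search (suc j , s≤s j≤n , left , right) = j , left refl , cases (j ℕ.≟ n)
    where
    cases : Dec (j ≡ n) → j ≡ n ⊎ Below (cut r) (½ ^ℚ suc (suc j))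
    cases (yes j≡n) = inj₁ j≡n
    cases (no  j≢n) = inj₂ (right (s≤s (ℕ.≤∧≢⇒< j≤n j≢n)))

-- This is `½ ^ f ≤ (½ ^ j) ^ t′ ≤ rˢ`. As the base is at most 1, the condition at `t′` implies the
-- one at the smaller exponent `t`, which the definition of the power asks for as well.
power-atLeast : ∀ (r s : ℝ) {t t′} → 0ℚ ℚ.< t → Below (cut s) t → Above (cut s) t′ → ∀ {j f} →
                numerator t′ ℕ.* j ℕ.≤ ↧ₙ t′ ℕ.* f → Below (cut r) (½ ^ℚ j) → AtLeast (cut r ^ cut s) (½ ^ℚ f)
power-atLeast r s {t} {t′} 0<t t<s s<t′ {j} {f} tj≤f ½^j<r = atLeast bound
  where
  open ℚ.≤-Reasoning
  raise : ∀ {c} u v .{{_ : ℕ.NonZero v}} → 0ℚ ℚ.≤ c → c ℚ.< ½ ^ℚ f → u ℕ.* j ℕ.≤ v ℕ.* f → c ^ℚ v ℚ.< (½ ^ℚ j) ^ℚ u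
  raise {c} u v 0≤c c<½^f uj≤vf = begin-strict
    c ^ℚ v             <⟨ ^-monoˡ-< 0≤c c<½^f v ⟩
    (½ ^ℚ f) ^ℚ v      ≡⟨ ^-assocʳ ½ f v ⟩
    ½ ^ℚ (v ℕ.* f)     ≤⟨ ½^-antimono-≤ {u ℕ.* j} {v ℕ.* f} uj≤vf ⟩
    ½ ^ℚ (u ℕ.* j)     ≡⟨ ^-assocʳ ½ j u ⟨
    (½ ^ℚ j) ^ℚ u      ∎
  tj≤f-smaller : numerator t ℕ.* j ℕ.≤ ↧ₙ t ℕ.* f
  tj≤f-smaller = ℕ.*-cancelˡ-≤ (↧ₙ t′) (ℕ.≤-trans (ℕ.≤-reflexive (id₁ (↧ₙ t′) (numerator t) j))
    (ℕ.≤-trans (ℕ.*-monoˡ-≤ j (ℕ.<⇒≤ (cross-< 0<t (Below⇒<Above s t<s s<t′))))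
      (ℕ.≤-trans (ℕ.≤-reflexive (id₂ (numerator t′) (↧ₙ t) j)) (ℕ.≤-trans (ℕ.*-monoʳ-≤ (↧ₙ t) tj≤f) (ℕ.≤-reflexive (id₃ (↧ₙ t) (↧ₙ t′) f))))))
    where
    id₁ : ∀ a b c → a ℕ.* (b ℕ.* c) ≡ b ℕ.* a ℕ.* c
    id₁ = ℕSolver.solve-∀
    id₂ : ∀ a b c → a ℕ.* b ℕ.* c ≡ b ℕ.* (a ℕ.* c)
    id₂ = ℕSolver.solve-∀
    id₃ : ∀ a b c → a ℕ.* (b ℕ.* c) ≡ b ℕ.* (a ℕ.* c)
    id₃ = ℕSolver.solve-∀
  bound : ∀ {c} → c ℚ.< ½ ^ℚ f → Below (cut r ^ cut s) c
  bound {c} c<½^f with c ℚ.<? 0ℚ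
  ... | yes c<0 = inj₁ c<0
  ... | no  c≮0 = inj₂ (½ ^ℚ j , t , t′ , ½^-pos j , 0<t , ½^j<r , t<s , s<t′ ,
                    raise (numerator t) (↧ₙ t) (ℚ.≮⇒≥ c≮0) c<½^f tj≤f-smaller , raise (numerator t′) (↧ₙ t′) (ℚ.≮⇒≥ c≮0) c<½^f tj≤f)

-- The lower bound for the dimension

-- `many-free` reads `t′ (n + 2) < F n + 4`: a set of diameter above `½ ^ (n + 2)` has `s`-th power
-- at least `½ ^ (F n + 4)`, comparable with the chance `½ ^ F n` of hitting a cylinder of level
-- `n`. The 2 is the loss in `scale-of`; the 4 leaves room for the bounded terms in the count of
-- free bits.
module LowerBound
  (E : Subset) (constraint : ℕ → Maybe Bool) (s : ℝ) {t t′ : ℚ} (0<t : 0ℚ ℚ.< t) (t<s : Below (cut s) t) (s<t′ : Above (cut s) t′)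
  (many-free : ∀ n → numerator t′ ℕ.* suc (suc n) ℕ.< ↧ₙ t′ ℕ.* (freeCount constraint n ℕ.+ 4))
  (points : ∀ bit → (∀ n {v} → constraint n ≡ just v → bit n ≡ v) →
            Σ[ x ∈ ℝ ] x ∈ E × (∀ n → AtLeast (cut x) (fromℕ (prefix bit n) ℚ.* ½ ^ℚ n) × AtMost (cut x) (fromℕ (prefix bit n) ℚ.* ½ ^ℚ n ℚ.+ ½ ^ℚ n)))
  where

  F : ℕ → ℕ
  F = freeCount constraint

  freeCount-unbounded : ∀ B → ∃[ n ] B ℕ.≤ F n
  freeCount-unbounded B = n , ℕ.<⇒≤ (ℕ.+-cancelʳ-< 4 B (F n) (ℕ.*-cancelˡ-< (↧ₙ t′) (B ℕ.+ 4) (F n ℕ.+ 4) (ℕ.≤-<-trans n≤ (many-free n))))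
    where
    n = ↧ₙ t′ ℕ.* (B ℕ.+ 4)
    n≤ : n ℕ.≤ numerator t′ ℕ.* suc (suc n)
    n≤ = ℕ.≤-trans (ℕ.≤-trans (ℕ.n≤1+n n) (ℕ.n≤1+n (suc n)))
      (ℕ.≤-trans (ℕ.≤-reflexive (sym (ℕ.*-identityˡ (suc (suc n))))) (ℕ.*-monoˡ-≤ (suc (suc n)) (0<numerator (ℚ.<-trans 0<t (Below⇒<Above s t<s s<t′)))))

  -- Four cylinders of weight `½ ^ F level` are paid for by `64 = 4 * 2 ^ 4` times the mass, or, for
  -- a set too small to be measured, by an allowance depending on the index. All allowances together
  -- amount to at most `1 / 4`.
  record Obstacle (U : Subset) (r : ℝ) (i : ℕ) : Set₁ where
    field
      level position : ℕ
      mass    : ℚ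
      0≤mass  : 0ℚ ℚ.≤ mass
      mass≤   : AtLeast (cut r ^ cut s) mass
      weight≤ : fromℕ 4 ℚ.* ½ ^ℚ F level ℚ.≤ fromℕ 64 ℚ.* mass ℚ.+ ½ ^ℚ suc (2 ℕ.+ i)
      near    : ∀ x → x ∈ U → ∀ N → N ℕ.< 2 ℕ.^ level → AtLeast (cut x) (fromℕ N ℚ.* ½ ^ℚ level) →
                AtMost (cut x) (fromℕ N ℚ.* ½ ^ℚ level ℚ.+ ½ ^ℚ level) → ∃[ e ] e ℕ.< 4 × N ≡ position ℕ.+ e ℕ.∸ 2

  Mass : ℝ → ℕ → ℕ → Set
  Mass r i j = ∃[ mass ] 0ℚ ℚ.≤ mass × AtLeast (cut r ^ cut s) mass × fromℕ 4 ℚ.* ½ ^ℚ F j ℚ.≤ fromℕ 64 ℚ.* mass ℚ.+ ½ ^ℚ suc (2 ℕ.+ i)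

  mass-at : ∀ r i {n} → 5 ℕ.+ i ℕ.≤ F n → ∀ j → j ≡ n ⊎ Below (cut r) (½ ^ℚ suc (suc j)) → Mass r i j
  -- The search reached the deep level `n`: mass 0 suffices, since `4 * ½ ^ (5 + i)` is exactly the
  -- allowance `½ ^ (3 + i)`.
  mass-at r i 5+i≤F j (inj₁ refl) = 0ℚ , ℚ.≤-refl , atLeast inj₁ , (begin
    fromℕ 4 ℚ.* ½ ^ℚ F j                                    ≤⟨ *-monoʳ-≤ {fromℕ 4} {½ ^ℚ F j} {½ ^ℚ (5 ℕ.+ i)} (0≤fromℕ 4) (½^-antimono-≤ {5 ℕ.+ i} {F j} 5+i≤F) ⟩
    fromℕ 4 ℚ.* ½ ^ℚ (5 ℕ.+ i)                              ≡⟨ identity (½ ^ℚ suc (2 ℕ.+ i)) ⟩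
    fromℕ 64 ℚ.* 0ℚ ℚ.+ ½ ^ℚ suc (2 ℕ.+ i)                  ∎)
    where
    open ℚ.≤-Reasoning
    identity : ∀ h → fromℕ 4 ℚ.* (½ ℚ.* (½ ℚ.* h)) ≡ fromℕ 64 ℚ.* 0ℚ ℚ.+ h
    identity = solve-∀ ℚ-ring
  mass-at r i _ j (inj₂ ½^j+2<r) = ½ ^ℚ (F j ℕ.+ 4) , ℚ.<⇒≤ (½^-pos (F j ℕ.+ 4)) ,
    power-atLeast r s 0<t t<s s<t′ {suc (suc j)} {F j ℕ.+ 4} (ℕ.<⇒≤ (many-free j)) ½^j+2<r , (begin
    fromℕ 4 ℚ.* ½ ^ℚ F j                                        ≡⟨ identity (½ ^ℚ F j) ⟩
    fromℕ 64 ℚ.* (½ ^ℚ F j ℚ.* ½ ^ℚ 4)                          ≡⟨ cong (fromℕ 64 ℚ.*_) (^-homo-* ½ (F j) 4) ⟨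
    fromℕ 64 ℚ.* ½ ^ℚ (F j ℕ.+ 4)                               ≡⟨ ℚ.+-identityʳ (fromℕ 64 ℚ.* ½ ^ℚ (F j ℕ.+ 4)) ⟨
    fromℕ 64 ℚ.* ½ ^ℚ (F j ℕ.+ 4) ℚ.+ 0ℚ                        ≤⟨ ℚ.+-monoʳ-≤ (fromℕ 64 ℚ.* ½ ^ℚ (F j ℕ.+ 4)) (ℚ.<⇒≤ (½^-pos (suc (2 ℕ.+ i)))) ⟩
    fromℕ 64 ℚ.* ½ ^ℚ (F j ℕ.+ 4) ℚ.+ ½ ^ℚ suc (2 ℕ.+ i)        ∎)
    where
    open ℚ.≤-Reasoning
    identity : ∀ h → fromℕ 4 ℚ.* h ≡ fromℕ 64 ℚ.* (h ℚ.* (½ ℚ.* (½ ℚ.* (½ ℚ.* (½ ℚ.* 1ℚ)))))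
    identity = solve-∀ ℚ-ring

  obstacle : ∀ (U : Subset) r → IsDiameter U r → cut r ≤ ι ½ → ∀ i → Obstacle U r i
  obstacle U r isDiam r≤½ i = build (IsDedekind.below-inhabited (isDedekind r))
    where
    build : ∃[ q ] Below (cut r) q → Obstacle U r i
    build (q , q<r) =
      -- A rational below the diameter is exceeded by the distance of some pair, which supplies a
      -- point of `U` to locate it by.
      let (y , _ , y∈U , _) , _ = proj₂ isDiam q q<r
          n , 5+i≤F = freeCount-unbounded (5 ℕ.+ i)
          j , r<½^j , scale = scale-of r r≤½ n
          k , k≤2^j , left , right = grid-search y (½^-pos j) (2 ℕ.^ j)
          mass , 0≤mass , mass≤ , weight≤ = mass-at r i {n} 5+i≤F j scale
      in record
        { level = j ; position = k ; mass = mass ; 0≤mass = 0≤mass ; mass≤ = mass≤ ; weight≤ = weight≤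
        ; near = λ x x∈U N N<2^j N≤x x≤N → Position.near U r isDiam y y∈U (½ ^ℚ j) (½^-pos j) r<½^j k left x x∈U N N≤x x≤N (2 ℕ.^ j) k≤2^j right N<2^j
        }

  module _ (U : ℕ → Subset) (r : ℕ → ℝ) (obstacles : ∀ i → Obstacle (U i) (r i) i)
           (v : ℝ) (hasSum : HasSum (λ i → cut (r i) ^ cut s) (cut v))
           {η : ℚ} (0<η : 0ℚ ℚ.< η) (η-small : (fromℕ 64 ℚ.+ fromℕ 64) ℚ.* η ℚ.< ½ ^ℚ 2) (v<η : Above (cut v) η) where

    open module O (i : ℕ) = Obstacle (obstacles i)
    open MassBound (λ i → ^-disjoint (r i) s) v hasSum 0≤mass mass≤ renaming (mass≤ to total-mass≤)

    weight : ℕ → ℚ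
    weight i = fromℕ 4 ℚ.* ½ ^ℚ F (level i)

    window≤ : ∀ M L → ∑ (λ i → weight (M ℕ.+ i)) L ℚ.≤ fromℕ 64 ℚ.* ∑ (λ i → mass (M ℕ.+ i)) L ℚ.+ ½ ^ℚ (2 ℕ.+ M)
    window≤ M L = begin
      ∑ (λ i → weight (M ℕ.+ i)) L                                                ≤⟨ ∑-mono (λ i → weight≤ (M ℕ.+ i)) L ⟩
      ∑ (λ i → fromℕ 64 ℚ.* mass (M ℕ.+ i) ℚ.+ ½ ^ℚ suc (2 ℕ.+ (M ℕ.+ i))) L      ≡⟨ ∑-+ (λ i → fromℕ 64 ℚ.* mass (M ℕ.+ i)) (λ i → ½ ^ℚ suc (2 ℕ.+ (M ℕ.+ i))) L ⟩
      ∑ (λ i → fromℕ 64 ℚ.* mass (M ℕ.+ i)) L ℚ.+ ∑ (λ i → ½ ^ℚ suc (2 ℕ.+ M ℕ.+ i)) L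
                                                                                  ≤⟨ ℚ.+-mono-≤ (ℚ.≤-reflexive (∑-* (fromℕ 64) (λ i → mass (M ℕ.+ i)) L)) (geometric (2 ℕ.+ M) L) ⟩
      fromℕ 64 ℚ.* ∑ (λ i → mass (M ℕ.+ i)) L ℚ.+ ½ ^ℚ (2 ℕ.+ M)                  ∎
      where open ℚ.≤-Reasoning

    -- The masses add up to at most `2 η` and contribute at most `128 η ≤ 1 / 4`; the allowances
    -- contribute the other `1 / 4`.
    weight-small : ∀ L → ∑ weight L ℚ.≤ ½
    weight-small L = begin
      ∑ weight L                                       ≤⟨ window≤ 0 L ⟩
      fromℕ 64 ℚ.* ∑ mass L ℚ.+ ½ ^ℚ 2                 ≤⟨ ℚ.+-monoˡ-≤ (½ ^ℚ 2) (*-monoʳ-≤ {fromℕ 64} {∑ mass L} {η ℚ.+ η} (0≤fromℕ 64) (total-mass≤ v<η 0<η L)) ⟩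
      fromℕ 64 ℚ.* (η ℚ.+ η) ℚ.+ ½ ^ℚ 2                ≡⟨ cong (ℚ._+ ½ ^ℚ 2) (regroup (fromℕ 64) η) ⟩
      (fromℕ 64 ℚ.+ fromℕ 64) ℚ.* η ℚ.+ ½ ^ℚ 2         ≤⟨ ℚ.+-monoˡ-≤ (½ ^ℚ 2) (ℚ.<⇒≤ η-small) ⟩
      ½ ^ℚ 2 ℚ.+ ½ ^ℚ 2                                ≡⟨ ½^-double 1 ⟩
      ½ ^ℚ 1                                           ≡⟨⟩
      ½                                                ∎
      where
      open ℚ.≤-Reasoning
      regroup : ∀ a h → a ℚ.* (h ℚ.+ h) ≡ (a ℚ.+ a) ℚ.* h
      regroup = solve-∀ ℚ-ring

    weight-tails : HasTails weight
    weight-tails {ε} 0<ε =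
      -- `½ ^ 7` because the factor 64 turns `ε / 128` into `ε / 2`; the allowances take the other
      -- half.
      let N , mass-tail = mass-tails {½ ^ℚ 7 ℚ.* ε} (*-pos (½^-pos 7) 0<ε)
          n , ½^n<½ε = ∃½^-below {½ ℚ.* ε} (*-pos 0<½ 0<ε)
      in N ℕ.+ n , λ L → ℚ.≤-trans (window≤ (N ℕ.+ n) L) (ℚ.≤-trans
           (ℚ.+-mono-≤ (*-monoʳ-≤ {fromℕ 64} (0≤fromℕ 64) (mass-tail (N ℕ.+ n) (ℕ.m≤m+n N n) L))
             (ℚ.≤-trans (½^-antimono-≤ {n} {2 ℕ.+ (N ℕ.+ n)} (ℕ.≤-trans (ℕ.m≤n+m n N) (ℕ.m≤n+m (N ℕ.+ n) 2))) (ℚ.<⇒≤ ½^n<½ε)))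
           (ℚ.≤-reflexive (identity ε)))
      where
      regroup : ∀ a h e → a ℚ.* (½ ℚ.* h ℚ.* e) ℚ.+ ½ ℚ.* e ≡ a ℚ.* h ℚ.* (½ ℚ.* e) ℚ.+ ½ ℚ.* e
      regroup = solve-∀ ℚ-ring
      halves : ∀ e → 1ℚ ℚ.* (½ ℚ.* e) ℚ.+ ½ ℚ.* e ≡ e
      halves = solve-∀ ℚ-ring
      identity : ∀ e → fromℕ 64 ℚ.* (½ ^ℚ 7 ℚ.* e) ℚ.+ ½ ℚ.* e ≡ e
      identity e = trans (regroup (fromℕ 64) (½ ^ℚ 6) e)
        (trans (cong (λ a → a ℚ.* (½ ℚ.* e) ℚ.+ ½ ℚ.* e) (fromℕ[2^n]*½^n≡1 6)) (halves e))

    open Avoidance constraint level (λ i e → position i ℕ.+ e ℕ.∸ 2) weight-small weight-tails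

    uncovered : ¬ (∀ {x} → x ∈ E → ∃[ i ] x ∈ U i)
    uncovered covers =
      let x , x∈E , bounds = points bit bit-respects
          i , x∈U = covers x∈E
          e , e<4 , prefix≡ = near i x x∈U (prefix bit (level i)) (prefix<2^n bit (level i)) (proj₁ (bounds (level i))) (proj₂ (bounds (level i)))
      in bit-avoids i e e<4 prefix≡

  measure≢0 : ¬ IsHausdorffMeasure s E 0ℝ
  measure≢0 (h , premeasure , (h≤0 , _)) = choose (∃½^-below-scaled (fromℕ 64 ℚ.+ fromℕ 64) (½^-pos 2))
    where
    δ : ℝ
    -- Measure zero is needed at a single scale only. With `δ = ½` every diameter is below the scale
    -- of level 0, as `scale-of` requires.
    δ = fromℚ ½
    δ>0 : cut 0ℝ < cut δ
    δ>0 = ℚ.<-dense 0<½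
    module _ {η : ℚ} (0<η : 0ℚ ℚ.< η) (η-small : (fromℕ 64 ℚ.+ fromℕ 64) ℚ.* η ℚ.< ½ ^ℚ 2) where
      h<η : Above (cut (h δ δ>0)) η
      h<η with ℚ.<-dense 0<η
      -- That the premeasure is at most 0 is a negation; locating it between `p` and `η` turns this
      -- into an explicit upper bound.
      ... | p , 0<p , p<η with IsDedekind.located (isDedekind (h δ δ>0)) p<η
      ...   | inj₂ above = above
      ...   | inj₁ below = ⊥-elim (h≤0 (δ , δ>0) (p , 0<p , below))
      from-cover : Σ[ (C , v , _) ∈ (Σ[ C ∈ DeltaCover δ E ] Σ[ v ∈ ℝ ] HasSum (λ i → cut (diam C i) ^ cut s) (cut v)) ] Above (cut v) η → ⊥
      from-cover ((C , v , hasSum) , v<η) = uncovered (member C) (diam C)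
        (λ i → obstacle (member C i) (diam C i) (isDiameter C i) (diam≤δ C i) i) v hasSum 0<η η-small v<η (λ {x} → covers C {x})
    choose : ∃[ n ] (fromℕ 64 ℚ.+ fromℕ 64) ℚ.* ½ ^ℚ n ℚ.< ½ ^ℚ 2 → ⊥
    choose (n , small) = from-cover (½^-pos n) small (proj₂ (premeasure δ δ>0) (½ ^ℚ n) (h<η (½^-pos n) small))

-- For the period m = 2 (1 + w), the free bits have lower density above 1 − 1/(1 + w).
many-free : ∀ (constraint : ℕ → Maybe Bool) {u} w → let m = suc (w ℕ.+ suc w) in u ℕ.≤ w →
            (∀ n → 2 ℕ.* m ℕ.* n ℕ.≤ 2 ℕ.* m ℕ.* freeCount constraint n ℕ.+ (3 ℕ.* n ℕ.+ 2 ℕ.* m ℕ.+ 1)) →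
            ∀ n → u ℕ.* suc (suc n) ℕ.< suc w ℕ.* (freeCount constraint n ℕ.+ 4)
many-free constraint {u} w u≤w large n = ℕ.≤-<-trans (ℕ.*-monoˡ-≤ (suc (suc n)) u≤w)
  (ℕ.*-cancelˡ-≤ 4 (ℕ-lin₁ (n ℕ.+ 4 ℕ.* w ℕ.+ 7) (large n) (identity n w (freeCount constraint n))))
  where
  identity : ∀ n w f → 4 ℕ.* suc (w ℕ.* suc (suc n)) ℕ.+ (2 ℕ.* suc (w ℕ.+ suc w) ℕ.* f ℕ.+ (3 ℕ.* n ℕ.+ 2 ℕ.* suc (w ℕ.+ suc w) ℕ.+ 1)) ℕ.+ (n ℕ.+ 4 ℕ.* w ℕ.+ 7) ≡
             4 ℕ.* (suc w ℕ.* (f ℕ.+ 4)) ℕ.+ 2 ℕ.* suc (w ℕ.+ suc w) ℕ.* n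
  identity = ℕSolver.solve-∀

1≤dimension : ∀ (α : ℝ) → cut 0ℝ < cut α → ∀ (s : ℝ) → cut 0ℝ < cut s → IsHausdorffMeasure s (MaxDigitSet α) 0ℝ → cut 1ℝ ≤ cut s
1≤dimension α α>0 s (t , 0<t , t<s) measure≡0 (t′ , s<t′ , t′<1) = bound (natural-above α)
  where
  -- In lowest terms `t′ = u / (1 + w)`, and `t′ < 1` forces `u ≤ w`, a distance of at least
  -- `1 / (1 + w)` from 1. With period `m = 2 (1 + w)` the forced bits cost only
  -- `3 / (2 m) = 3 / (4 (1 + w))`.
  w : ℕ
  w = ℚ.denominator-1 t′
  u≤w : numerator t′ ℕ.≤ w
  u≤w = ℕ.≤-pred (ℕ.≤-trans (ℕ.≤-reflexive (cong suc (sym (ℕ.*-identityʳ (numerator t′)))))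
    (ℕ.≤-trans (cross-< (ℚ.<-trans 0<t (Below⇒<Above s t<s s<t′)) t′<1) (ℕ.≤-reflexive (ℕ.*-identityˡ (suc w)))))
  module _ (a : ℕ) (floor : ∀ k → ∃[ n ] IsFloor α a k n) where
    open RunLengths α α>0 a floor (w ℕ.+ suc w)
    open Constraint c (w ℕ.+ suc w) sparse
    next : ∀ bit → (∀ n {v} → constraint n ≡ just v → bit n ≡ v) → ∀ n → ∃[ g ] bit (n ℕ.+ g) ≡ true
    next bit respects n = proj₁ (next-one n) , respects _ (proj₁ (proj₂ (next-one n)))
    contradiction : ⊥
    contradiction = LowerBound.measure≢0 (MaxDigitSet α) constraint s 0<t t<s s<t′
      (many-free constraint w u≤w freeCount-large)
      (λ bit respects → Expansion.x bit (next bit respects) , x∈MaxDigitSet bit respects ,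
                        λ n → Expansion.X≤x bit (next bit respects) n , Expansion.x≤X+½^ bit (next bit respects) n)
      measure≡0
  bound : ∃[ a ] Above (cut α) (fromℕ a) → ⊥
  bound (a , α<a) = contradiction a (scaled-floor α α>0 {a} α<a)

corollary1p1 : (α : ℝ) → cut 0ℝ < cut α → IsHausdorffDimension (MaxDigitSet α) 1ℝ
corollary1p1 α α>0 = (λ (s , s>0 , measure≡0) → 1≤dimension α α>0 s s>0 measure≡0)
  , dimension≤1 λ (lift (x>0 , x≤1 , _)) → x>0 , x≤1
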